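{- Fix $\alpha,\beta>0$. For $n\ge3$ let $S$ be a random $\alpha/\beta$-staircase tableau of size $n$ with law $\mathbb{P}_{n,\alpha,\beta}$, and let $A_n^{(3)}$ be the number of boxes $(n-j-1,j)$, $1\le j\le n-2$ (the third main diagonal), that contain $\alpha$. Then, as $n\to\infty$, $A_n^{(3)}$ converges in distribution to a Poisson random variable with parameter $1/2$.
   Context: A staircase tableau of size $n$ has boxes $(i,j)$ with $i,j\ge1$ and $i+j\le n+1$, rows numbered from the top and columns from the left. An $\alpha/\beta$-staircase tableau of size $n$ is a filling in which each box is empty or contains $\alpha$ or $\beta$, such that: all boxes in the same column and above an $\alpha$ are empty; all boxes in the same row and to the left of a $\beta$ are empty; every main-diagonal box (with $i+j=n+1$) contains a symbol. $\overline{\mathcal{S}}_n$ is the set of these. The weight is $wt(S)=\alpha^{N_\alpha}\beta^{N_\beta}$ ($N_\alpha,N_\beta$ the numbers of $\alpha$'s, $\beta$'s), and $\mathbb{P}_{n,\alpha,\beta}(S)=wt(S)/\sum_{T\in\overline{\mathcal{S}}_n}wt(T)$. -}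

module Defs where

open import Level using (0ℓ)
open import Data.Empty using (⊥-elim)
open import Data.Fin.Base as Fin using (Fin; toℕ)
open import Data.Fin.Properties using (all?; _<?_)
import Data.Integer.Base as ℤ
import Data.Integer.Properties as ℤ
open import Data.List.Base as List
  using (List; []; _∷_; foldr; map; filter; length; upTo; cartesianProductWith)
open import Data.List.Membership.Propositional using (_∈_)
open import Data.List.Membership.Propositional.Properties
  using (∈-cartesianProductWith⁺; ∈-filter⁺)
open import Data.List.Relation.Unary.Any using (here; there)
import Data.List.Relation.Unary.All as All
import Data.List.Relation.Unary.AllPairs as AllPairs
open import Data.List.Relation.Unary.Unique.Propositional using (Unique)
import Data.List.Relation.Unary.Unique.Propositional.Properties as Unique
open import Data.Nat.Base as ℕ using (ℕ; zero; suc; _∸_)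
import Data.Nat.Properties as ℕ
open import Data.Product using (Σ; ∃; _×_; _,_; proj₁; proj₂)
open import Data.Rational.Base as ℚ using (ℚ; 0ℚ; 1ℚ; ½; ↥_; ↧_; toℚᵘ)
import Data.Rational.Properties as ℚ
open import Data.Rational.Solver using (module +-*-Solver)
import Data.Rational.Unnormalised.Base as ℚᵘ
import Data.Rational.Unnormalised.Properties as ℚᵘ
open import Data.Sum.Base using (_⊎_; inj₁; inj₂)
open import Data.Vec.Base as Vec using (Vec; []; _∷_; _∷ʳ_; replicate)
open import Relation.Binary.Definitions using (DecidableEquality)
open import Relation.Binary.PropositionalEquality
  using (_≡_; _≢_; refl; sym; trans; cong; cong₂; subst; subst₂)
open import Relation.Nullary using (¬_; Dec; yes; no)
open import Relation.Nullary.Decidable using (_→-dec_; _×-dec_; ¬?)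
open import Relation.Unary using (Pred; Decidable)

open +-*-Solver using (solve; _:=_; _:+_; _:*_; _:-_; :-_; con)

module ℚ-Lemmas where

  ι : ℕ → ℚ
  ι k = ℤ.+ k ℚ./ 1

  recip : ℕ → ℚ
  recip k = ℤ.+ 1 ℚ./ suc k

  toℚᵘ-ι : ∀ k → toℚᵘ (ι k) ℚᵘ.≃ ℚᵘ.mkℚᵘ (ℤ.+ k) 0
  toℚᵘ-ι k = ℚ.toℚᵘ-fromℚᵘ (ℚᵘ.mkℚᵘ (ℤ.+ k) 0)

  ι-mono : ∀ {j k} → j ℕ.≤ k → ι j ℚ.≤ ι k
  ι-mono {j} {k} j≤k = ℚ.toℚᵘ-cancel-≤
    (ℚᵘ.≤-respˡ-≃ (ℚᵘ.≃-sym (toℚᵘ-ι j)) (ℚᵘ.≤-respʳ-≃ (ℚᵘ.≃-sym (toℚᵘ-ι k))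
      (ℚᵘ.*≤* (subst₂ ℤ._≤_ (sym (ℤ.*-identityʳ (ℤ.+ j))) (sym (ℤ.*-identityʳ (ℤ.+ k)))
        (ℤ.+≤+ j≤k)))))

  ι-strict : ∀ {j k} → j ℕ.< k → ι j ℚ.< ι k
  ι-strict {j} {k} j<k = ℚ.toℚᵘ-cancel-<
    (ℚᵘ.<-respˡ-≃ (ℚᵘ.≃-sym (toℚᵘ-ι j)) (ℚᵘ.<-respʳ-≃ (ℚᵘ.≃-sym (toℚᵘ-ι k))
      (ℚᵘ.*<* (subst₂ ℤ._<_ (sym (ℤ.*-identityʳ (ℤ.+ j))) (sym (ℤ.*-identityʳ (ℤ.+ k)))
        (ℤ.+<+ j<k)))))

  ι-pos : ∀ k → 0ℚ ℚ.< ι (suc k)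
  ι-pos k = ℚ.positive⁻¹ _ {{ℚ.normalize-pos (suc k) 1}}

  recip-pos : ∀ k → 0ℚ ℚ.< recip k
  recip-pos k = ℚ.positive⁻¹ _ {{ℚ.normalize-pos 1 (suc k)}}

  ι-recip : ∀ k → ι (suc k) ℚ.* recip k ≡ 1ℚ
  ι-recip k = ℚ.toℚᵘ-injective (ℚᵘ.≃-trans (ℚ.toℚᵘ-homo-* (ι (suc k)) (recip k))
    (ℚᵘ.≃-trans (ℚᵘ.*-cong (toℚᵘ-ι (suc k)) (ℚ.toℚᵘ-fromℚᵘ (ℚᵘ.mkℚᵘ (ℤ.+ 1) k)))
      (ℚᵘ.*≡* (cong (λ j → ℤ.+ suc j) (eq k)))))
    where
    eq : ∀ k → (k ℕ.* 1) ℕ.* 1 ≡ k ℕ.+ 0 ℕ.+ 0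
    eq k = trans (trans (ℕ.*-identityʳ (k ℕ.* 1)) (ℕ.*-identityʳ k))
                 (sym (trans (ℕ.+-identityʳ (k ℕ.+ 0)) (ℕ.+-identityʳ k)))

  ceil : ℚ → ℕ
  ceil q = ℤ.∣ ↥ q ∣

  ≤ceil : ∀ q → q ℚ.≤ ι (ceil q)
  ≤ceil q@(ℚ.mkℚ n d _) = ℚ.toℚᵘ-cancel-≤ (ℚᵘ.≤-respʳ-≃ (ℚᵘ.≃-sym (toℚᵘ-ι ℤ.∣ n ∣))
    (ℚᵘ.*≤* (subst (ℤ._≤ (ℤ.+ ℤ.∣ n ∣ ℤ.* ℤ.+ suc d)) (sym (ℤ.*-identityʳ n)) (lem n))))
    where
    lem : ∀ n → n ℤ.≤ ℤ.+ ℤ.∣ n ∣ ℤ.* ℤ.+ suc d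
    lem (ℤ.+ m)    = subst (ℤ.+ m ℤ.≤_) (ℤ.pos-* m (suc d)) (ℤ.+≤+ (ℕ.m≤m*n m (suc d)))
    lem ℤ.-[1+ m ] = ℤ.-≤+

  abs-≤ : ∀ {p r} → p ℚ.≤ r → ℚ.- p ℚ.≤ r → ℚ.∣ p ∣ ℚ.≤ r
  abs-≤ {p} {r} p≤r -p≤r with ℚ.∣p∣≡p∨∣p∣≡-p p
  ... | inj₁ eq = subst (ℚ._≤ r) (sym eq) p≤r
  ... | inj₂ eq = subst (ℚ._≤ r) (sym eq) -p≤r

  p≤∣p∣ : ∀ p → p ℚ.≤ ℚ.∣ p ∣
  p≤∣p∣ p with ℚ.≤-total 0ℚ p
  ... | inj₁ 0≤p = ℚ.≤-reflexive (sym (ℚ.0≤p⇒∣p∣≡p 0≤p))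
  ... | inj₂ p≤0 = ℚ.≤-trans p≤0 (ℚ.0≤∣p∣ p)

  abs-swap : ∀ p q → ℚ.∣ p ℚ.- q ∣ ≡ ℚ.∣ q ℚ.- p ∣
  abs-swap p q = trans (cong ℚ.∣_∣ (solve 2 (λ p q → p :- q := :- (q :- p)) refl p q))
                       (ℚ.∣-p∣≡∣p∣ (q ℚ.- p))

  abs-split : ∀ p q → ℚ.∣ p ∣ ℚ.≤ ℚ.∣ p ℚ.- q ∣ ℚ.+ ℚ.∣ q ∣
  abs-split p q = subst (λ r → ℚ.∣ r ∣ ℚ.≤ ℚ.∣ p ℚ.- q ∣ ℚ.+ ℚ.∣ q ∣)
    (solve 2 (λ p q → (p :- q) :+ q := p) refl p q) (ℚ.∣p+q∣≤∣p∣+∣q∣ (p ℚ.- q) q)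

  ≤+⇒-≤ : ∀ {p q r} → p ℚ.≤ q ℚ.+ r → p ℚ.- r ℚ.≤ q
  ≤+⇒-≤ {p} {q} {r} h = subst (p ℚ.- r ℚ.≤_)
    (solve 2 (λ q r → (q :+ r) :- r := q) refl q r) (ℚ.+-monoˡ-≤ (ℚ.- r) h)

  abs-abs : ∀ p q → ℚ.∣ ℚ.∣ p ∣ ℚ.- ℚ.∣ q ∣ ∣ ℚ.≤ ℚ.∣ p ℚ.- q ∣
  abs-abs p q = abs-≤ (≤+⇒-≤ (abs-split p q))
    (subst₂ ℚ._≤_
      (solve 2 (λ a b → b :- a := :- (a :- b)) refl ℚ.∣ p ∣ ℚ.∣ q ∣) (abs-swap q p)
      (≤+⇒-≤ (abs-split q p)))

  pos*pos : ∀ p q → 0ℚ ℚ.< p → 0ℚ ℚ.< q → 0ℚ ℚ.< p ℚ.* q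
  pos*pos p q 0<p 0<q =
    ℚ.positive⁻¹ _ {{ℚ.pos*pos⇒pos p {{ℚ.positive 0<p}} q {{ℚ.positive 0<q}}}}

  pos+pos : ∀ p q → 0ℚ ℚ.< p → 0ℚ ℚ.< q → 0ℚ ℚ.< p ℚ.+ q
  pos+pos p q 0<p 0<q =
    ℚ.positive⁻¹ _ {{ℚ.pos+pos⇒pos p {{ℚ.positive 0<p}} q {{ℚ.positive 0<q}}}}

  *-mono-≤ : ∀ p q r s → 0ℚ ℚ.≤ p → 0ℚ ℚ.≤ s → p ℚ.≤ q → r ℚ.≤ s → p ℚ.* r ℚ.≤ q ℚ.* s
  *-mono-≤ p q r s 0≤p 0≤s p≤q r≤s = ℚ.≤-trans
    (ℚ.*-monoˡ-≤-nonNeg p {{ℚ.nonNegative 0≤p}} r≤s)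
    (ℚ.*-monoʳ-≤-nonNeg s {{ℚ.nonNegative 0≤s}} p≤q)

  -- 1/0 is 0.
  inv : ℚ → ℚ
  inv q with q ℚ.≟ 0ℚ
  ... | yes _   = 0ℚ
  ... | no q≢0 = (ℚ.1/ q) {{ℚ.≢-nonZero q≢0}}

  inv-right : ∀ {q} → 0ℚ ℚ.< q → q ℚ.* inv q ≡ 1ℚ
  inv-right {q} 0<q with q ℚ.≟ 0ℚ
  ... | yes q≡0 = ⊥-elim (ℚ.<⇒≢ 0<q (sym q≡0))
  ... | no q≢0 = ℚ.*-inverseʳ q {{ℚ.≢-nonZero q≢0}}

  inv-pos : ∀ {q} → 0ℚ ℚ.< q → 0ℚ ℚ.< inv q
  inv-pos {q} 0<q with q ℚ.≟ 0ℚ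
  ... | yes q≡0 = ⊥-elim (ℚ.<⇒≢ 0<q (sym q≡0))
  ... | no q≢0 = ℚ.positive⁻¹ _ {{ℚ.1/pos⇒pos q {{ℚ.positive 0<q}}}}

  inv-anti : ∀ {p q} → 0ℚ ℚ.< p → p ℚ.≤ q → inv q ℚ.≤ inv p
  inv-anti {p} {q} 0<p p≤q = subst₂ ℚ._≤_
    (trans (solve 3 (λ p p' q' → (p :* p') :* q' := p :* (p' :* q')) refl p (inv p) (inv q))
      (trans (cong (p ℚ.*_) refl)
        (trans (sym (ℚ.*-assoc p (inv p) (inv q)))
          (trans (cong (ℚ._* inv q) (inv-right 0<p)) (ℚ.*-identityˡ _)))))
    (trans (solve 3 (λ q p' q' → q :* (p' :* q') := (q :* q') :* p') refl q (inv p) (inv q))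
      (trans (cong (ℚ._* inv p) (inv-right 0<q)) (ℚ.*-identityˡ _)))
    (subst (ℚ._≤ q ℚ.* (inv p ℚ.* inv q))
      (sym (ℚ.*-assoc p (inv p) (inv q)))
      (ℚ.*-monoʳ-≤-nonNeg (inv p ℚ.* inv q)
        {{ℚ.nonNegative (ℚ.<⇒≤ (pos*pos (inv p) (inv q) (inv-pos 0<p) (inv-pos 0<q)))}} p≤q))
    where 0<q = ℚ.<-≤-trans 0<p p≤q

  halves : ∀ ε → ε ℚ.* ½ ℚ.+ ε ℚ.* ½ ≡ ε
  halves ε = trans (sym (ℚ.*-distribˡ-+ ε ½ ½)) (ℚ.*-identityʳ ε)

  half-pos : ∀ ε → 0ℚ ℚ.< ε → 0ℚ ℚ.< ε ℚ.* ½
  half-pos ε 0<ε = pos*pos ε ½ 0<ε (ℚ.positive⁻¹ ½)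

  0≤+pos : ∀ p → 0ℚ ℚ.≤ p → 0ℚ ℚ.< p ℚ.+ 1ℚ
  0≤+pos p 0≤p = ℚ.positive⁻¹ _ {{ℚ.nonNeg+pos⇒pos p {{ℚ.nonNegative 0≤p}} 1ℚ}}

  split-inv : ∀ B C ε → 0ℚ ℚ.< B ℚ.+ C →
    B ℚ.* (ε ℚ.* inv (B ℚ.+ C)) ℚ.+ (ε ℚ.* inv (B ℚ.+ C)) ℚ.* C ≡ ε
  split-inv B C ε 0<S =
    trans (solve 4 (λ b c e i → b :* (e :* i) :+ (e :* i) :* c := e :* ((b :+ c) :* i)) refl
            B C ε (inv (B ℚ.+ C)))
      (trans (cong (ε ℚ.*_) (inv-right 0<S)) (ℚ.*-identityʳ ε))

  sum-close : ∀ a b c d ε → ℚ.∣ a ℚ.- b ∣ ℚ.< ε ℚ.* ½ → ℚ.∣ c ℚ.- d ∣ ℚ.< ε ℚ.* ½ →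
    ℚ.∣ (a ℚ.+ c) ℚ.- (b ℚ.+ d) ∣ ℚ.< ε
  sum-close a b c d ε h k = ℚ.≤-<-trans
    (subst (λ r → ℚ.∣ r ∣ ℚ.≤ ℚ.∣ a ℚ.- b ∣ ℚ.+ ℚ.∣ c ℚ.- d ∣)
      (solve 4 (λ a b c d → (a :- b) :+ (c :- d) := (a :+ c) :- (b :+ d)) refl a b c d)
      (ℚ.∣p+q∣≤∣p∣+∣q∣ (a ℚ.- b) (c ℚ.- d)))
    (subst (ℚ.∣ a ℚ.- b ∣ ℚ.+ ℚ.∣ c ℚ.- d ∣ ℚ.<_) (halves ε) (ℚ.+-mono-< h k))

  abs-neg : ∀ a b → ℚ.∣ a ℚ.- b ∣ ≡ ℚ.∣ (ℚ.- a) ℚ.- (ℚ.- b) ∣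
  abs-neg a b = trans (sym (ℚ.∣-p∣≡∣p∣ (a ℚ.- b))) (cong ℚ.∣_∣ (ℚ.neg-distrib-+ a (ℚ.- b)))

  product-close : ∀ a b c d B C ε → 0ℚ ℚ.< B → 0ℚ ℚ.< C →
    ℚ.∣ a ∣ ℚ.≤ B → ℚ.∣ d ∣ ℚ.≤ C →
    ℚ.∣ c ℚ.- d ∣ ℚ.< ε ℚ.* inv (B ℚ.+ C) → ℚ.∣ a ℚ.- b ∣ ℚ.< ε ℚ.* inv (B ℚ.+ C) →
    ℚ.∣ a ℚ.* c ℚ.- b ℚ.* d ∣ ℚ.< ε
  product-close a b c d B C ε 0<B 0<C ∣a∣≤B ∣d∣≤C ∣c-d∣<δ ∣a-b∣<δ = ℚ.≤-<-trans split
    (subst (ℚ.∣ a ∣ ℚ.* ℚ.∣ c ℚ.- d ∣ ℚ.+ ℚ.∣ a ℚ.- b ∣ ℚ.* ℚ.∣ d ∣ ℚ.<_)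
      (split-inv B C ε (pos+pos B C 0<B 0<C)) (ℚ.+-mono-< part₁ part₂))
    where
    split : ℚ.∣ a ℚ.* c ℚ.- b ℚ.* d ∣ ℚ.≤
            ℚ.∣ a ∣ ℚ.* ℚ.∣ c ℚ.- d ∣ ℚ.+ ℚ.∣ a ℚ.- b ∣ ℚ.* ℚ.∣ d ∣
    split = subst₂ ℚ._≤_
      (cong ℚ.∣_∣ (solve 4 (λ a b c d → a :* (c :- d) :+ (a :- b) :* d := a :* c :- b :* d) refl
                    a b c d))
      (cong₂ ℚ._+_ (ℚ.∣p*q∣≡∣p∣*∣q∣ a (c ℚ.- d)) (ℚ.∣p*q∣≡∣p∣*∣q∣ (a ℚ.- b) d))
      (ℚ.∣p+q∣≤∣p∣+∣q∣ (a ℚ.* (c ℚ.- d)) ((a ℚ.- b) ℚ.* d))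
    part₁ : ℚ.∣ a ∣ ℚ.* ℚ.∣ c ℚ.- d ∣ ℚ.< B ℚ.* (ε ℚ.* inv (B ℚ.+ C))
    part₁ = ℚ.≤-<-trans
      (ℚ.*-monoʳ-≤-nonNeg ℚ.∣ c ℚ.- d ∣ {{ℚ.∣-∣-nonNeg (c ℚ.- d)}} ∣a∣≤B)
      (ℚ.*-monoʳ-<-pos B {{ℚ.positive 0<B}} ∣c-d∣<δ)
    part₂ : ℚ.∣ a ℚ.- b ∣ ℚ.* ℚ.∣ d ∣ ℚ.< ε ℚ.* inv (B ℚ.+ C) ℚ.* C
    part₂ = ℚ.≤-<-trans
      (ℚ.*-monoˡ-≤-nonNeg ℚ.∣ a ℚ.- b ∣ {{ℚ.∣-∣-nonNeg (a ℚ.- b)}} ∣d∣≤C)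
      (ℚ.*-monoˡ-<-pos C {{ℚ.positive 0<C}} ∣a-b∣<δ)

  inv-close : ∀ a b {δ ε} → 0ℚ ℚ.< ε → 0ℚ ℚ.< δ → δ ℚ.≤ a → δ ℚ.≤ b →
    ℚ.∣ b ℚ.- a ∣ ℚ.< ε ℚ.* (δ ℚ.* δ) → ℚ.∣ inv a ℚ.- inv b ∣ ℚ.< ε
  inv-close a b {δ} {ε} 0<ε 0<δ δ≤a δ≤b ∣b-a∣<η = ℚ.≤-<-trans bound
    (subst (ℚ.∣ b ℚ.- a ∣ ℚ.* (d ℚ.* d) ℚ.<_) (η-eq d (inv-right 0<δ))
      (ℚ.*-monoˡ-<-pos (d ℚ.* d) {{ℚ.positive (pos*pos d d 0<d 0<d)}} ∣b-a∣<η))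
    where
    d : ℚ
    d = inv δ
    0<d : 0ℚ ℚ.< d
    0<d = inv-pos 0<δ
    0<a : 0ℚ ℚ.< a
    0<a = ℚ.<-≤-trans 0<δ δ≤a
    0<b : 0ℚ ℚ.< b
    0<b = ℚ.<-≤-trans 0<δ δ≤b
    η-eq : ∀ d → δ ℚ.* d ≡ 1ℚ → ε ℚ.* (δ ℚ.* δ) ℚ.* (d ℚ.* d) ≡ ε
    η-eq d δd≡1 =
      trans (solve 3 (λ e δ d → (e :* (δ :* δ)) :* (d :* d) := (e :* (δ :* d)) :* (δ :* d))
              refl ε δ d)
        (trans (cong₂ ℚ._*_ (trans (cong (ε ℚ.*_) δd≡1) (ℚ.*-identityʳ ε)) δd≡1)
          (ℚ.*-identityʳ ε))
    diff : ∀ a′ b′ → a ℚ.* a′ ≡ 1ℚ → b ℚ.* b′ ≡ 1ℚ → a′ ℚ.- b′ ≡ (b ℚ.- a) ℚ.* (a′ ℚ.* b′)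
    diff a′ b′ aa′≡1 bb′≡1 = sym (trans
      (solve 4 (λ a b c d → (b :- a) :* (c :* d) := c :* (b :* d) :- (a :* c) :* d) refl
        a b a′ b′)
      (cong₂ ℚ._-_ (trans (cong (a′ ℚ.*_) bb′≡1) (ℚ.*-identityʳ a′))
                   (trans (cong (ℚ._* b′) aa′≡1) (ℚ.*-identityˡ b′))))
    bound : ℚ.∣ inv a ℚ.- inv b ∣ ℚ.≤ ℚ.∣ b ℚ.- a ∣ ℚ.* (d ℚ.* d)
    bound = subst (ℚ._≤ ℚ.∣ b ℚ.- a ∣ ℚ.* (d ℚ.* d))
      (sym (trans (cong ℚ.∣_∣ (diff (inv a) (inv b) (inv-right 0<a) (inv-right 0<b)))
        (trans (ℚ.∣p*q∣≡∣p∣*∣q∣ (b ℚ.- a) (inv a ℚ.* inv b))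
          (cong (ℚ.∣ b ℚ.- a ∣ ℚ.*_)
            (ℚ.0≤p⇒∣p∣≡p (ℚ.<⇒≤ (pos*pos (inv a) (inv b) (inv-pos 0<a) (inv-pos 0<b))))))))
      (ℚ.*-monoˡ-≤-nonNeg ℚ.∣ b ℚ.- a ∣ {{ℚ.∣-∣-nonNeg (b ℚ.- a)}}
        (*-mono-≤ (inv a) d (inv b) d (ℚ.<⇒≤ (inv-pos 0<a)) (ℚ.<⇒≤ 0<d) (inv-anti 0<δ δ≤a) (inv-anti 0<δ δ≤b)))

  +pos≤⇒< : ∀ p q δ → 0ℚ ℚ.< δ → p ℚ.+ δ ℚ.≤ q → p ℚ.< q
  +pos≤⇒< p q δ 0<δ le =
    ℚ.<-≤-trans (subst (ℚ._< p ℚ.+ δ) (ℚ.+-identityʳ p) (ℚ.+-monoʳ-< p 0<δ)) le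

  0≤-+ : ∀ p q δ η → 0ℚ ℚ.+ δ ℚ.≤ p → 0ℚ ℚ.+ η ℚ.≤ q → 0ℚ ℚ.+ (δ ℚ.+ η) ℚ.≤ p ℚ.+ q
  0≤-+ p q δ η δ≤p η≤q = subst (ℚ._≤ p ℚ.+ q)
    (trans (cong₂ ℚ._+_ (ℚ.+-identityˡ δ) (ℚ.+-identityˡ η)) (sym (ℚ.+-identityˡ (δ ℚ.+ η))))
    (ℚ.+-mono-≤ δ≤p η≤q)

  0≤-* : ∀ p q δ η → 0ℚ ℚ.< δ → 0ℚ ℚ.< η →
    0ℚ ℚ.+ δ ℚ.≤ p → 0ℚ ℚ.+ η ℚ.≤ q → 0ℚ ℚ.+ (δ ℚ.* η) ℚ.≤ p ℚ.* q
  0≤-* p q δ η 0<δ 0<η δ≤p η≤q = subst (ℚ._≤ p ℚ.* q) (sym (ℚ.+-identityˡ (δ ℚ.* η)))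
    (*-mono-≤ δ p η q (ℚ.<⇒≤ 0<δ) (ℚ.≤-trans (ℚ.<⇒≤ 0<η) η≤q′)
      (subst (ℚ._≤ p) (ℚ.+-identityˡ δ) δ≤p) η≤q′)
    where
    η≤q′ : η ℚ.≤ q
    η≤q′ = subst (ℚ._≤ q) (ℚ.+-identityˡ η) η≤q

  0≤* : ∀ p q → 0ℚ ℚ.≤ p → 0ℚ ℚ.≤ q → 0ℚ ℚ.≤ p ℚ.* q
  0≤* p q 0≤p 0≤q = ℚ.nonNegative⁻¹ _
    {{ℚ.nonNeg*nonNeg⇒nonNeg p {{ℚ.nonNegative 0≤p}} q {{ℚ.nonNegative 0≤q}}}}

  0≤+ : ∀ p q → 0ℚ ℚ.≤ p → 0ℚ ℚ.≤ q → 0ℚ ℚ.≤ p ℚ.+ q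
  0≤+ p q 0≤p 0≤q = ℚ.nonNegative⁻¹ _
    {{ℚ.nonNeg+nonNeg⇒nonNeg p {{ℚ.nonNegative 0≤p}} q {{ℚ.nonNegative 0≤q}}}}

  p≤p+q : ∀ p q → 0ℚ ℚ.≤ q → p ℚ.≤ p ℚ.+ q
  p≤p+q p q 0≤q = subst (ℚ._≤ p ℚ.+ q) (ℚ.+-identityʳ p) (ℚ.+-monoʳ-≤ p 0≤q)

  absorb : ∀ i t a r → i ℚ.* r ≡ 1ℚ → i ℚ.* (t ℚ.* (a ℚ.* r)) ≡ a ℚ.* t
  absorb i t a r ir≡1 = trans
    (solve 4 (λ i t a r → i :* (t :* (a :* r)) := (a :* t) :* (i :* r)) refl i t a r)
    (trans (cong (a ℚ.* t ℚ.*_) ir≡1) (ℚ.*-identityʳ (a ℚ.* t)))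

  half-step : ∀ i u t a → 0ℚ ℚ.< i → 0ℚ ℚ.≤ t → i ℚ.* u ≡ a ℚ.* t → a ℚ.+ a ℚ.≤ i →
    u ℚ.+ u ℚ.≤ t
  half-step i u t a 0<i 0≤t iu≡at 2a≤i = ℚ.*-cancelˡ-≤-pos i {{ℚ.positive 0<i}}
    (subst (ℚ._≤ i ℚ.* t)
      (trans (ℚ.*-distribʳ-+ t a a)
        (trans (cong₂ ℚ._+_ (sym iu≡at) (sym iu≡at)) (sym (ℚ.*-distribˡ-+ i u u))))
      (ℚ.*-monoʳ-≤-nonNeg t {{ℚ.nonNegative 0≤t}} 2a≤i))

  tail-step : ∀ s x z t u → ℚ.∣ x ∣ ≡ t → u ℚ.+ u ℚ.≤ t →
    ℚ.∣ (s ℚ.+ x) ℚ.- z ∣ ℚ.+ (u ℚ.+ u) ℚ.≤ ℚ.∣ s ℚ.- z ∣ ℚ.+ (t ℚ.+ t)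
  tail-step s x z t u ∣x∣≡t 2u≤t = subst
    (ℚ.∣ (s ℚ.+ x) ℚ.- z ∣ ℚ.+ (u ℚ.+ u) ℚ.≤_) (ℚ.+-assoc ℚ.∣ s ℚ.- z ∣ t t)
    (ℚ.+-mono-≤
      (subst₂ ℚ._≤_
        (cong ℚ.∣_∣ (solve 3 (λ s x z → (s :- z) :+ x := (s :+ x) :- z) refl s x z))
        (cong (ℚ.∣ s ℚ.- z ∣ ℚ.+_) ∣x∣≡t)
        (ℚ.∣p+q∣≤∣p∣+∣q∣ (s ℚ.- z) x))
      2u≤t)

  archimedean : ∀ C t i ε → 0ℚ ℚ.< ε → (C ℚ.+ C) ℚ.* inv ε ℚ.< i → i ℚ.* t ℚ.≤ C →
    0ℚ ℚ.< i → t ℚ.+ t ℚ.< ε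
  archimedean C t i ε 0<ε 2C/ε<i it≤C 0<i = ℚ.*-cancelˡ-<-nonNeg i
    {{ℚ.nonNegative (ℚ.<⇒≤ 0<i)}}
    (ℚ.≤-<-trans
      (subst (ℚ._≤ C ℚ.+ C) (sym (ℚ.*-distribˡ-+ i t t)) (ℚ.+-mono-≤ it≤C it≤C))
      (subst (ℚ._< i ℚ.* ε) 2C-eq (ℚ.*-monoˡ-<-pos ε {{ℚ.positive 0<ε}} 2C/ε<i)))
    where
    2C-eq : (C ℚ.+ C) ℚ.* inv ε ℚ.* ε ≡ C ℚ.+ C
    2C-eq = trans (ℚ.*-assoc (C ℚ.+ C) (inv ε) ε)
      (trans (cong ((C ℚ.+ C) ℚ.*_) (trans (ℚ.*-comm (inv ε) ε) (inv-right 0<ε)))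
        (ℚ.*-identityʳ (C ℚ.+ C)))

  close⇒≤ : ∀ p q → ℚ.∣ p ℚ.- q ∣ ℚ.< 1ℚ → p ℚ.+ 1ℚ ℚ.≤ (q ℚ.+ 1ℚ) ℚ.+ 1ℚ
  close⇒≤ p q h = ℚ.+-monoˡ-≤ 1ℚ (subst₂ ℚ._≤_
    (solve 2 (λ p q → (p :- q) :+ q := p) refl p q) (ℚ.+-comm 1ℚ q)
    (ℚ.+-monoˡ-≤ q (ℚ.≤-trans (p≤∣p∣ (p ℚ.- q)) (ℚ.<⇒≤ h))))

open ℚ-Lemmas

-- Cauchy sequences of rationals, not quotiented: x and y denote the same real
-- number when neither x <ℝ y nor y <ℝ x.
record ℝ : Set where
  constructor mkℝ
  field
    seq    : ℕ → ℚ
    cauchy : ∀ ε → 0ℚ ℚ.< ε →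
             ∃ λ N → ∀ m n → N ℕ.≤ m → N ℕ.≤ n → ℚ.∣ seq m ℚ.- seq n ∣ ℚ.< ε

open ℝ public

infix  4 _<ℝ_ _≤ℝ_ _#_
infixl 6 _+ℝ_ _-ℝ_
infixl 7 _*ℝ_
infixr 8 _^ℝ_

_<ℝ_ : ℝ → ℝ → Set
x <ℝ y = ∃ λ δ → 0ℚ ℚ.< δ × ∃ λ N → ∀ n → N ℕ.≤ n → seq x n ℚ.+ δ ℚ.≤ seq y n

_≤ℝ_ : ℝ → ℝ → Set
x ≤ℝ y = ¬ (y <ℝ x)

-- The constructive meaning of x ≠ y.
_#_ : ℝ → ℝ → Set
x # y = x <ℝ y ⊎ y <ℝ x

fromℚ : ℚ → ℝ
fromℚ q .seq _ = q
fromℚ q .cauchy ε 0<ε = 0 , λ _ _ _ _ → subst (λ r → ℚ.∣ r ∣ ℚ.< ε) (sym (ℚ.+-inverseʳ q)) 0<ε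

fromℕ : ℕ → ℝ
fromℕ k = fromℚ (ι k)

0ℝ 1ℝ : ℝ
0ℝ = fromℚ 0ℚ
1ℝ = fromℚ 1ℚ

_+ℝ_ : ℝ → ℝ → ℝ
(x +ℝ y) .seq n = seq x n ℚ.+ seq y n
(x +ℝ y) .cauchy ε 0<ε = N , λ m n m≥ n≥ →
  sum-close (seq x m) (seq x n) (seq y m) (seq y n) ε
    (proj₂ cx m n (ℕ.≤-trans (ℕ.m≤m⊔n _ _) m≥) (ℕ.≤-trans (ℕ.m≤m⊔n _ _) n≥))
    (proj₂ cy m n (ℕ.≤-trans (ℕ.m≤n⊔m (proj₁ cx) _) m≥) (ℕ.≤-trans (ℕ.m≤n⊔m (proj₁ cx) _) n≥))
  where
  cx = cauchy x (ε ℚ.* ½) (half-pos ε 0<ε)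
  cy = cauchy y (ε ℚ.* ½) (half-pos ε 0<ε)
  N : ℕ
  N = proj₁ cx ℕ.⊔ proj₁ cy

-ℝ_ : ℝ → ℝ
(-ℝ x) .seq n = ℚ.- seq x n
(-ℝ x) .cauchy ε 0<ε = proj₁ c , λ m n m≥ n≥ →
  subst (ℚ._< ε) (abs-neg (seq x m) (seq x n)) (proj₂ c m n m≥ n≥)
  where c = cauchy x ε 0<ε

_-ℝ_ : ℝ → ℝ → ℝ
x -ℝ y = x +ℝ (-ℝ y)

∣_∣ℝ : ℝ → ℝ
∣ x ∣ℝ .seq n = ℚ.∣ seq x n ∣
∣ x ∣ℝ .cauchy ε 0<ε = proj₁ c , λ m n m≥ n≥ →
  ℚ.≤-<-trans (abs-abs (seq x m) (seq x n)) (proj₂ c m n m≥ n≥)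
  where c = cauchy x ε 0<ε

eventually-bounded : ∀ x → ∃ λ B → 0ℚ ℚ.< B × ∃ λ N → ∀ n → N ℕ.≤ n → ℚ.∣ seq x n ∣ ℚ.≤ B
eventually-bounded x with cauchy x 1ℚ (ℚ.positive⁻¹ 1ℚ)
... | N , h = ℚ.∣ seq x N ∣ ℚ.+ 1ℚ , 0≤+pos ℚ.∣ seq x N ∣ (ℚ.0≤∣p∣ (seq x N)) , N , λ n n≥ →
  ℚ.≤-trans (abs-split (seq x n) (seq x N))
    (subst (ℚ.∣ seq x n ℚ.- seq x N ∣ ℚ.+ ℚ.∣ seq x N ∣ ℚ.≤_) (ℚ.+-comm 1ℚ ℚ.∣ seq x N ∣)
      (ℚ.+-monoˡ-≤ ℚ.∣ seq x N ∣ (ℚ.<⇒≤ (h n N n≥ ℕ.≤-refl))))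

_*ℝ_ : ℝ → ℝ → ℝ
(x *ℝ y) .seq n = seq x n ℚ.* seq y n
(x *ℝ y) .cauchy = product-cauchy (eventually-bounded x) (eventually-bounded y)
  where
  Bounded : ℝ → Set
  Bounded x = ∃ λ B → 0ℚ ℚ.< B × ∃ λ N → ∀ n → N ℕ.≤ n → ℚ.∣ seq x n ∣ ℚ.≤ B
  product-cauchy : Bounded x → Bounded y → ∀ ε → 0ℚ ℚ.< ε → ∃ λ N → ∀ m n → N ℕ.≤ m → N ℕ.≤ n →
    ℚ.∣ seq x m ℚ.* seq y m ℚ.- seq x n ℚ.* seq y n ∣ ℚ.< ε
  product-cauchy (B , 0<B , M₁ , hB) (C , 0<C , M₂ , hC) ε 0<ε = N , λ m n m≥ n≥ →
    product-close (seq x m) (seq x n) (seq y m) (seq y n) B C ε 0<B 0<C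
      (hB m (ℕ.≤-trans N₁ m≥)) (hC n (ℕ.≤-trans N₂ n≥))
      (proj₂ cy m n (ℕ.≤-trans N₄ m≥) (ℕ.≤-trans N₄ n≥))
      (proj₂ cx m n (ℕ.≤-trans N₃ m≥) (ℕ.≤-trans N₃ n≥))
    where
    0<δ : 0ℚ ℚ.< ε ℚ.* inv (B ℚ.+ C)
    0<δ = pos*pos ε (inv (B ℚ.+ C)) 0<ε (inv-pos (pos+pos B C 0<B 0<C))
    cx = cauchy x (ε ℚ.* inv (B ℚ.+ C)) 0<δ
    cy = cauchy y (ε ℚ.* inv (B ℚ.+ C)) 0<δ
    M₃ M₄ N : ℕ
    M₃ = proj₁ cx
    M₄ = proj₁ cy
    N = (M₁ ℕ.⊔ M₂) ℕ.⊔ (M₃ ℕ.⊔ M₄)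
    N₁ : M₁ ℕ.≤ N
    N₁ = ℕ.≤-trans (ℕ.m≤m⊔n M₁ M₂) (ℕ.m≤m⊔n _ _)
    N₂ : M₂ ℕ.≤ N
    N₂ = ℕ.≤-trans (ℕ.m≤n⊔m M₁ M₂) (ℕ.m≤m⊔n _ _)
    N₃ : M₃ ℕ.≤ N
    N₃ = ℕ.≤-trans (ℕ.m≤m⊔n M₃ M₄) (ℕ.m≤n⊔m (M₁ ℕ.⊔ M₂) _)
    N₄ : M₄ ℕ.≤ N
    N₄ = ℕ.≤-trans (ℕ.m≤n⊔m M₃ M₄) (ℕ.m≤n⊔m (M₁ ℕ.⊔ M₂) _)

recipℝ : ∀ x → 0ℝ <ℝ x → ℝ
recipℝ x _ .seq n = inv (seq x n)
recipℝ x (δ , 0<δ , M , h) .cauchy ε 0<ε = N , close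
  where
  cx = cauchy x (ε ℚ.* (δ ℚ.* δ)) (pos*pos ε (δ ℚ.* δ) 0<ε (pos*pos δ δ 0<δ 0<δ))
  N : ℕ
  N = M ℕ.⊔ proj₁ cx
  close : ∀ m n → N ℕ.≤ m → N ℕ.≤ n → ℚ.∣ inv (seq x m) ℚ.- inv (seq x n) ∣ ℚ.< ε
  close m n m≥ n≥ = inv-close (seq x m) (seq x n) {δ} {ε} 0<ε 0<δ
    (subst (ℚ._≤ seq x m) (ℚ.+-identityˡ δ) (h m (ℕ.≤-trans (ℕ.m≤m⊔n M _) m≥)))
    (subst (ℚ._≤ seq x n) (ℚ.+-identityˡ δ) (h n (ℕ.≤-trans (ℕ.m≤m⊔n M _) n≥)))
    (proj₂ cx n m (ℕ.≤-trans (ℕ.m≤n⊔m M _) n≥) (ℕ.≤-trans (ℕ.m≤n⊔m M _) m≥))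

_^ℝ_ : ℝ → ℕ → ℝ
x ^ℝ zero  = 1ℝ
x ^ℝ suc k = x *ℝ x ^ℝ k

∑ : {A : Set} → List A → (A → ℝ) → ℝ
∑ xs f = foldr (λ a s → f a +ℝ s) 0ℝ xs

_⟶_ : (ℕ → ℝ) → ℝ → Set
s ⟶ L = ∀ ε → 0ℝ <ℝ ε → ∃ λ N → ∀ n → N ℕ.≤ n → ∣ s n -ℝ L ∣ℝ <ℝ ε

infix 4 _⟶_

<ℝ-asym : ∀ x y → x <ℝ y → ¬ (y <ℝ x)
<ℝ-asym x y (δ , 0<δ , M , h) (η , 0<η , N , k) = ℚ.<-irrefl refl
  (ℚ.<-trans (+pos≤⇒< (seq x K) (seq y K) δ 0<δ (h K (ℕ.m≤m⊔n M N)))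
             (+pos≤⇒< (seq y K) (seq x K) η 0<η (k K (ℕ.m≤n⊔m M N))))
  where
  K : ℕ
  K = M ℕ.⊔ N

#⇒≤? : ∀ x y → x # y → Dec (y ≤ℝ x)
#⇒≤? x y (inj₁ x<y) = no λ y≤x → y≤x x<y
#⇒≤? x y (inj₂ y<x) = yes (<ℝ-asym y x y<x)

0<1ℝ : 0ℝ <ℝ 1ℝ
0<1ℝ = 1ℚ , ℚ.positive⁻¹ 1ℚ , 0 , λ _ _ → ℚ.≤-refl

0<+ : ∀ x y → 0ℝ <ℝ x → 0ℝ <ℝ y → 0ℝ <ℝ x +ℝ y
0<+ x y (δ , 0<δ , M , h) (η , 0<η , N , k) =
  δ ℚ.+ η , pos+pos δ η 0<δ 0<η , M ℕ.⊔ N , λ n n≥ →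
    0≤-+ (seq x n) (seq y n) δ η
      (h n (ℕ.≤-trans (ℕ.m≤m⊔n M N) n≥)) (k n (ℕ.≤-trans (ℕ.m≤n⊔m M N) n≥))

0<* : ∀ x y → 0ℝ <ℝ x → 0ℝ <ℝ y → 0ℝ <ℝ x *ℝ y
0<* x y (δ , 0<δ , M , h) (η , 0<η , N , k) =
  δ ℚ.* η , pos*pos δ η 0<δ 0<η , M ℕ.⊔ N , λ n n≥ →
    0≤-* (seq x n) (seq y n) δ η 0<δ 0<η
      (h n (ℕ.≤-trans (ℕ.m≤m⊔n M N) n≥)) (k n (ℕ.≤-trans (ℕ.m≤n⊔m M N) n≥))

0<^ : ∀ x → 0ℝ <ℝ x → ∀ k → 0ℝ <ℝ x ^ℝ k
0<^ x 0<x zero    = 0<1ℝ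
0<^ x 0<x (suc k) = 0<* x (x ^ℝ k) 0<x (0<^ x 0<x k)

0<∑ : {A : Set} (f : A → ℝ) → (∀ a → 0ℝ <ℝ f a) → ∀ {a} xs → a ∈ xs → 0ℝ <ℝ ∑ xs f
0<∑ f 0<f (x ∷ []) _ with 0<f x
... | δ , 0<δ , N , h = δ , 0<δ , N , λ n n≥ →
  subst (0ℚ ℚ.+ δ ℚ.≤_) (sym (ℚ.+-identityʳ (seq (f x) n))) (h n n≥)
0<∑ f 0<f (x ∷ y ∷ ys) _ =
  0<+ (f x) (∑ (y ∷ ys) f) (0<f x) (0<∑ f 0<f (y ∷ ys) (here refl))

-- q ^ k / k !
expTerm : ℚ → ℕ → ℚ
expTerm q zero    = 1ℚ
expTerm q (suc k) = expTerm q k ℚ.* (q ℚ.* (ℤ.+ 1 ℚ./ suc k))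

expSum : ℚ → ℕ → ℚ
expSum q zero    = 0ℚ
expSum q (suc n) = expSum q n ℚ.+ expTerm q n

module ExpCauchy (q : ℚ) where

  a : ℚ
  a = ℚ.∣ q ∣

  0≤a : 0ℚ ℚ.≤ a
  0≤a = ℚ.0≤∣p∣ q

  N : ℕ
  N = ceil (a ℚ.+ a)

  t : ℕ → ℚ
  t = expTerm a

  0≤t : ∀ k → 0ℚ ℚ.≤ t k
  0≤t zero    = ℚ.nonNegative⁻¹ 1ℚ
  0≤t (suc k) = 0≤* (t k) (a ℚ.* recip k) (0≤t k) (0≤* a (recip k) 0≤a (ℚ.<⇒≤ (recip-pos k)))

  ∣term∣ : ∀ k → ℚ.∣ expTerm q k ∣ ≡ t k
  ∣term∣ zero    = refl
  ∣term∣ (suc k) = trans (ℚ.∣p*q∣≡∣p∣*∣q∣ (expTerm q k) (q ℚ.* recip k))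
    (cong₂ ℚ._*_ (∣term∣ k)
      (trans (ℚ.∣p*q∣≡∣p∣*∣q∣ q (recip k))
        (cong (a ℚ.*_) (ℚ.0≤p⇒∣p∣≡p (ℚ.<⇒≤ (recip-pos k))))))

  suc*t : ∀ k → ι (suc k) ℚ.* t (suc k) ≡ a ℚ.* t k
  suc*t k = absorb (ι (suc k)) (t k) a (recip k) (ι-recip k)

  2a≤ι : ∀ k → N ℕ.≤ k → a ℚ.+ a ℚ.≤ ι k
  2a≤ι k N≤k = ℚ.≤-trans (≤ceil (a ℚ.+ a)) (ι-mono N≤k)

  halving : ∀ k → N ℕ.≤ k → t (suc k) ℚ.+ t (suc k) ℚ.≤ t k
  halving k N≤k = half-step (ι (suc k)) (t (suc k)) (t k) a (ι-pos k) (0≤t k) (suc*t k)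
    (2a≤ι (suc k) (ℕ.m≤n⇒m≤1+n N≤k))

  C : ℚ
  C = ι N ℚ.* t N

  decay : ∀ d → ι (d ℕ.+ N) ℚ.* t (d ℕ.+ N) ℚ.≤ C
  decay zero    = ℚ.≤-refl
  decay (suc d) = ℚ.≤-trans (ℚ.≤-reflexive (suc*t (d ℕ.+ N)))
    (ℚ.≤-trans
      (*-mono-≤ a (ι (d ℕ.+ N)) (t (d ℕ.+ N)) (t (d ℕ.+ N)) 0≤a (0≤t (d ℕ.+ N))
        (ℚ.≤-trans (p≤p+q a a 0≤a) (2a≤ι (d ℕ.+ N) (ℕ.m≤n+m N d))) ℚ.≤-refl)
      (decay d))

  tail : ∀ m d → N ℕ.≤ m →
    ℚ.∣ expSum q (d ℕ.+ m) ℚ.- expSum q m ∣ ℚ.+ (t (d ℕ.+ m) ℚ.+ t (d ℕ.+ m)) ℚ.≤ t m ℚ.+ t m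
  tail m zero    N≤m = ℚ.≤-reflexive
    (trans (cong (λ r → ℚ.∣ r ∣ ℚ.+ (t m ℚ.+ t m)) (ℚ.+-inverseʳ (expSum q m)))
           (ℚ.+-identityˡ (t m ℚ.+ t m)))
  tail m (suc d) N≤m = ℚ.≤-trans
    (tail-step (expSum q (d ℕ.+ m)) (expTerm q (d ℕ.+ m)) (expSum q m)
      (t (d ℕ.+ m)) (t (suc (d ℕ.+ m))) (∣term∣ (d ℕ.+ m))
      (halving (d ℕ.+ m) (ℕ.≤-trans N≤m (ℕ.m≤n+m m d))))
    (tail m d N≤m)

  tail′ : ∀ m n → N ℕ.≤ m → m ℕ.≤ n → ℚ.∣ expSum q n ℚ.- expSum q m ∣ ℚ.≤ t m ℚ.+ t m
  tail′ m n N≤m m≤n = subst (λ k → ℚ.∣ expSum q k ℚ.- expSum q m ∣ ℚ.≤ t m ℚ.+ t m)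
    (ℕ.m∸n+n≡m m≤n)
    (ℚ.≤-trans (p≤p+q ℚ.∣ expSum q (n ∸ m ℕ.+ m) ℚ.- expSum q m ∣ (u ℚ.+ u) (0≤+ u u 0≤u 0≤u))
      (tail m (n ∸ m) N≤m))
    where
    u : ℚ
    u = t (n ∸ m ℕ.+ m)
    0≤u : 0ℚ ℚ.≤ u
    0≤u = 0≤t (n ∸ m ℕ.+ m)

  small : ∀ ε → 0ℚ ℚ.< ε → ∀ m → suc (ceil ((C ℚ.+ C) ℚ.* inv ε)) ℕ.⊔ N ℕ.≤ m → t m ℚ.+ t m ℚ.< ε
  small ε 0<ε m h = archimedean C (t m) (ι m) ε 0<ε
    (ℚ.≤-<-trans (≤ceil ((C ℚ.+ C) ℚ.* inv ε))
      (ι-strict (ℕ.≤-trans (ℕ.m≤m⊔n _ N) h)))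
    (subst (λ k → ι k ℚ.* t k ℚ.≤ C) (ℕ.m∸n+n≡m N≤m) (decay (m ∸ N)))
    (ι-strict (ℕ.≤-trans (ℕ.s≤s ℕ.z≤n) (ℕ.≤-trans (ℕ.m≤m⊔n _ N) h)))
    where
    N≤m : N ℕ.≤ m
    N≤m = ℕ.≤-trans (ℕ.m≤n⊔m (suc (ceil ((C ℚ.+ C) ℚ.* inv ε))) N) h

  expSum-cauchy : ∀ ε → 0ℚ ℚ.< ε →
    ∃ λ M → ∀ m n → M ℕ.≤ m → M ℕ.≤ n → ℚ.∣ expSum q m ℚ.- expSum q n ∣ ℚ.< ε
  expSum-cauchy ε 0<ε = M , close
    where
    M : ℕ
    M = suc (ceil ((C ℚ.+ C) ℚ.* inv ε)) ℕ.⊔ N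
    N≤M : N ℕ.≤ M
    N≤M = ℕ.m≤n⊔m (suc (ceil ((C ℚ.+ C) ℚ.* inv ε))) N
    close : ∀ m n → M ℕ.≤ m → M ℕ.≤ n → ℚ.∣ expSum q m ℚ.- expSum q n ∣ ℚ.< ε
    close m n m≥ n≥ with ℕ.≤-total m n
    ... | inj₁ m≤n = subst (ℚ._< ε) (abs-swap (expSum q n) (expSum q m))
      (ℚ.≤-<-trans (tail′ m n (ℕ.≤-trans N≤M m≥) m≤n) (small ε 0<ε m m≥))
    ... | inj₂ n≤m = ℚ.≤-<-trans (tail′ n m (ℕ.≤-trans N≤M n≥) n≤m) (small ε 0<ε n n≥)

exp : ℚ → ℝ
exp q .seq    = expSum q
exp q .cauchy = ExpCauchy.expSum-cauchy q

-- e^(-q) · q ^ k / k !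
poissonPMF : ℚ → ℕ → ℝ
poissonPMF q k = exp (ℚ.- q) *ℝ fromℚ (expTerm q k)

_∉ℕ : ℝ → Set
x ∉ℕ = ∀ k → x # fromℕ k

-- A law on ℕ is given through x ↦ ℙ(X ≤ x) on the reals x ∉ ℕ. There the event
-- X ≤ x is decidable. If every k ∈ ℕ is an atom of the law, as for a Poisson law
-- of positive parameter, then these x are exactly the continuity points of its
-- distribution function.
DistributionFunction : Set
DistributionFunction = ∀ x → x ∉ℕ → ℝ

_≤?[_,_] : ∀ k x → x ∉ℕ → Dec (fromℕ k ≤ℝ x)
k ≤?[ x , x∉ℕ ] = #⇒≤? x (fromℕ k) (x∉ℕ k)

infix 4 _⟶ᵈ_

_⟶ᵈ_ : (ℕ → DistributionFunction) → DistributionFunction → Set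
F ⟶ᵈ G = ∀ x x∉ℕ → (λ n → F n x x∉ℕ) ⟶ G x x∉ℕ

upperBound : ℝ → ℕ
upperBound x = ceil (seq x (proj₁ (cauchy x 1ℚ (ℚ.positive⁻¹ 1ℚ))) ℚ.+ 1ℚ ℚ.+ 1ℚ)

x<upperBound : ∀ x → x <ℝ fromℕ (upperBound x)
x<upperBound x = 1ℚ , ℚ.positive⁻¹ 1ℚ , N , λ n n≥ →
  ℚ.≤-trans (close⇒≤ (seq x n) (seq x N) (proj₂ c n N n≥ ℕ.≤-refl))
    (≤ceil (seq x N ℚ.+ 1ℚ ℚ.+ 1ℚ))
  where
  c = cauchy x 1ℚ (ℚ.positive⁻¹ 1ℚ)
  N : ℕ
  N = proj₁ c

-- ∑ of the mass function over all k ∈ ℕ with k ≤ x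
Poisson : ℚ → DistributionFunction
Poisson q x x∉ℕ = ∑ (filter (_≤?[ x , x∉ℕ ]) (upTo (upperBound x))) (poissonPMF q)

data Symbol : Set where
  empty alpha beta : Symbol

infix 4 _≟_

_≟_ : DecidableEquality Symbol
empty ≟ empty = yes refl
empty ≟ alpha = no λ ()
empty ≟ beta  = no λ ()
alpha ≟ empty = no λ ()
alpha ≟ alpha = yes refl
alpha ≟ beta  = no λ ()
beta  ≟ empty = no λ ()
beta  ≟ alpha = no λ ()
beta  ≟ beta  = yes refl

-- Rows from top to bottom; the row numbered i from 0 has n - i boxes.
data Filling : ℕ → Set where
  []  : Filling 0
  _∷_ : ∀ {n} → Vec Symbol (suc n) → Filling n → Filling (suc n)

entry : ∀ {m} → Vec Symbol m → ℕ → Symbol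
entry []      _       = empty
entry (s ∷ _) zero    = s
entry (_ ∷ r) (suc j) = entry r j

infix 9 _[_,_]

-- The content of the box in row i and column j, numbered from 0, so that the
-- boxes are the (i , j) with i + j < n; outside the shape the value is empty.
_[_,_] : ∀ {n} → Filling n → ℕ → ℕ → Symbol
[]      [ _     , _ ] = empty
(r ∷ _) [ zero  , j ] = entry r j
(_ ∷ T) [ suc i , j ] = T [ i , j ]

EmptyAboveα EmptyLeftOfβ FullDiagonal : ∀ {n} → Filling n → Set
EmptyAboveα {n} T = ∀ (i j : Fin n) → T [ toℕ i , toℕ j ] ≡ alpha →
  ∀ (k : Fin n) → k Fin.< i → T [ toℕ k , toℕ j ] ≡ empty
EmptyLeftOfβ {n} T = ∀ (i j : Fin n) → T [ toℕ i , toℕ j ] ≡ beta →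
  ∀ (k : Fin n) → k Fin.< j → T [ toℕ i , toℕ k ] ≡ empty
FullDiagonal {n} T = ∀ (i j : Fin n) → suc (toℕ i ℕ.+ toℕ j) ≡ n → T [ toℕ i , toℕ j ] ≢ empty

IsTableau : ∀ {n} → Filling n → Set
IsTableau T = EmptyAboveα T × EmptyLeftOfβ T × FullDiagonal T

isTableau? : ∀ {n} → Decidable (IsTableau {n})
isTableau? {n} T =
  all? (λ i → all? λ j → (T [ toℕ i , toℕ j ] ≟ alpha) →-dec
    all? λ k → (k <? i) →-dec (T [ toℕ k , toℕ j ] ≟ empty)) ×-dec
  all? (λ i → all? λ j → (T [ toℕ i , toℕ j ] ≟ beta) →-dec
    all? λ k → (k <? j) →-dec (T [ toℕ i , toℕ k ] ≟ empty)) ×-dec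
  all? (λ i → all? λ j → (suc (toℕ i ℕ.+ toℕ j) ℕ.≟ n) →-dec
    ¬? (T [ toℕ i , toℕ j ] ≟ empty))

rows : ∀ m → List (Vec Symbol m)
rows zero    = [] ∷ []
rows (suc m) = cartesianProductWith _∷_ (empty ∷ alpha ∷ beta ∷ []) (rows m)

fillings : ∀ n → List (Filling n)
fillings zero    = [] ∷ []
fillings (suc n) = cartesianProductWith _∷_ (rows (suc n)) (fillings n)

tableaux : ∀ n → List (Filling n)
tableaux n = filter isTableau? (fillings n)

∈-rows : ∀ {m} (r : Vec Symbol m) → r ∈ rows m
∈-rows []      = here refl
∈-rows (s ∷ r) = ∈-cartesianProductWith⁺ _∷_ (∈-symbols s) (∈-rows r)
  where
  ∈-symbols : ∀ s → s ∈ empty ∷ alpha ∷ beta ∷ []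
  ∈-symbols empty = here refl
  ∈-symbols alpha = there (here refl)
  ∈-symbols beta  = there (there (here refl))

∈-fillings : ∀ {n} (T : Filling n) → T ∈ fillings n
∈-fillings []      = here refl
∈-fillings (r ∷ T) = ∈-cartesianProductWith⁺ _∷_ (∈-rows r) (∈-fillings T)

∈-tableaux : ∀ {n} (T : Filling n) → IsTableau T → T ∈ tableaux n
∈-tableaux T = ∈-filter⁺ isTableau? (∈-fillings T)

rows-unique : ∀ m → Unique (rows m)
rows-unique zero    = All.[] AllPairs.∷ AllPairs.[]
rows-unique (suc m) = Unique.cartesianProductWith⁺ _∷_ (λ { refl → refl , refl })
  (((λ ()) All.∷ (λ ()) All.∷ All.[]) AllPairs.∷
   ((λ ()) All.∷ All.[]) AllPairs.∷ All.[] AllPairs.∷ AllPairs.[])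
  (rows-unique m)

fillings-unique : ∀ n → Unique (fillings n)
fillings-unique zero    = All.[] AllPairs.∷ AllPairs.[]
fillings-unique (suc n) = Unique.cartesianProductWith⁺ _∷_ (λ { refl → refl , refl })
  (rows-unique (suc n)) (fillings-unique n)

tableaux-unique : ∀ n → Unique (tableaux n)
tableaux-unique n = Unique.filter⁺ isTableau? (fillings-unique n)

diagonal : ∀ n → Filling n
diagonal zero    = []
diagonal (suc n) = (replicate n empty ∷ʳ alpha) ∷ diagonal n

entry-diagonal : ∀ n j → (j ≡ n × entry (replicate n empty ∷ʳ alpha) j ≡ alpha) ⊎
                         (j ≢ n × entry (replicate n empty ∷ʳ alpha) j ≡ empty)
entry-diagonal zero    zero    = inj₁ (refl , refl)
entry-diagonal zero    (suc j) = inj₂ ((λ ()) , refl)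
entry-diagonal (suc n) zero    = inj₂ ((λ ()) , refl)
entry-diagonal (suc n) (suc j) with entry-diagonal n j
... | inj₁ (j≡n , eq) = inj₁ (cong suc j≡n , eq)
... | inj₂ (j≢n , eq) = inj₂ ((λ e → j≢n (ℕ.suc-injective e)) , eq)

diagonal-[,] : ∀ n i j → (suc (i ℕ.+ j) ≡ n × diagonal n [ i , j ] ≡ alpha) ⊎
                         (suc (i ℕ.+ j) ≢ n × diagonal n [ i , j ] ≡ empty)
diagonal-[,] zero    i       j = inj₂ ((λ ()) , refl)
diagonal-[,] (suc n) zero    j with entry-diagonal n j
... | inj₁ (j≡n , eq) = inj₁ (cong suc j≡n , eq)
... | inj₂ (j≢n , eq) = inj₂ ((λ e → j≢n (ℕ.suc-injective e)) , eq)
diagonal-[,] (suc n) (suc i) j with diagonal-[,] n i j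
... | inj₁ (h , eq) = inj₁ (cong suc h , eq)
... | inj₂ (h , eq) = inj₂ ((λ e → h (ℕ.suc-injective e)) , eq)

diagonal-isTableau : ∀ n → IsTableau (diagonal n)
diagonal-isTableau n = above , left , full
  where
  above : EmptyAboveα (diagonal n)
  above i j eq k k<i with diagonal-[,] n (toℕ i) (toℕ j) | diagonal-[,] n (toℕ k) (toℕ j)
  ... | inj₂ (_ , eq′) | _ with () ← trans (sym eq) eq′
  ... | inj₁ (h , _) | inj₁ (h′ , _) =
    ⊥-elim (ℕ.<⇒≢ k<i (ℕ.+-cancelʳ-≡ (toℕ j) _ _ (ℕ.suc-injective (trans h′ (sym h)))))
  ... | inj₁ _ | inj₂ (_ , eq′) = eq′
  left : EmptyLeftOfβ (diagonal n)
  left i j eq _ _ with diagonal-[,] n (toℕ i) (toℕ j)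
  ... | inj₁ (_ , eq′) with () ← trans (sym eq) eq′
  ... | inj₂ (_ , eq′) with () ← trans (sym eq) eq′
  full : FullDiagonal (diagonal n)
  full i j h eq with diagonal-[,] n (toℕ i) (toℕ j)
  ... | inj₁ (_ , eq′) with () ← trans (sym eq) eq′
  ... | inj₂ (h′ , _) = h′ h

number : ∀ {n} → Symbol → Filling n → ℕ
number s []      = 0
number s (r ∷ T) = Vec.count (s ≟_) r ℕ.+ number s T

-- The boxes (n - j - 1 , j), 1 ≤ j ≤ n - 2, have row n - 3 - j′ and column j′,
-- 0 ≤ j′ < n - 2, when numbered from 0. There are none if n < 3.
A⁽³⁾ : ∀ {n} → Filling n → ℕ
A⁽³⁾ {n} T = length (filter (λ j → T [ n ∸ 3 ∸ j , j ] ≟ alpha) (upTo (n ∸ 2)))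

module Law (α β : ℝ) (0<α : 0ℝ <ℝ α) (0<β : 0ℝ <ℝ β) where

  wt : ∀ {n} → Filling n → ℝ
  wt T = α ^ℝ number alpha T *ℝ β ^ℝ number beta T

  0<wt : ∀ {n} (T : Filling n) → 0ℝ <ℝ wt T
  0<wt T = 0<* (α ^ℝ number alpha T) (β ^ℝ number beta T)
    (0<^ α 0<α (number alpha T)) (0<^ β 0<β (number beta T))

  Z : ℕ → ℝ
  Z n = ∑ (tableaux n) wt

  0<Z : ∀ n → 0ℝ <ℝ Z n
  0<Z n = 0<∑ wt 0<wt (tableaux n) (∈-tableaux (diagonal n) (diagonal-isTableau n))

  mass : ∀ {n} → Filling n → ℝ
  mass {n} T = wt T *ℝ recipℝ (Z n) (0<Z n)

  ℙ : ∀ n {P : Pred (Filling n) 0ℓ} → Decidable P → ℝ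
  ℙ n P? = ∑ (filter P? (tableaux n)) mass

  distribution : ∀ n → (Filling n → ℕ) → DistributionFunction
  distribution n X x x∉ℕ = ℙ n (λ T → X T ≤?[ x , x∉ℕ ])

{-# OPTIONS --safe #-}
-- Peeling off the leftmost column gives a recursion for the polynomials
--   G_n(x) = Σ_T wt(T) · C(A(T), r) · x ^ (number of rows of T without β).
-- Put a = 1/α, b = 1/β, x = βy, and divide by (αβ)ⁿ. An unmarked column acts as
-- P(y) ↦ (y + a) P(y + 1), so that r = 0 yields rising factorials, and an α in the
-- third diagonal replaces three such steps by y (y + a) P(y + 1) + 2 y P(y), or four
-- by y² P(y) when the next column carries a mark as well. At y = b this makes the
-- r-th factorial moment of A⁽³⁾, over r !, roughly an elementary symmetric polynomial
-- of b, b + 1, …, b + n - 1 divided by n ^ (2 r). Explicit upper and lower bounds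
-- confirm the limit (1/2) ^ r / r !, uniformly for a and b in a bounded interval.
-- Newton's interpolation formula with remainder turns the factorial moments into
-- probabilities. A real number is a sequence of rationals and all operations act
-- termwise, so it suffices to prove the estimates for rational α and β.
module Submission where

open import Defs
open import Data.Nat.Base using (ℕ; zero; suc)
open import Data.Rational.Base
  using (ℚ; 0ℚ; 1ℚ; ½; _+_; _*_; _-_; -_; _≤_; _<_; ∣_∣; _⊔_; nonNegative)
open import Data.Bool.Base using (Bool; true; false; _∧_)
open import Data.Empty using (⊥-elim)
open import Data.Fin.Base using (Fin; toℕ; fromℕ<)
open import Data.Fin.Properties using (toℕ-fromℕ<)
import Data.Integer.Base as ℤ
import Data.Integer.Properties as ℤ
open import Data.List.Base as List
  using (List; []; _∷_; _++_; foldr; map; filter; length; upTo; cartesianProductWith)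
open import Data.List.Membership.Propositional using (_∈_)
open import Data.List.Relation.Unary.Unique.Propositional using (Unique)
import Data.List.Relation.Unary.All as All
import Data.List.Relation.Unary.AllPairs as AllPairs
open import Data.List.Relation.Unary.Any using (here)
import Data.List.Properties as List
import Data.List.Membership.Propositional.Properties as ∈
import Data.List.Relation.Unary.Unique.Propositional.Properties as Unique
open import Data.List.Membership.Propositional.Properties.WithK using (unique∧set⇒bag)
open import Data.List.Relation.Binary.BagAndSetEquality using (∼bag⇒↭)
open import Data.List.Relation.Binary.Permutation.Propositional using (_↭_; prep; swap)
  renaming (refl to ↭-refl; trans to ↭-trans)
import Data.Nat.Base as ℕ
import Data.Nat.Properties as ℕ
import Data.Rational.Properties as ℚ
import Data.Rational.Unnormalised.Base as ℚᵘ
import Data.Rational.Unnormalised.Properties as ℚᵘ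
open import Data.Product using (∃; _×_; _,_; proj₁; proj₂)
open import Data.Sum.Base using (inj₁; inj₂)
open import Data.Vec.Base as Vec using (Vec; []; _∷_; _∷ʳ_; replicate; reverse)
import Data.Vec.Properties as Vec
open import Function.Base using (_∘_)
open import Function.Bundles using (mk⇔)
open import Level using (0ℓ)
open import Relation.Nullary using (Dec; yes; no; does)
open import Relation.Nullary.Decidable using (dec⇒maybe)
open import Relation.Unary using (Pred; Decidable)
open import Relation.Binary.PropositionalEquality
  using (_≡_; _≢_; refl; sym; trans; cong; cong₂; subst; subst₂)
open import Tactic.RingSolver using (solve-∀)
open import Tactic.RingSolver.Core.AlmostCommutativeRing
  using (AlmostCommutativeRing; fromCommutativeRing)
open ℚ-Lemmas

-- A column sees only which rows to its right still lack β. A mark adds a demand on a low row, and a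
-- demand on the bottom row forces the next column to be a single α, after which it is gone: so the
-- recursion closes after finitely many columns.
--
-- The moment recursion is not solved but compared. Its coefficients are nonnegative, so induction
-- carries over any super- or subsolution. An elementary symmetric polynomial of degree r is close
-- to S ^ r / r !, S being the sum of the variables, and 2 S is nearly a difference of two squares.
-- The r-th power of such a difference, shifted by a multiple of r, passes through the recursion by
-- a mean value inequality; the shift pays for repeated factors and for the terms of lower order.
--
-- Uniformity in a and b is forced by the order of quantifiers in a limit of reals: the size n is
-- fixed before the index of the rational approximations.
--
-- The R-th difference of a function bounded by 1 is at most 2 ^ R, while the R-th moment tends to
-- (1/2) ^ R / R !. Newton's remainder is therefore close to 1 / R !, and no alternating
-- inequalities are required.

ring : AlmostCommutativeRing 0ℓ 0ℓ
ring = fromCommutativeRing ℚ.+-*-commutativeRing (λ x → dec⇒maybe (0ℚ ℚ.≟ x))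

-- Rational arithmetic and inequalities for powers

ι-suc : ∀ k → ι (suc k) ≡ 1ℚ + ι k
ι-suc k = ℚ.toℚᵘ-injective (ℚᵘ.≃-trans (toℚᵘ-ι (suc k)) (ℚᵘ.≃-trans
  (ℚᵘ.*≡* (cong (λ z → (ℤ.+ 1 ℤ.+ z) ℤ.* ℤ.+ 1) (sym (ℤ.*-identityʳ (ℤ.+ k)))))
  (ℚᵘ.≃-sym (ℚᵘ.≃-trans (ℚ.toℚᵘ-homo-+ 1ℚ (ι k)) (ℚᵘ.+-congʳ ℚᵘ.1ℚᵘ (toℚᵘ-ι k))))))

ι-+ : ∀ j k → ι (j ℕ.+ k) ≡ ι j + ι k
ι-+ zero    k = sym (ℚ.+-identityˡ (ι k))
ι-+ (suc j) k = trans (ι-suc (j ℕ.+ k)) (trans (cong (1ℚ +_) (ι-+ j k))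
  (trans (sym (ℚ.+-assoc 1ℚ (ι j) (ι k))) (cong (_+ ι k) (sym (ι-suc j)))))

ι-* : ∀ j k → ι (j ℕ.* k) ≡ ι j * ι k
ι-* zero    k = sym (ℚ.*-zeroˡ (ι k))
ι-* (suc j) k = trans (ι-+ k (j ℕ.* k)) (trans (cong (ι k +_) (ι-* j k))
  (trans (lem (ι j) (ι k)) (cong (_* ι k) (sym (ι-suc j)))))
  where
  lem : ∀ x y → y + x * y ≡ (1ℚ + x) * y
  lem = solve-∀ ring

0≤ι : ∀ k → 0ℚ ≤ ι k
0≤ι k = ι-mono {0} {k} ℕ.z≤n

0≤1 : 0ℚ ≤ 1ℚ
0≤1 = ℚ.nonNegative⁻¹ 1ℚ

≤-by : ∀ {p q} d → 0ℚ ≤ d → q ≡ p + d → p ≤ q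
≤-by {p} {q} d 0≤d eq = subst (p ≤_) (sym eq) (p≤p+q p d 0≤d)

0≤- : ∀ {p q} → p ≤ q → 0ℚ ≤ q - p
0≤- {p} {q} h = subst (_≤ q - p) (ℚ.+-inverseʳ p) (ℚ.+-monoˡ-≤ (- p) h)

*-monoʳ : ∀ {p q} r → 0ℚ ≤ r → p ≤ q → r * p ≤ r * q
*-monoʳ r 0≤r = ℚ.*-monoˡ-≤-nonNeg r {{nonNegative 0≤r}}

*-monoˡ : ∀ {p q} r → 0ℚ ≤ r → p ≤ q → p * r ≤ q * r
*-monoˡ r 0≤r = ℚ.*-monoʳ-≤-nonNeg r {{nonNegative 0≤r}}

pow : ℚ → ℕ → ℚ
pow x zero    = 1ℚ
pow x (suc k) = x * pow x k

0≤pow : ∀ {x} k → 0ℚ ≤ x → 0ℚ ≤ pow x k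
0≤pow     zero    0≤x = 0≤1
0≤pow {x} (suc k) 0≤x = 0≤* x (pow x k) 0≤x (0≤pow k 0≤x)

pow-mono : ∀ {x y} k → 0ℚ ≤ x → x ≤ y → pow x k ≤ pow y k
pow-mono         zero    0≤x x≤y = ℚ.≤-refl
pow-mono {x} {y} (suc k) 0≤x x≤y = *-mono-≤ x y (pow x k) (pow y k) 0≤x
  (0≤pow k (ℚ.≤-trans 0≤x x≤y)) x≤y (pow-mono k 0≤x x≤y)

pow-+ : ∀ x j k → pow x (j ℕ.+ k) ≡ pow x j * pow x k
pow-+ x zero    k = sym (ℚ.*-identityˡ (pow x k))
pow-+ x (suc j) k = trans (cong (x *_) (pow-+ x j k)) (sym (ℚ.*-assoc x (pow x j) (pow x k)))

pow-* : ∀ x y k → pow (x * y) k ≡ pow x k * pow y k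
pow-* x y zero    = refl
pow-* x y (suc k) = trans (cong (x * y *_) (pow-* x y k)) (lem x y (pow x k) (pow y k))
  where
  lem : ∀ x y p q → x * y * (p * q) ≡ x * p * (y * q)
  lem = solve-∀ ring

pow-1 : ∀ k → pow 1ℚ k ≡ 1ℚ
pow-1 zero    = refl
pow-1 (suc k) = trans (ℚ.*-identityˡ _) (pow-1 k)

-- A mean value inequality, proved by induction instead of calculus. The point `C` at which the
-- derivative is bounded is a separate argument, because in the comparison the lower power has a
-- base with a different shift.
pow-mvt-≥ : ∀ A B C d k → 0ℚ ≤ C → 0ℚ ≤ d → C ≤ B → B + d ≤ A →
  pow B (suc k) + ι (suc k) * d * pow C k ≤ pow A (suc k)
pow-mvt-≥ A B C d zero    0≤C 0≤d C≤B le = subst₂ _≤_ (lem₁ B d) (lem₂ A) le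
  where
  lem₁ : ∀ B d → B + d ≡ B * 1ℚ + 1ℚ * d * 1ℚ
  lem₁ = solve-∀ ring
  lem₂ : ∀ A → A ≡ A * 1ℚ
  lem₂ = solve-∀ ring
pow-mvt-≥ A B C d (suc k) 0≤C 0≤d C≤B le = begin
  pow B (suc (suc k)) + ι (suc (suc k)) * d * (C * pow C k)
    ≡⟨ cong (λ i → pow B (suc (suc k)) + i * d * (C * pow C k)) (ι-suc (suc k)) ⟩
  B * p + (1ℚ + i) * d * (C * q)
    ≡⟨ lem₁ B C d i p q ⟩
  B * p + (d * (C * q) + i * d * (C * q))
    ≤⟨ ℚ.+-monoʳ-≤ (B * p) (ℚ.+-mono-≤
         (*-monoʳ d 0≤d (pow-mono {C} {B} (suc k) 0≤C C≤B))
         (subst₂ _≤_ (lem₂ C q i d) refl (*-monoˡ (i * d * q) 0≤idq C≤B))) ⟩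
  B * p + (d * p + B * (i * d * q))
    ≤⟨ ≤-by (d * (i * d * q)) (0≤* d _ 0≤d 0≤idq) (lem₃ B p d (i * d * q)) ⟩
  (B + d) * (p + i * d * q)
    ≤⟨ *-mono-≤ (B + d) A (p + i * d * q) (pow A (suc k)) 0≤B+d (0≤pow (suc k) 0≤A) le
         (pow-mvt-≥ A B C d k 0≤C 0≤d C≤B le) ⟩
  A * pow A (suc k) ∎
  where
  open ℚ.≤-Reasoning
  i p q : ℚ
  i = ι (suc k)
  p = pow B (suc k)
  q = pow C k
  0≤B : 0ℚ ≤ B
  0≤B = ℚ.≤-trans 0≤C C≤B
  0≤B+d : 0ℚ ≤ B + d
  0≤B+d = 0≤+ B d 0≤B 0≤d
  0≤A : 0ℚ ≤ A
  0≤A = ℚ.≤-trans 0≤B+d le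
  0≤idq : 0ℚ ≤ i * d * q
  0≤idq = 0≤* (i * d) q (0≤* i d (0≤ι (suc k)) 0≤d) (0≤pow k 0≤C)
  lem₁ : ∀ B C d i p q → B * p + (1ℚ + i) * d * (C * q) ≡ B * p + (d * (C * q) + i * d * (C * q))
  lem₁ = solve-∀ ring
  lem₂ : ∀ C q i d → C * (i * d * q) ≡ i * d * (C * q)
  lem₂ = solve-∀ ring
  lem₃ : ∀ B p d r → (B + d) * (p + r) ≡ B * p + (d * p + B * r) + d * r
  lem₃ = solve-∀ ring

-- Here `C` lies beyond both `A` and `B`, so that it bounds the derivative from above.
pow-mvt-≤ : ∀ A B C d k → 0ℚ ≤ A → 0ℚ ≤ B → 0ℚ ≤ d → A ≤ C → B ≤ C → A ≤ B + d →
  pow A (suc k) ≤ pow B (suc k) + ι (suc k) * d * pow C k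
pow-mvt-≤ A B C d zero    0≤A 0≤B 0≤d A≤C B≤C le = subst₂ _≤_ (lem₂ A) (lem₁ B d) le
  where
  lem₁ : ∀ B d → B + d ≡ B * 1ℚ + 1ℚ * d * 1ℚ
  lem₁ = solve-∀ ring
  lem₂ : ∀ A → A ≡ A * 1ℚ
  lem₂ = solve-∀ ring
pow-mvt-≤ A B C d (suc k) 0≤A 0≤B 0≤d A≤C B≤C le = begin
  A * pow A (suc k)
    ≤⟨ *-monoʳ A 0≤A (pow-mvt-≤ A B C d k 0≤A 0≤B 0≤d A≤C B≤C le) ⟩
  A * (p + i * d * q)
    ≡⟨ lem₁ A p (i * d * q) ⟩
  A * p + A * (i * d * q)
    ≤⟨ ℚ.+-mono-≤ (*-monoˡ p (0≤pow (suc k) 0≤B) le) (*-monoˡ (i * d * q) 0≤idq A≤C) ⟩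
  (B + d) * p + C * (i * d * q)
    ≡⟨ lem₂ B C d p (i * d * q) ⟩
  B * p + (d * p + C * (i * d * q))
    ≤⟨ ℚ.+-monoʳ-≤ (B * p) (ℚ.+-monoˡ-≤ (C * (i * d * q))
         (*-monoʳ d 0≤d (pow-mono {B} {C} (suc k) 0≤B B≤C))) ⟩
  B * p + (d * (C * q) + C * (i * d * q))
    ≡⟨ lem₃ B C d i p q ⟩
  B * p + (1ℚ + i) * d * (C * q)
    ≡⟨ cong (λ i → B * p + i * d * (C * q)) (sym (ι-suc (suc k))) ⟩
  B * p + ι (suc (suc k)) * d * (C * q) ∎
  where
  open ℚ.≤-Reasoning
  i p q : ℚ
  i = ι (suc k)
  p = pow B (suc k)
  q = pow C k
  0≤idq : 0ℚ ≤ i * d * q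
  0≤idq = 0≤* (i * d) q (0≤* i d (0≤ι (suc k)) 0≤d) (0≤pow k (ℚ.≤-trans 0≤A A≤C))
  lem₁ : ∀ A p r → A * (p + r) ≡ A * p + A * r
  lem₁ = solve-∀ ring
  lem₂ : ∀ B C d p r → (B + d) * p + C * r ≡ B * p + (d * p + C * r)
  lem₂ = solve-∀ ring
  lem₃ : ∀ B C d i p q → B * p + (d * (C * q) + C * (i * d * q)) ≡ B * p + (1ℚ + i) * d * (C * q)
  lem₃ = solve-∀ ring

-- Comparison functions for the moment recursion

double : ℚ → ℚ
double p = p + p

0≤double : ∀ {p} → 0ℚ ≤ p → 0ℚ ≤ double p
0≤double {p} 0≤p = 0≤+ p p 0≤p 0≤p

-- 2 ^ r · r !
doubleFactorial : ℕ → ℚ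
doubleFactorial zero    = 1ℚ
doubleFactorial (suc r) = double (ι (suc r)) * doubleFactorial r

0≤doubleFactorial : ∀ r → 0ℚ ≤ doubleFactorial r
0≤doubleFactorial zero    = 0≤1
0≤doubleFactorial (suc r) = 0≤* (double (ι (suc r))) (doubleFactorial r) (0≤double (0≤ι (suc r)))
  (0≤doubleFactorial r)

-- The solution of the recursion without marks; at `y = b` it is the scaled partition function.
rising : ℚ → ℕ → ℚ → ℚ
rising a zero    y = 1ℚ
rising a (suc k) y = (y + a) * rising a k (y + 1ℚ)

rising-last : ∀ a k y → rising a (suc k) y ≡ rising a k y * (y + a + ι k)
rising-last a zero    y = lem (y + a)
  where
  lem : ∀ s → s * 1ℚ ≡ 1ℚ * (s + 0ℚ)
  lem = solve-∀ ring
rising-last a (suc k) y = trans (cong ((y + a) *_) (rising-last a k (y + 1ℚ)))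
  (trans (lem y a (rising a k (y + 1ℚ)) (ι k))
    (cong (λ i → (y + a) * rising a k (y + 1ℚ) * (y + a + i)) (sym (ι-suc k))))
  where
  lem : ∀ y a h i → (y + a) * (h * (y + 1ℚ + a + i)) ≡ (y + a) * h * (y + a + (1ℚ + i))
  lem = solve-∀ ring

0≤rising : ∀ {a} → 0ℚ ≤ a → ∀ k {y} → 0ℚ ≤ y → 0ℚ ≤ rising a k y
0≤rising         0≤a zero        0≤y = 0≤1
0≤rising {a} 0≤a (suc k) {y} 0≤y =
  0≤* (y + a) (rising a k (y + 1ℚ)) (0≤+ y a 0≤y 0≤a) (0≤rising 0≤a k (0≤+ y 1ℚ 0≤y 0≤1))

-- Marks in two neighbouring columns use up two of `suc r` marks. For `r = 0` this is impossible,
-- hence the value 0.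
previous : (ℕ → ℕ → ℚ → ℚ) → ℕ → ℕ → ℚ → ℚ
previous γ zero    k y = 0ℚ
previous γ (suc r) k y = γ r k y

-- γ r k b is the r-th factorial moment of A⁽³⁾ on boards of size 2 r + k, divided
-- by r ! and by (αβ) ^ (2 r + k), where a = 1 / α and b = 1 / β. The terms after
-- the first stand for a mark in the leftmost column: with no mark in the next
-- column, or with one (the summand in y * y).
record MomentRecursion (a : ℚ) (γ : ℕ → ℕ → ℚ → ℚ) : Set where
  field
    zero-zero : ∀ y → γ 0 0 y ≡ 1ℚ
    zero-suc  : ∀ k y → γ 0 (suc k) y ≡ (y + a) * γ 0 k (y + 1ℚ)
    suc-zero  : ∀ r y → γ (suc r) 0 y ≡ y * y * previous γ r 0 y
    suc-suc   : ∀ r k y → γ (suc r) (suc k) y ≡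
      (y + a) * γ (suc r) k (y + 1ℚ) +
      (y * (y + a) * γ r k (y + 1ℚ) + double y * γ r k y + y * y * previous γ r (suc k) y)

module Bounds (a : ℚ) (0≤a : 0ℚ ≤ a) (γ : ℕ → ℕ → ℚ → ℚ) (rec : MomentRecursion a γ) where
  open MomentRecursion rec
  open ℚ.≤-Reasoning

  H : ℕ → ℚ → ℚ
  H = rising a

  0≤y+1 : ∀ {y} → 0ℚ ≤ y → 0ℚ ≤ y + 1ℚ
  0≤y+1 {y} 0≤y = 0≤+ y 1ℚ 0≤y 0≤1

  0≤y+a : ∀ {y} → 0ℚ ≤ y → 0ℚ ≤ y + a
  0≤y+a {y} 0≤y = 0≤+ y a 0≤y 0≤a

  γ-zero : ∀ k y → γ 0 k y ≡ H k y
  γ-zero zero    y = zero-zero y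
  γ-zero (suc k) y = trans (zero-suc k y) (cong ((y + a) *_) (γ-zero k (y + 1ℚ)))

  mutual
    0≤γ : ∀ r k {y} → 0ℚ ≤ y → 0ℚ ≤ γ r k y
    0≤γ zero    k       {y} 0≤y = subst (0ℚ ≤_) (sym (γ-zero k y)) (0≤rising 0≤a k 0≤y)
    0≤γ (suc r) zero    {y} 0≤y = subst (0ℚ ≤_) (sym (suc-zero r y))
      (0≤* (y * y) _ (0≤* y y 0≤y 0≤y) (0≤previous r zero 0≤y))
    0≤γ (suc r) (suc k) {y} 0≤y = subst (0ℚ ≤_) (sym (suc-suc r k y))
      (0≤+ _ _ (0≤* (y + a) _ (0≤y+a 0≤y) (0≤γ (suc r) k (0≤y+1 0≤y)))
        (0≤+ _ _
          (0≤+ _ _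
            (0≤* (y * (y + a)) _ (0≤* y _ 0≤y (0≤y+a 0≤y)) (0≤γ r k (0≤y+1 0≤y)))
            (0≤* (double y) _ (0≤double 0≤y) (0≤γ r k 0≤y)))
          (0≤* (y * y) _ (0≤* y y 0≤y 0≤y) (0≤previous r (suc k) 0≤y))))

    0≤previous : ∀ r k {y} → 0ℚ ≤ y → 0ℚ ≤ previous γ r k y
    0≤previous zero    k 0≤y = ℚ.≤-refl
    0≤previous (suc r) k 0≤y = 0≤γ r k 0≤y

  module Upper (M : ℚ) where

    -- Chosen so that `τ y - τ (y + 1)` is `2 (y + 2)`: the summand `y` pays for the term in
    -- `y * (y + a)`, the summand 2 for `double y * γ r k y`.
    τ : ℚ → ℚ
    τ y = M * M - (y + 1ℚ) * (y + (1ℚ + 1ℚ))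

    -- The shift grows by `double M` with `r`, at least the drop of `τ` over one step of `y`. This
    -- is what makes `base-≤` true.
    V : ℕ → ℚ → ℚ
    V r y = pow (τ y + ι r * double M) r

    -- Bounds `previous γ r` multiplied by `doubleFactorial r`, which exceeds the factorial
    -- belonging to one mark fewer by the factor `double (ι r)`.
    W : ℕ → ℚ → ℚ
    W zero    y = 0ℚ
    W (suc r) y = double (ι (suc r)) * V r y

    module _ {y : ℚ} (0≤y : 0ℚ ≤ y) (y+2≤M : y + (1ℚ + 1ℚ) ≤ M) where

      0≤y+2 : 0ℚ ≤ y + (1ℚ + 1ℚ)
      0≤y+2 = 0≤+ y (1ℚ + 1ℚ) 0≤y (0≤double 0≤1)

      0≤M : 0ℚ ≤ M
      0≤M = ℚ.≤-trans 0≤y+2 y+2≤M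

      0≤τ : 0ℚ ≤ τ y
      0≤τ = 0≤- (*-mono-≤ (y + 1ℚ) M (y + (1ℚ + 1ℚ)) M (0≤y+1 0≤y) 0≤M
        (ℚ.≤-trans (ℚ.+-monoʳ-≤ y (p≤p+q 1ℚ 1ℚ 0≤1)) y+2≤M) y+2≤M)

      0≤base : ∀ r → 0ℚ ≤ τ y + ι r * double M
      0≤base r = 0≤+ (τ y) _ 0≤τ (0≤* (ι r) _ (0≤ι r) (0≤double 0≤M))

      0≤V : ∀ r → 0ℚ ≤ V r y
      0≤V r = 0≤pow r (0≤base r)

      base-≤ : ∀ r → τ y + ι r * double M ≤ τ (y + 1ℚ) + ι (suc r) * double M
      base-≤ r = ≤-by (double (M - (y + (1ℚ + 1ℚ)))) (0≤double (0≤- y+2≤M))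
        (trans (cong (λ i → τ (y + 1ℚ) + i * double M) (ι-suc r)) (lem M y (ι r)))
        where
        lem : ∀ M y i →
          (M * M - (y + 1ℚ + 1ℚ) * (y + 1ℚ + (1ℚ + 1ℚ))) + (1ℚ + i) * (M + M) ≡
          (M * M - (y + 1ℚ) * (y + (1ℚ + 1ℚ))) + i * (M + M) +
          ((M - (y + (1ℚ + 1ℚ))) + (M - (y + (1ℚ + 1ℚ))))
        lem = solve-∀ ring

      0≤V-suc : ∀ r → 0ℚ ≤ V (suc r) (y + 1ℚ)
      0≤V-suc r = 0≤pow (suc r) (ℚ.≤-trans (0≤base r) (base-≤ r))

      -- The bases at `y` and `y + 1` differ by exactly `2 (y + 2)`, and `base-≤` shows that the
      -- base of `V r y` lies below both.
      V-suc : ∀ r → V (suc r) (y + 1ℚ) + double (ι (suc r)) * ((y + (1ℚ + 1ℚ)) * V r y) ≤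
        V (suc r) y
      V-suc r = subst (_≤ V (suc r) y)
        (lem₁ (ι (suc r)) (y + (1ℚ + 1ℚ)) (V r y) (V (suc r) (y + 1ℚ)))
        (pow-mvt-≥ (τ y + ι (suc r) * double M) (τ (y + 1ℚ) + ι (suc r) * double M)
          (τ y + ι r * double M) (double (y + (1ℚ + 1ℚ))) r (0≤base r) (0≤double 0≤y+2)
          (base-≤ r) (ℚ.≤-reflexive (lem₂ M y (ι (suc r) * double M))))
        where
        lem₁ : ∀ i s v w → w + i * (s + s) * v ≡ w + (i + i) * (s * v)
        lem₁ = solve-∀ ring
        lem₂ : ∀ M y i →
          (M * M - (y + 1ℚ + 1ℚ) * (y + 1ℚ + (1ℚ + 1ℚ))) + i + ((y + (1ℚ + 1ℚ)) + (y + (1ℚ + 1ℚ))) ≡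
          (M * M - (y + 1ℚ) * (y + (1ℚ + 1ℚ))) + i
        lem₂ = solve-∀ ring

      -- A neighbouring pair of marks costs no more than is gained by moving from `y + 1` back to
      -- `y`; so the term in `y * y` merges into `y * V r y`.
      V-W : ∀ r → V r (y + 1ℚ) + y * W r y ≤ V r y
      V-W zero    = ℚ.≤-reflexive (lem y)
        where
        lem : ∀ y → 1ℚ + y * 0ℚ ≡ 1ℚ
        lem = solve-∀ ring
      V-W (suc r) = ℚ.≤-trans
        (ℚ.+-monoʳ-≤ (V (suc r) (y + 1ℚ))
          (≤-by (double (double (ι (suc r)) * V r y))
            (0≤double (0≤* (double (ι (suc r))) (V r y) (0≤double (0≤ι (suc r))) (0≤V r)))
            (lem y (double (ι (suc r))) (V r y))))
        (V-suc r)
        where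
        lem : ∀ y i v → i * ((y + (1ℚ + 1ℚ)) * v) ≡ y * (i * v) + (i * v + i * v)
        lem = solve-∀ ring

      -- The supersolution property once the rising factorial has been cancelled.
      V-step : ∀ r → V (suc r) (y + 1ℚ) +
        double (ι (suc r)) * (y * V r (y + 1ℚ) + double (V r y) + y * y * W r y) ≤ V (suc r) y
      V-step r = ℚ.≤-trans
        (ℚ.+-monoʳ-≤ (V (suc r) (y + 1ℚ)) (*-monoʳ (double (ι (suc r))) (0≤double (0≤ι (suc r)))
          (subst₂ _≤_ (lem₁ y (V r (y + 1ℚ)) (V r y) (W r y)) (lem₂ y (V r y))
            (ℚ.+-monoˡ-≤ (double (V r y)) (*-monoʳ y 0≤y (V-W r))))))
        (V-suc r)
        where
        lem₁ : ∀ y v′ v w → y * (v′ + y * w) + (v + v) ≡ y * v′ + (v + v) + y * y * w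
        lem₁ = solve-∀ ring
        lem₂ : ∀ y v → y * v + (v + v) ≡ (y + (1ℚ + 1ℚ)) * v
        lem₂ = solve-∀ ring

    y+2≤M : ∀ y k → y + (1ℚ + 1ℚ) + ι k ≤ M → y + (1ℚ + 1ℚ) ≤ M
    y+2≤M y k = ℚ.≤-trans (p≤p+q (y + (1ℚ + 1ℚ)) (ι k) (0≤ι k))

    mutual
      -- Nonnegative coefficients allow the bounds to be inserted term by term. `M` can stay fixed
      -- because `y` grows by 1 whenever `k` shrinks by 1.
      upper : ∀ r k {y} → 0ℚ ≤ y → y + (1ℚ + 1ℚ) + ι k ≤ M →
        γ r k y * doubleFactorial r ≤ V r y * H k y
      upper zero k {y} 0≤y h = ℚ.≤-reflexive
        (trans (ℚ.*-identityʳ (γ 0 k y)) (trans (γ-zero k y) (sym (ℚ.*-identityˡ (H k y)))))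
      upper (suc r) zero {y} 0≤y h = begin
        γ (suc r) 0 y * (t * F)
          ≡⟨ cong (_* (t * F)) (suc-zero r y) ⟩
        y * y * previous γ r 0 y * (t * F)
          ≡⟨ lem y (previous γ r 0 y) t F ⟩
        t * (y * y * (previous γ r 0 y * F))
          ≤⟨ *-monoʳ t 0≤t (*-monoʳ (y * y) (0≤* y y 0≤y 0≤y) (upper-previous r 0 0≤y h)) ⟩
        t * (y * y * (W r y * 1ℚ))
          ≡⟨ cong (λ w → t * (y * y * w)) (ℚ.*-identityʳ (W r y)) ⟩
        t * (y * y * W r y)
          ≤⟨ *-monoʳ t 0≤t (ℚ.≤-trans (≤-by _
               (0≤+ (y * V r (y + 1ℚ)) (double (V r y)) (0≤* y _ 0≤y (0≤V+ r))
                 (0≤double (0≤V 0≤y g r)))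
               (ℚ.+-comm (y * V r (y + 1ℚ) + double (V r y)) (y * y * W r y))) ℚ.≤-refl) ⟩
        t * (y * V r (y + 1ℚ) + double (V r y) + y * y * W r y)
          ≤⟨ ≤-by (V (suc r) (y + 1ℚ)) (0≤V-suc 0≤y g r) (ℚ.+-comm (V (suc r) (y + 1ℚ)) _) ⟩
        V (suc r) (y + 1ℚ) + t * (y * V r (y + 1ℚ) + double (V r y) + y * y * W r y)
          ≤⟨ V-step 0≤y g r ⟩
        V (suc r) y
          ≡⟨ ℚ.*-identityʳ (V (suc r) y) ⟨
        V (suc r) y * 1ℚ ∎
        where
        t F : ℚ
        t = double (ι (suc r))
        F = doubleFactorial r
        0≤t : 0ℚ ≤ t
        0≤t = 0≤double (0≤ι (suc r))
        g : y + (1ℚ + 1ℚ) ≤ M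
        g = y+2≤M y 0 h
        0≤V+ : ∀ r → 0ℚ ≤ V r (y + 1ℚ)
        0≤V+ zero    = 0≤1
        0≤V+ (suc r) = 0≤V-suc 0≤y g r
        lem : ∀ y p t F → y * y * p * (t * F) ≡ t * (y * y * (p * F))
        lem = solve-∀ ring
      upper (suc r) (suc k) {y} 0≤y h = begin
        γ (suc r) (suc k) y * (t * F)
          ≡⟨ cong (_* (t * F)) (suc-suc r k y) ⟩
        (s * γ (suc r) k (y + 1ℚ) +
          (y * s * γ r k (y + 1ℚ) + double y * γ r k y + y * y * previous γ r (suc k) y)) * (t * F)
          ≡⟨ lem₁ s y t F (γ (suc r) k (y + 1ℚ)) (γ r k (y + 1ℚ)) (γ r k y)
               (previous γ r (suc k) y) ⟩
        s * (γ (suc r) k (y + 1ℚ) * (t * F)) +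
          t * (y * s * (γ r k (y + 1ℚ) * F) + double y * (γ r k y * F) +
            y * y * (previous γ r (suc k) y * F))
          ≤⟨ ℚ.+-mono-≤ (*-monoʳ s 0≤s (upper (suc r) k (0≤y+1 0≤y) h₁))
               (*-monoʳ t 0≤t (ℚ.+-mono-≤ (ℚ.+-mono-≤
                 (*-monoʳ (y * s) (0≤* y s 0≤y 0≤s) (upper r k (0≤y+1 0≤y) h₁))
                 (*-monoʳ (double y) (0≤double 0≤y) (upper r k 0≤y h₀)))
                 (*-monoʳ (y * y) (0≤* y y 0≤y 0≤y) (upper-previous r (suc k) 0≤y h)))) ⟩
        s * (V (suc r) (y + 1ℚ) * H k (y + 1ℚ)) +
          t * (y * s * (V r (y + 1ℚ) * H k (y + 1ℚ)) + double y * (V r y * H k y) +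
            y * y * (W r y * H (suc k) y))
          ≡⟨ lem₂ s y t (V (suc r) (y + 1ℚ)) (H k (y + 1ℚ)) (V r (y + 1ℚ)) (V r y) (H k y) (W r y) ⟩
        (V (suc r) (y + 1ℚ) + t * (y * V r (y + 1ℚ) + y * y * W r y)) * H (suc k) y +
          t * (double (V r y) * (y * H k y))
          ≤⟨ ℚ.+-monoʳ-≤ ((V (suc r) (y + 1ℚ) + t * (y * V r (y + 1ℚ) + y * y * W r y)) * H (suc k)
            y) (*-monoʳ t 0≤t
               (*-monoʳ (double (V r y)) (0≤double (0≤V 0≤y g r)) y*H≤)) ⟩
        (V (suc r) (y + 1ℚ) + t * (y * V r (y + 1ℚ) + y * y * W r y)) * H (suc k) y +
          t * (double (V r y) * H (suc k) y)
          ≡⟨ lem₃ t y (V (suc r) (y + 1ℚ)) (V r (y + 1ℚ)) (W r y) (V r y) (H (suc k) y) ⟩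
        (V (suc r) (y + 1ℚ) + t * (y * V r (y + 1ℚ) + double (V r y) + y * y * W r y)) * H (suc k) y
          ≤⟨ *-monoˡ (H (suc k) y) (0≤rising 0≤a (suc k) 0≤y) (V-step 0≤y g r) ⟩
        V (suc r) y * H (suc k) y ∎
        where
        t F s : ℚ
        t = double (ι (suc r))
        F = doubleFactorial r
        s = y + a
        0≤t : 0ℚ ≤ t
        0≤t = 0≤double (0≤ι (suc r))
        0≤s : 0ℚ ≤ s
        0≤s = 0≤y+a 0≤y
        g : y + (1ℚ + 1ℚ) ≤ M
        g = y+2≤M y (suc k) h
        h₀ : y + (1ℚ + 1ℚ) + ι k ≤ M
        h₀ = ℚ.≤-trans (ℚ.+-monoʳ-≤ (y + (1ℚ + 1ℚ)) (ι-mono (ℕ.n≤1+n k))) h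
        h₁ : y + 1ℚ + (1ℚ + 1ℚ) + ι k ≤ M
        h₁ = subst (_≤ M) (trans (cong (y + (1ℚ + 1ℚ) +_) (ι-suc k)) (lem y (ι k))) h
          where
          lem : ∀ y i → y + (1ℚ + 1ℚ) + (1ℚ + i) ≡ y + 1ℚ + (1ℚ + 1ℚ) + i
          lem = solve-∀ ring
        -- The term `double y * γ r k y` brings only `k` factors of the rising factorial; its own
        -- `y` is exchanged for the missing one.
        y*H≤ : y * H k y ≤ H (suc k) y
        y*H≤ = ≤-by (H k y * (a + ι k))
          (0≤* (H k y) _ (0≤rising 0≤a k 0≤y) (0≤+ a (ι k) 0≤a (0≤ι k)))
          (trans (rising-last a k y) (lem (H k y) y a (ι k)))
          where
          lem : ∀ h y a i → h * (y + a + i) ≡ y * h + h * (a + i)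
          lem = solve-∀ ring
        lem₁ : ∀ s y t F g₁ g₂ g₃ g₄ →
          (s * g₁ + (y * s * g₂ + (y + y) * g₃ + y * y * g₄)) * (t * F) ≡
          s * (g₁ * (t * F)) + t * (y * s * (g₂ * F) + (y + y) * (g₃ * F) + y * y * (g₄ * F))
        lem₁ = solve-∀ ring
        lem₂ : ∀ s y t v₁ h₁ v₂ v₃ h w →
          s * (v₁ * h₁) + t * (y * s * (v₂ * h₁) + (y + y) * (v₃ * h) + y * y * (w * (s * h₁))) ≡
          (v₁ + t * (y * v₂ + y * y * w)) * (s * h₁) + t * ((v₃ + v₃) * (y * h))
        lem₂ = solve-∀ ring
        lem₃ : ∀ t y v₁ v₂ w v₃ h →
          (v₁ + t * (y * v₂ + y * y * w)) * h + t * ((v₃ + v₃) * h) ≡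
          (v₁ + t * (y * v₂ + (v₃ + v₃) + y * y * w)) * h
        lem₃ = solve-∀ ring

      upper-previous : ∀ r k {y} → 0ℚ ≤ y → y + (1ℚ + 1ℚ) + ι k ≤ M →
        previous γ r k y * doubleFactorial r ≤ W r y * H k y
      upper-previous zero    k {y} 0≤y h = ℚ.≤-reflexive
        (trans (ℚ.*-zeroˡ 1ℚ) (sym (ℚ.*-zeroˡ (H k y))))
      upper-previous (suc r) k {y} 0≤y h = subst₂ _≤_
        (lem (double (ι (suc r))) (γ r k y) (doubleFactorial r))
        (sym (ℚ.*-assoc (double (ι (suc r))) (V r y) (H k y)))
        (*-monoʳ (double (ι (suc r))) (0≤double (0≤ι (suc r))) (upper r k 0≤y h))
        where
        lem : ∀ t g F → t * (g * F) ≡ g * (t * F)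
        lem = solve-∀ ring

  module Lower (K : ℚ) where

    -- Twice the sum of `y`, `y + 1`, ..., `K - 1`; it drops by `2 y` in one step.
    Λ : ℚ → ℚ
    Λ y = K * (K - 1ℚ) - y * (y - 1ℚ)

    -- The subtraction makes up for products with repeated factors in a power of the sum. Truncation
    -- at 0 keeps powers monotone.
    base : ℕ → ℚ → ℚ
    base r y = 0ℚ ⊔ (Λ y - ι r * double K)

    ⊔-mono : ∀ {p q} → p ≤ q → 0ℚ ⊔ p ≤ 0ℚ ⊔ q
    ⊔-mono {p} {q} h = ℚ.⊔-lub (ℚ.p≤p⊔q 0ℚ q) (ℚ.≤-trans h (ℚ.p≤q⊔p 0ℚ q))

    0≤base : ∀ r y → 0ℚ ≤ base r y
    0≤base r y = ℚ.p≤p⊔q 0ℚ (Λ y - ι r * double K)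

    L : ℕ → ℚ → ℚ
    L r y = pow (base r y) r

    -- A step lowers `Λ` by `2 y`, at most `2 K`, so `base r (y + 1)` dominates both bases with
    -- index `suc r` and can bound the derivative.
    L-step : ∀ r {y} → 0ℚ ≤ y → y ≤ K →
      L (suc r) y ≤ L (suc r) (y + 1ℚ) + double (ι (suc r)) * (y * L r (y + 1ℚ))
    L-step r {y} 0≤y y≤K = subst (L (suc r) y ≤_)
      (lem (L (suc r) (y + 1ℚ)) (ι (suc r)) y (L r (y + 1ℚ)))
      (pow-mvt-≤ (base (suc r) y) (base (suc r) (y + 1ℚ)) (base r (y + 1ℚ)) (double y) r
        (0≤base (suc r) y) (0≤base (suc r) (y + 1ℚ)) (0≤double 0≤y)
        (⊔-mono (≤-by {Λ y - ι (suc r) * double K} {Λ (y + 1ℚ) - ι r * double K} (double (K - y))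
          (0≤double (0≤- y≤K))
          (trans (lem₁ K y (ι r))
            (cong (λ i → Λ y - i * double K + double (K - y)) (sym (ι-suc r))))))
        (⊔-mono (≤-by {Λ (y + 1ℚ) - ι (suc r) * double K} {Λ (y + 1ℚ) - ι r * double K} (double K)
          (0≤double (ℚ.≤-trans 0≤y y≤K))
          (trans (lem₂ (Λ (y + 1ℚ)) (ι r) (double K))
            (cong (λ i → Λ (y + 1ℚ) - i * double K + double K) (sym (ι-suc r))))))
        (ℚ.⊔-lub (0≤+ (base (suc r) (y + 1ℚ)) (double y) (0≤base (suc r) (y + 1ℚ)) (0≤double 0≤y))
          (subst (_≤ base (suc r) (y + 1ℚ) + double y) (lem₃ K y (ι (suc r) * double K))
            (ℚ.+-monoˡ-≤ (double y) (ℚ.p≤q⊔p 0ℚ (Λ (y + 1ℚ) - ι (suc r) * double K))))))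
      where
      lem : ∀ l i y m → l + i * (y + y) * m ≡ l + (i + i) * (y * m)
      lem = solve-∀ ring
      lem₁ : ∀ K y i → (K * (K - 1ℚ) - (y + 1ℚ) * (y + 1ℚ - 1ℚ)) - i * (K + K) ≡
        (K * (K - 1ℚ) - y * (y - 1ℚ)) - (1ℚ + i) * (K + K) + ((K - y) + (K - y))
      lem₁ = solve-∀ ring
      lem₂ : ∀ l i k → l - i * k ≡ l - (1ℚ + i) * k + k
      lem₂ = solve-∀ ring
      lem₃ : ∀ K y i → (K * (K - 1ℚ) - (y + 1ℚ) * (y + 1ℚ - 1ℚ)) - i + (y + y) ≡
        (K * (K - 1ℚ) - y * (y - 1ℚ)) - i
      lem₃ = solve-∀ ring

    L-last : ∀ r → 0ℚ ≤ K → L (suc r) K ≡ 0ℚ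
    L-last r 0≤K = trans
      (cong (_* pow (base (suc r) K) r)
        (ℚ.p≥q⇒p⊔q≡p (≤-by {Λ K - ι (suc r) * double K} {0ℚ} (ι (suc r) * double K)
        (0≤* (ι (suc r)) (double K) (0≤ι (suc r)) (0≤double 0≤K)) (lem K (ι (suc r) * double K)))))
      (ℚ.*-zeroˡ (pow (base (suc r) K) r))
      where
      lem : ∀ K i → 0ℚ ≡ (K * (K - 1ℚ) - K * (K - 1ℚ)) - i + i
      lem = solve-∀ ring

    -- Of the terms with a mark only the one in `y * (y + a)` is kept; the others are nonnegative.
    -- At `k = 0` the truncated base is 0 and nothing is claimed.
    lower : ∀ r k {y} → 0ℚ ≤ y → y + ι k ≡ K → L r y * H k y ≤ γ r k y * doubleFactorial r
    lower zero k {y} 0≤y h = ℚ.≤-reflexive (sym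
      (trans (ℚ.*-identityʳ (γ 0 k y)) (trans (γ-zero k y) (sym (ℚ.*-identityˡ (H k y))))))
    lower (suc r) zero {y} 0≤y h = begin
      L (suc r) y * 1ℚ  ≡⟨ ℚ.*-identityʳ (L (suc r) y) ⟩
      L (suc r) y       ≡⟨ cong (L (suc r)) y≡K ⟩
      L (suc r) K       ≡⟨ L-last r (subst (0ℚ ≤_) y≡K 0≤y) ⟩
      0ℚ                ≤⟨ 0≤* (γ (suc r) 0 y) _ (0≤γ (suc r) 0 0≤y) (0≤doubleFactorial (suc r)) ⟩
      γ (suc r) 0 y * doubleFactorial (suc r) ∎
      where
      y≡K : y ≡ K
      y≡K = trans (sym (ℚ.+-identityʳ y)) h
    lower (suc r) (suc k) {y} 0≤y h = begin
      L (suc r) y * (s * H k (y + 1ℚ))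
        ≤⟨ *-monoˡ (s * H k (y + 1ℚ)) (0≤rising 0≤a (suc k) 0≤y) (L-step r 0≤y y≤K) ⟩
      (L (suc r) (y + 1ℚ) + t * (y * L r (y + 1ℚ))) * (s * H k (y + 1ℚ))
        ≡⟨ lem₁ (L (suc r) (y + 1ℚ)) t y (L r (y + 1ℚ)) s (H k (y + 1ℚ)) ⟩
      s * (L (suc r) (y + 1ℚ) * H k (y + 1ℚ)) + t * (y * s * (L r (y + 1ℚ) * H k (y + 1ℚ)))
        ≤⟨ ℚ.+-mono-≤ (*-monoʳ s 0≤s (lower (suc r) k (0≤y+1 0≤y) h₁))
             (*-monoʳ t (0≤double (0≤ι (suc r)))
               (*-monoʳ (y * s) (0≤* y s 0≤y 0≤s) (lower r k (0≤y+1 0≤y) h₁))) ⟩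
      s * (γ (suc r) k (y + 1ℚ) * (t * F)) + t * (y * s * (γ r k (y + 1ℚ) * F))
        ≤⟨ ≤-by ((double y * γ r k y + y * y * previous γ r (suc k) y) * (t * F))
             (0≤* _ (t * F)
               (0≤+ _ _ (0≤* (double y) _ (0≤double 0≤y) (0≤γ r k 0≤y))
                 (0≤* (y * y) _ (0≤* y y 0≤y 0≤y) (0≤previous r (suc k) 0≤y)))
               (0≤doubleFactorial (suc r)))
             (lem₂ s y t F (γ (suc r) k (y + 1ℚ)) (γ r k (y + 1ℚ)) (γ r k y)
               (previous γ r (suc k) y)) ⟩
      (s * γ (suc r) k (y + 1ℚ) +
        (y * s * γ r k (y + 1ℚ) + double y * γ r k y + y * y * previous γ r (suc k) y)) * (t * F)
        ≡⟨ cong (_* (t * F)) (suc-suc r k y) ⟨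
      γ (suc r) (suc k) y * (t * F) ∎
      where
      t F s : ℚ
      t = double (ι (suc r))
      F = doubleFactorial r
      s = y + a
      0≤s : 0ℚ ≤ s
      0≤s = 0≤y+a 0≤y
      y≤K : y ≤ K
      y≤K = ≤-by (ι (suc k)) (0≤ι (suc k)) (sym h)
      h₁ : y + 1ℚ + ι k ≡ K
      h₁ = trans (trans (ℚ.+-assoc y 1ℚ (ι k)) (cong (y +_) (sym (ι-suc k)))) h
      lem₁ : ∀ l t y m s h → (l + t * (y * m)) * (s * h) ≡ s * (l * h) + t * (y * s * (m * h))
      lem₁ = solve-∀ ring
      lem₂ : ∀ s y t F g₁ g₂ g₃ g₄ →
        (s * g₁ + (y * s * g₂ + (y + y) * g₃ + y * y * g₄)) * (t * F) ≡
        s * (g₁ * (t * F)) + t * (y * s * (g₂ * F)) + ((y + y) * g₃ + y * y * g₄) * (t * F)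
      lem₂ = solve-∀ ring

-- Normalisation by the partition function and the limit of the moments

size : ℕ → ℕ → ℕ
size zero    k = k
size (suc r) k = suc (suc (size r k))

ι-size : ∀ r k → ι (size r k) ≡ double (ι r) + ι k
ι-size zero    k = sym (ℚ.+-identityˡ (ι k))
ι-size (suc r) k = trans (trans (ι-suc (suc (size r k))) (cong (1ℚ +_) (ι-suc (size r k))))
  (trans (cong (λ i → 1ℚ + (1ℚ + i)) (ι-size r k))
    (trans (lem (ι r) (ι k)) (cong (λ i → double i + ι k) (sym (ι-suc r)))))
  where
  lem : ∀ i j → 1ℚ + (1ℚ + (i + i + j)) ≡ (1ℚ + i) + (1ℚ + i) + j
  lem = solve-∀ ring

k≤size : ∀ r k → k ℕ.≤ size r k
k≤size zero    k = ℕ.≤-refl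
k≤size (suc r) k = ℕ.m≤n⇒m≤1+n (ℕ.m≤n⇒m≤1+n (k≤size r k))

module _ {a : ℚ} (0≤a : 0ℚ ≤ a) where
  open ℚ.≤-Reasoning

  rising-size : ∀ r k y → rising a (size (suc r) k) y ≡
    (y + a + ι (size r k)) * (y + a + ι (suc (size r k))) * rising a (size r k) y
  rising-size r k y = trans (rising-last a (suc (size r k)) y)
    (trans (cong (_* (y + a + ι (suc (size r k)))) (rising-last a (size r k) y))
      (lem (rising a (size r k) y) (y + a + ι (size r k)) (y + a + ι (suc (size r k)))))
    where
    lem : ∀ h p q → h * p * q ≡ p * q * h
    lem = solve-∀ ring

  -- The passage from `k` to `2 r + k` adds `2 r` factors, none below `ι k`. They match the `r`
  -- squares in the bound for the moment.
  rising-size-≥ : ∀ r k {y} → 0ℚ ≤ y → pow (ι k * ι k) r * rising a k y ≤ rising a (size r k) y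
  rising-size-≥ zero    k {y} 0≤y = ℚ.≤-reflexive (ℚ.*-identityˡ (rising a k y))
  rising-size-≥ (suc r) k {y} 0≤y = begin
    κ * κ * pow (κ * κ) r * rising a k y      ≡⟨ ℚ.*-assoc (κ * κ) (pow (κ * κ) r) (rising a k y) ⟩
    κ * κ * (pow (κ * κ) r * rising a k y)
      ≤⟨ *-mono-≤ (κ * κ) _ _ (rising a (size r k) y) (0≤* κ κ 0≤κ 0≤κ)
           (0≤rising 0≤a (size r k) 0≤y)
           (*-mono-≤ κ _ κ _ 0≤κ (ℚ.≤-trans 0≤κ κ≤₁) κ≤₀ κ≤₁) (rising-size-≥ r k 0≤y) ⟩
    (y + a + ι (size r k)) * (y + a + ι (suc (size r k))) * rising a (size r k) y
      ≡⟨ rising-size r k y ⟨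
    rising a (size (suc r) k) y ∎
    where
    κ : ℚ
    κ = ι k
    0≤κ : 0ℚ ≤ κ
    0≤κ = 0≤ι k
    κ≤ : ∀ {j} → k ℕ.≤ j → κ ≤ y + a + ι j
    κ≤ {j} k≤j = ℚ.≤-trans (ι-mono k≤j)
      (≤-by (y + a) (0≤+ y a 0≤y 0≤a) (ℚ.+-comm (y + a) (ι j)))
    κ≤₀ : κ ≤ y + a + ι (size r k)
    κ≤₀ = κ≤ (k≤size r k)
    κ≤₁ : κ ≤ y + a + ι (suc (size r k))
    κ≤₁ = κ≤ (ℕ.m≤n⇒m≤1+n (k≤size r k))

  rising-size-≤ : ∀ r k {y Q} → 0ℚ ≤ y → y + a + ι (size r k) ≤ Q →
    rising a (size r k) y ≤ pow (Q * Q) r * rising a k y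
  rising-size-≤ zero    k {y} {Q} 0≤y h = ℚ.≤-reflexive (sym (ℚ.*-identityˡ (rising a k y)))
  rising-size-≤ (suc r) k {y} {Q} 0≤y h = begin
    rising a (size (suc r) k) y
      ≡⟨ rising-size r k y ⟩
    p * q * rising a (size r k) y
      ≤⟨ *-mono-≤ (p * q) (Q * Q) (rising a (size r k) y) (pow (Q * Q) r * rising a k y)
           (0≤* p q (0≤p (size r k)) (0≤p (suc (size r k))))
           (0≤* _ (rising a k y) (0≤pow r (0≤* Q Q 0≤Q 0≤Q)) (0≤rising 0≤a k 0≤y))
           (*-mono-≤ p Q q Q (0≤p (size r k)) 0≤Q p≤Q q≤Q)
           (rising-size-≤ r k 0≤y p≤Q) ⟩
    Q * Q * (pow (Q * Q) r * rising a k y)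
      ≡⟨ ℚ.*-assoc (Q * Q) (pow (Q * Q) r) (rising a k y) ⟨
    pow (Q * Q) (suc r) * rising a k y ∎
    where
    p q : ℚ
    p = y + a + ι (size r k)
    q = y + a + ι (suc (size r k))
    0≤p : ∀ j → 0ℚ ≤ y + a + ι j
    0≤p j = 0≤+ (y + a) (ι j) (0≤+ y a 0≤y 0≤a) (0≤ι j)
    q≤Q : q ≤ Q
    q≤Q = ℚ.≤-trans (ℚ.+-monoʳ-≤ (y + a) (ι-mono (ℕ.n≤1+n (suc (size r k))))) h
    p≤Q : p ≤ Q
    p≤Q = ℚ.≤-trans (ℚ.+-monoʳ-≤ (y + a) (ι-mono (ℕ.n≤1+n (size r k)))) q≤Q
    0≤Q : 0ℚ ≤ Q
    0≤Q = ℚ.≤-trans (0≤p (size r k)) p≤Q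

-- A Lipschitz constant of the r-th power on [0, 2].
slope : ℕ → ℚ
slope zero    = 0ℚ
slope (suc r) = ι (suc r) * pow (1ℚ + 1ℚ) r

0≤slope : ∀ r → 0ℚ ≤ slope r
0≤slope zero    = ℚ.≤-refl
0≤slope (suc r) = 0≤* (ι (suc r)) _ (0≤ι (suc r)) (0≤pow r (0≤double 0≤1))

pow-1+ : ∀ r {t} → 0ℚ ≤ t → t ≤ 1ℚ → pow (1ℚ + t) r ≤ 1ℚ + slope r * t
pow-1+ zero    {t} 0≤t t≤1 = ℚ.≤-reflexive (lem t)
  where
  lem : ∀ t → 1ℚ ≡ 1ℚ + 0ℚ * t
  lem = solve-∀ ring
pow-1+ (suc r) {t} 0≤t t≤1 = subst (pow (1ℚ + t) (suc r) ≤_)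
  (trans (cong (_+ ι (suc r) * t * pow (1ℚ + 1ℚ) r) (pow-1 (suc r)))
    (lem (ι (suc r)) t (pow (1ℚ + 1ℚ) r)))
  (pow-mvt-≤ (1ℚ + t) 1ℚ (1ℚ + 1ℚ) t r (0≤+ 1ℚ t 0≤1 0≤t) 0≤1 0≤t (ℚ.+-monoʳ-≤ 1ℚ t≤1)
    (p≤p+q 1ℚ 1ℚ 0≤1) ℚ.≤-refl)
  where
  lem : ∀ i t p → 1ℚ + i * t * p ≡ 1ℚ + i * p * t
  lem = solve-∀ ring

pow-1- : ∀ r {t} → 0ℚ ≤ t → t ≤ 1ℚ → 1ℚ ≤ pow (1ℚ - t) r + slope r * t
pow-1- zero    {t} 0≤t t≤1 = ℚ.≤-reflexive (lem t)
  where
  lem : ∀ t → 1ℚ ≡ 1ℚ + 0ℚ * t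
  lem = solve-∀ ring
pow-1- (suc r) {t} 0≤t t≤1 = subst (_≤ pow (1ℚ - t) (suc r) + slope (suc r) * t) (pow-1 (suc r))
  (ℚ.≤-trans
    (pow-mvt-≤ 1ℚ (1ℚ - t) 1ℚ t r 0≤1 (0≤- t≤1) 0≤t ℚ.≤-refl (≤-by t 0≤t (lem₁ t))
      (ℚ.≤-reflexive (lem₁ t)))
    (ℚ.+-monoʳ-≤ (pow (1ℚ - t) (suc r)) (subst (ι (suc r) * t * pow 1ℚ r ≤_)
      (lem₂ (ι (suc r)) t (pow (1ℚ + 1ℚ) r))
      (*-monoʳ (ι (suc r) * t) (0≤* (ι (suc r)) t (0≤ι (suc r)) 0≤t)
        (pow-mono r 0≤1 (p≤p+q 1ℚ 1ℚ 0≤1))))))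
  where
  lem₁ : ∀ t → 1ℚ ≡ 1ℚ - t + t
  lem₁ = solve-∀ ring
  lem₂ : ∀ i t p → i * t * p ≡ i * p * t
  lem₂ = solve-∀ ring

expTerm-½ : ∀ r → expTerm ½ r * doubleFactorial r ≡ 1ℚ
expTerm-½ zero    = refl
expTerm-½ (suc r) = trans
  (lem (expTerm ½ r) ½ (recip r) (ι (suc r)) (doubleFactorial r))
  (trans (cong₂ (λ p q → p * (q * (½ + ½))) (expTerm-½ r) (ι-recip r)) refl)
  where
  lem : ∀ e h s i f → e * (h * s) * ((i + i) * f) ≡ e * f * (i * s * (h + h))
  lem = solve-∀ ring

0≤expTerm : ∀ {q} → 0ℚ ≤ q → ∀ r → 0ℚ ≤ expTerm q r
0≤expTerm     0≤q zero    = 0≤1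
0≤expTerm {q} 0≤q (suc r) =
  0≤* (expTerm q r) (q * recip r) (0≤expTerm 0≤q r) (0≤* q (recip r) 0≤q (ℚ.<⇒≤ (recip-pos r)))

-- Coefficients of `ι k` once each constant such as `e * e` has been enlarged to `e * e * ι k`,
-- which is legitimate as `1 ≤ ι k`. `e` bounds `b + 2` in `M`, and `D` bounds `b + a + 2 r` in `Q`.
upperConstant lowerConstant threshold : ℕ → ℚ → ℚ
upperConstant r c = double e + e * e + double (ι r) + double (ι r * e)
  where
  e : ℚ
  e = c + (1ℚ + 1ℚ)
lowerConstant r c = double D + D * D + (1ℚ + double (ι r) + double (ι r * c))
  where
  D : ℚ
  D = double c + double (ι r)
threshold r c = upperConstant r c + lowerConstant r c

0≤upperConstant : ∀ r {c} → 0ℚ ≤ c → 0ℚ ≤ upperConstant r c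
0≤upperConstant r {c} 0≤c = 0≤+ _ _ (0≤+ _ _ (0≤+ _ _ (0≤double 0≤e) (0≤* e e 0≤e 0≤e))
  (0≤double (0≤ι r))) (0≤double (0≤* (ι r) e (0≤ι r) 0≤e))
  where
  e : ℚ
  e = c + (1ℚ + 1ℚ)
  0≤e : 0ℚ ≤ e
  0≤e = 0≤+ c _ 0≤c (0≤double 0≤1)

0≤lowerConstant : ∀ r {c} → 0ℚ ≤ c → 0ℚ ≤ lowerConstant r c
0≤lowerConstant r {c} 0≤c = 0≤+ _ _ (0≤+ _ _ (0≤double 0≤D) (0≤* D D 0≤D 0≤D))
  (0≤+ _ _ (0≤+ 1ℚ _ 0≤1 (0≤double (0≤ι r))) (0≤double (0≤* (ι r) c (0≤ι r) 0≤c)))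
  where
  D : ℚ
  D = double c + double (ι r)
  0≤D : 0ℚ ≤ D
  0≤D = 0≤+ (double c) (double (ι r)) (0≤double 0≤c) (0≤double (0≤ι r))

module Closeness (a : ℚ) (0≤a : 0ℚ ≤ a) (γ : ℕ → ℕ → ℚ → ℚ) (rec : MomentRecursion a γ)
  (b c : ℚ) (0≤b : 0ℚ ≤ b) (a≤c : a ≤ c) (b≤c : b ≤ c)
  (r k : ℕ) (1≤k : 1ℚ ≤ ι k) (t : ℚ) (0≤t : 0ℚ ≤ t) (t≤1 : t ≤ 1ℚ)
  (large : threshold r c ≤ t * ι k) where
  open Bounds a 0≤a γ rec
  open ℚ.≤-Reasoning

  κ i M K Q : ℚ
  κ = ι k
  i = ι r
  M = b + (1ℚ + 1ℚ) + κ
  K = b + κ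
  Q = b + a + (double i + κ)

  0≤κ : 0ℚ ≤ κ
  0≤κ = 0≤ι k

  0≤i : 0ℚ ≤ i
  0≤i = 0≤ι r

  0≤c : 0ℚ ≤ c
  0≤c = ℚ.≤-trans 0≤b b≤c

  open Upper M using (τ; V; upper)
  open Lower K using (Λ; L; lower)

  upper-base : τ b + i * double M ≤ (1ℚ + t) * (κ * κ)
  upper-base = begin
    M * M - (b + 1ℚ) * (b + (1ℚ + 1ℚ)) + i * double M
      ≤⟨ ≤-by ((b + 1ℚ) * (b + (1ℚ + 1ℚ)))
           (0≤* _ _ (0≤+ b 1ℚ 0≤b 0≤1) (0≤+ b (1ℚ + 1ℚ) 0≤b (0≤double 0≤1)))
           (lem₁ M ((b + 1ℚ) * (b + (1ℚ + 1ℚ))) i) ⟩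
    M * M + i * double M
      ≤⟨ ℚ.+-mono-≤ (*-mono-≤ M N M N 0≤M 0≤N M≤N M≤N) (*-monoʳ i 0≤i (ℚ.+-mono-≤ M≤N M≤N)) ⟩
    N * N + i * double N
      ≤⟨ ≤-by ((κ - 1ℚ) * (e * e + double (i * e)))
           (0≤* _ _ (0≤- 1≤k) (0≤+ _ _ (0≤* e e 0≤e 0≤e) (0≤double (0≤* i e 0≤i 0≤e))))
           (lem₂ κ e i) ⟩
    κ * κ + upperConstant r c * κ
      ≤⟨ ℚ.+-monoʳ-≤ (κ * κ) (*-monoˡ κ 0≤κ (ℚ.≤-trans
           (p≤p+q (upperConstant r c) (lowerConstant r c) (0≤lowerConstant r 0≤c)) large)) ⟩
    κ * κ + t * κ * κ
      ≡⟨ lem₃ κ t ⟩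
    (1ℚ + t) * (κ * κ) ∎
    where
    e N : ℚ
    e = c + (1ℚ + 1ℚ)
    N = e + κ
    0≤e : 0ℚ ≤ e
    0≤e = 0≤+ c (1ℚ + 1ℚ) 0≤c (0≤double 0≤1)
    0≤N : 0ℚ ≤ N
    0≤N = 0≤+ e κ 0≤e 0≤κ
    0≤M : 0ℚ ≤ M
    0≤M = 0≤+ (b + (1ℚ + 1ℚ)) κ (0≤+ b (1ℚ + 1ℚ) 0≤b (0≤double 0≤1)) 0≤κ
    M≤N : M ≤ N
    M≤N = ℚ.+-monoˡ-≤ κ (ℚ.+-monoˡ-≤ (1ℚ + 1ℚ) b≤c)
    lem₁ : ∀ M p i → M * M + i * (M + M) ≡ M * M - p + i * (M + M) + p
    lem₁ = solve-∀ ring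
    lem₂ : ∀ κ e i → κ * κ + (e + e + e * e + (i + i) + (i * e + i * e)) * κ ≡
      (e + κ) * (e + κ) + i * ((e + κ) + (e + κ)) + (κ - 1ℚ) * (e * e + (i * e + i * e))
    lem₂ = solve-∀ ring
    lem₃ : ∀ κ t → κ * κ + t * κ * κ ≡ (1ℚ + t) * (κ * κ)
    lem₃ = solve-∀ ring

  lower-base : (1ℚ - t) * (Q * Q) ≤ Λ b - i * double K
  lower-base = begin
    (1ℚ - t) * (Q * Q)
      -- Giving away the part of `t * (Q * Q)` above `t * κ * κ` leaves a quantity to which `large`
      -- applies directly.
      ≤⟨ ≤-by (t * (Q * Q - κ * κ)) (0≤* t _ 0≤t (0≤- (*-mono-≤ κ Q κ Q 0≤κ 0≤Q κ≤Q κ≤Q)))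
           (lem₁ t Q κ) ⟩
    Q * Q - t * κ * κ
      ≤⟨ ℚ.+-mono-≤ (*-mono-≤ Q N Q N 0≤Q 0≤N Q≤N Q≤N) (ℚ.neg-antimono-≤
           (*-monoˡ {lowerConstant r c} κ 0≤κ
             (ℚ.≤-trans (≤-by (upperConstant r c) (0≤upperConstant r 0≤c)
             (ℚ.+-comm (upperConstant r c) (lowerConstant r c))) large))) ⟩
    N * N - lowerConstant r c * κ
      ≤⟨ ≤-by ((κ - 1ℚ) * (D * D)) (0≤* _ _ (0≤- 1≤k) (0≤* D D 0≤D 0≤D)) (lem₂ κ D i c) ⟩
    κ * κ - (1ℚ + double i + double (i * c)) * κ
      ≤⟨ ≤-by (double (b * κ) + double i * (c * (κ - 1ℚ) + (c - b)))
           (0≤+ _ _ (0≤double (0≤* b κ 0≤b 0≤κ)) (0≤* (double i) _ (0≤double 0≤i)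
             (0≤+ _ _ (0≤* c _ 0≤c (0≤- 1≤k)) (0≤- b≤c))))
           (lem₃ b κ i c) ⟩
    Λ b - i * double K ∎
    where
    D N : ℚ
    D = double c + double i
    N = D + κ
    0≤D : 0ℚ ≤ D
    0≤D = 0≤+ (double c) (double i) (0≤double 0≤c) (0≤double 0≤i)
    0≤N : 0ℚ ≤ N
    0≤N = 0≤+ D κ 0≤D 0≤κ
    κ≤Q : κ ≤ Q
    κ≤Q = ≤-by (b + a + double i) (0≤+ _ _ (0≤+ b a 0≤b 0≤a) (0≤double 0≤i)) (lem b a i κ)
      where
      lem : ∀ b a i κ → b + a + (i + i + κ) ≡ κ + (b + a + (i + i))
      lem = solve-∀ ring
    0≤Q : 0ℚ ≤ Q
    0≤Q = ℚ.≤-trans 0≤κ κ≤Q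
    Q≤N : Q ≤ N
    Q≤N = subst (Q ≤_) (sym (ℚ.+-assoc (double c) (double i) κ))
      (ℚ.+-monoˡ-≤ (double i + κ) (ℚ.+-mono-≤ b≤c a≤c))
    lem₁ : ∀ t Q κ → Q * Q - t * κ * κ ≡ (1ℚ - t) * (Q * Q) + t * (Q * Q - κ * κ)
    lem₁ = solve-∀ ring
    lem₂ : ∀ κ D i c → κ * κ - (1ℚ + (i + i) + (i * c + i * c)) * κ ≡
      (D + κ) * (D + κ) - (D + D + D * D + (1ℚ + (i + i) + (i * c + i * c))) * κ +
      (κ - 1ℚ) * (D * D)
    lem₂ = solve-∀ ring
    lem₃ : ∀ b κ i c →
      (b + κ) * (b + κ - 1ℚ) - b * (b - 1ℚ) - i * ((b + κ) + (b + κ)) ≡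
      κ * κ - (1ℚ + (i + i) + (i * c + i * c)) * κ +
      ((b * κ + b * κ) + (i + i) * (c * (κ - 1ℚ) + (c - b)))
    lem₃ = solve-∀ ring

  Hₙ : ℚ
  Hₙ = H (size r k) b

  0≤Hₙ : 0ℚ ≤ Hₙ
  0≤Hₙ = 0≤rising 0≤a (size r k) 0≤b

  0≤Hₖ : 0ℚ ≤ H k b
  0≤Hₖ = 0≤rising 0≤a k 0≤b

  γ≤ : γ r k b * doubleFactorial r ≤ (1ℚ + slope r * t) * Hₙ
  γ≤ = begin
    γ r k b * doubleFactorial r
      ≤⟨ upper r k 0≤b ℚ.≤-refl ⟩
    V r b * H k b
      ≤⟨ *-monoˡ (H k b) 0≤Hₖ (pow-mono r 0≤base upper-base) ⟩
    pow ((1ℚ + t) * (κ * κ)) r * H k b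
      ≡⟨ trans (cong (_* H k b) (pow-* (1ℚ + t) (κ * κ) r))
           (ℚ.*-assoc (pow (1ℚ + t) r) (pow (κ * κ) r) (H k b)) ⟩
    pow (1ℚ + t) r * (pow (κ * κ) r * H k b)
      ≤⟨ *-mono-≤ (pow (1ℚ + t) r) (1ℚ + slope r * t) (pow (κ * κ) r * H k b) Hₙ
           (0≤pow r (0≤+ 1ℚ t 0≤1 0≤t)) 0≤Hₙ (pow-1+ r 0≤t t≤1) (rising-size-≥ 0≤a r k 0≤b) ⟩
    (1ℚ + slope r * t) * Hₙ ∎
    where
    0≤base : 0ℚ ≤ τ b + i * double M
    0≤base = Upper.0≤base M 0≤b (p≤p+q (b + (1ℚ + 1ℚ)) κ 0≤κ) r

  γ≥ : Hₙ ≤ γ r k b * doubleFactorial r + slope r * t * Hₙ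
  γ≥ = begin
    Hₙ
      ≡⟨ ℚ.*-identityˡ Hₙ ⟨
    1ℚ * Hₙ
      ≤⟨ *-monoˡ Hₙ 0≤Hₙ (pow-1- r 0≤t t≤1) ⟩
    (pow (1ℚ - t) r + slope r * t) * Hₙ
      ≡⟨ ℚ.*-distribʳ-+ Hₙ (pow (1ℚ - t) r) (slope r * t) ⟩
    pow (1ℚ - t) r * Hₙ + slope r * t * Hₙ
      ≤⟨ ℚ.+-monoˡ-≤ (slope r * t * Hₙ) main ⟩
    γ r k b * doubleFactorial r + slope r * t * Hₙ ∎
    where
    0≤1-t : 0ℚ ≤ 1ℚ - t
    0≤1-t = 0≤- t≤1
    0≤Q : 0ℚ ≤ Q
    0≤Q = 0≤+ (b + a) _ (0≤+ b a 0≤b 0≤a) (0≤+ (double i) κ (0≤double 0≤i) 0≤κ)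
    main : pow (1ℚ - t) r * Hₙ ≤ γ r k b * doubleFactorial r
    main = begin
      pow (1ℚ - t) r * Hₙ
        ≤⟨ *-monoʳ (pow (1ℚ - t) r) (0≤pow r 0≤1-t) (rising-size-≤ 0≤a r k {b} {Q} 0≤b
             (ℚ.≤-reflexive (cong (b + a +_) (ι-size r k)))) ⟩
      pow (1ℚ - t) r * (pow (Q * Q) r * H k b)
        ≡⟨ trans (cong (_* H k b) (pow-* (1ℚ - t) (Q * Q) r))
             (ℚ.*-assoc (pow (1ℚ - t) r) (pow (Q * Q) r) (H k b)) ⟨
      pow ((1ℚ - t) * (Q * Q)) r * H k b
        ≤⟨ *-monoˡ (H k b) 0≤Hₖ (pow-mono r (0≤* (1ℚ - t) (Q * Q) 0≤1-t (0≤* Q Q 0≤Q 0≤Q))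
             (ℚ.≤-trans lower-base (ℚ.p≤q⊔p 0ℚ (Λ b - i * double K)))) ⟩
      L r b * H k b
        ≤⟨ lower r k 0≤b refl ⟩
      γ r k b * doubleFactorial r ∎

  -- `expTerm ½ r` is the reciprocal of `doubleFactorial r` and `z` that of `Hₙ`; multiplying `γ≤`
  -- and `γ≥` by their product normalises both.
  close : ∀ z → 0ℚ ≤ z → Hₙ * z ≡ 1ℚ → ∣ γ r k b * z - expTerm ½ r ∣ ≤ expTerm ½ r * slope r * t
  close z 0≤z Hz≡1 = abs-≤
    (subst₂ _≤_ (eq₁ (γ r k b) (expTerm-½ r) Hz≡1) (eq₂ Hz≡1)
      (*-monoʳ (e * z) 0≤ez (≤+⇒-≤ (subst (γ r k b * doubleFactorial r ≤_)
        (lem₁ (slope r * t) Hₙ) γ≤))))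
    (subst₂ _≤_ (trans (lem₂ (e * z) Hₙ (γ r k b * doubleFactorial r))
        (cong -_ (eq₁ (γ r k b) (expTerm-½ r) Hz≡1)))
      (eq₂ Hz≡1)
      (*-monoʳ (e * z) 0≤ez (≤+⇒-≤ (subst (Hₙ ≤_)
        (ℚ.+-comm (γ r k b * doubleFactorial r) (slope r * t * Hₙ)) γ≥))))
    where
    e : ℚ
    e = expTerm ½ r
    0≤ez : 0ℚ ≤ e * z
    0≤ez = 0≤* e z (0≤expTerm (ℚ.nonNegative⁻¹ ½) r) 0≤z
    lem₁ : ∀ s h → (1ℚ + s) * h ≡ s * h + h
    lem₁ = solve-∀ ring
    lem₂ : ∀ p h x → p * (h - x) ≡ - (p * (x - h))
    lem₂ = solve-∀ ring
    lem₃ : ∀ e z g f h → e * z * (g * f - h) ≡ e * f * (g * z) - e * (h * z)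
    lem₃ = solve-∀ ring
    lem₄ : ∀ g e → 1ℚ * g - e * 1ℚ ≡ g - e
    lem₄ = solve-∀ ring
    eq₁ : ∀ g → e * doubleFactorial r ≡ 1ℚ → Hₙ * z ≡ 1ℚ →
      e * z * (g * doubleFactorial r - Hₙ) ≡ g * z - e
    eq₁ g p q = trans (lem₃ e z g (doubleFactorial r) Hₙ)
      (trans (cong₂ (λ u v → u * (g * z) - e * v) p q) (lem₄ (g * z) e))
    lem₅ : ∀ e z s t h → e * z * (s * t * h) ≡ e * s * t * (h * z)
    lem₅ = solve-∀ ring
    eq₂ : Hₙ * z ≡ 1ℚ → e * z * (slope r * t * Hₙ) ≡ e * slope r * t
    eq₂ q = trans (lem₅ e z (slope r) t Hₙ)
      (trans (cong (e * slope r * t *_) q) (ℚ.*-identityʳ (e * slope r * t)))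

inv-≤1 : ∀ {p} → 1ℚ ≤ p → inv p ≤ 1ℚ
inv-≤1 {p} 1≤p = subst (inv p ≤_)
  (trans (sym (ℚ.*-identityˡ (inv 1ℚ))) (inv-right (ℚ.positive⁻¹ 1ℚ)))
  (inv-anti (ℚ.positive⁻¹ 1ℚ) 1≤p)

-- `N` precedes `a`, `b` and `γ`: these will vary with the index of a rational approximation,
-- whereas `c` will not.
MomentLimit : ℕ → ℚ → ℚ → ℕ → Set
MomentLimit r c ε N = ∀ k → N ℕ.≤ k → ∀ {a} → 0ℚ ≤ a → ∀ {γ} → MomentRecursion a γ →
  ∀ b → 0ℚ ≤ b → a ≤ c → b ≤ c → ∀ z → 0ℚ ≤ z → rising a (size r k) b * z ≡ 1ℚ →
  ∣ γ r k b * z - expTerm ½ r ∣ ≤ ε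

-- Unfolding the threshold would make later goals explode.
abstract
  moment-limit : ∀ r c ε → 0ℚ ≤ c → 0ℚ < ε → ∃ (MomentLimit r c ε)
  moment-limit r c ε 0≤c 0<ε = suc (ceil (threshold r c * inv t)) , λ k N≤k 0≤a rec b 0≤b a≤c b≤c z
    0≤z Hz≡1 →
    ℚ.≤-trans
      (Closeness.close _ 0≤a _ rec b c 0≤b a≤c b≤c r k
        (ι-mono {1} {k} (ℕ.≤-trans (ℕ.s≤s ℕ.z≤n) N≤k)) t (ℚ.<⇒≤ 0<t) t≤1
        (large k (ℕ.≤-trans (ℕ.n≤1+n _) N≤k)) z 0≤z Hz≡1)
      st≤ε
    where
    s q t : ℚ
    s = expTerm ½ r * slope r
    -- Both `t ≤ 1` and `s * t ≤ ε` are wanted of `t = 1 / q`; the summand 1 secures the first.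
    q = 1ℚ + s * inv ε
    t = inv q
    0≤s : 0ℚ ≤ s
    0≤s = 0≤* (expTerm ½ r) (slope r) (0≤expTerm (ℚ.nonNegative⁻¹ ½) r) (0≤slope r)
    1≤q : 1ℚ ≤ q
    1≤q = p≤p+q 1ℚ (s * inv ε) (0≤* s (inv ε) 0≤s (ℚ.<⇒≤ (inv-pos 0<ε)))
    0<q : 0ℚ < q
    0<q = ℚ.<-≤-trans (ℚ.positive⁻¹ 1ℚ) 1≤q
    0<t : 0ℚ < t
    0<t = inv-pos 0<q
    t≤1 : t ≤ 1ℚ
    t≤1 = inv-≤1 1≤q
    st≤ε : s * t ≤ ε
    st≤ε = subst₂ _≤_ (cong (_* t) (eq (inv ε) (inv-right 0<ε)))
      (trans (ℚ.*-assoc ε q t) (trans (cong (ε *_) (inv-right 0<q)) (ℚ.*-identityʳ ε)))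
      (*-monoˡ t (ℚ.<⇒≤ 0<t) (*-monoʳ ε (ℚ.<⇒≤ 0<ε) (≤-by 1ℚ 0≤1 (ℚ.+-comm 1ℚ (s * inv ε)))))
      where
      lem : ∀ e s i → e * (s * i) ≡ e * i * s
      lem = solve-∀ ring
      eq : ∀ i → ε * i ≡ 1ℚ → ε * (s * i) ≡ s
      eq i p = trans (lem ε s i) (trans (cong (_* s) p) (ℚ.*-identityˡ s))
    large : ∀ k → ceil (threshold r c * inv t) ℕ.≤ k → threshold r c ≤ t * ι k
    large k h = subst (_≤ t * ι k) (eq (inv t) (inv-right 0<t))
      (*-monoʳ t (ℚ.<⇒≤ 0<t) (ℚ.≤-trans (≤ceil (threshold r c * inv t)) (ι-mono h)))
      where
      lem : ∀ t s i → t * (s * i) ≡ t * i * s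
      lem = solve-∀ ring
      eq : ∀ i → t * i ≡ 1ℚ → t * (threshold r c * i) ≡ threshold r c
      eq i p = trans (lem t (threshold r c) i) (trans (cong (_* threshold r c) p) (ℚ.*-identityˡ _))

-- Finite sums of rationals

∑ℚ : {A : Set} → List A → (A → ℚ) → ℚ
∑ℚ xs f = foldr (λ a s → f a + s) 0ℚ xs

module _ {A : Set} where

  seq-∑ : ∀ (xs : List A) f i → seq (∑ xs f) i ≡ ∑ℚ xs (λ a → seq (f a) i)
  seq-∑ []       f i = refl
  seq-∑ (x ∷ xs) f i = cong (seq (f x) i +_) (seq-∑ xs f i)

  ∑-cong : ∀ (xs : List A) {f g : A → ℚ} → (∀ a → f a ≡ g a) → ∑ℚ xs f ≡ ∑ℚ xs g
  ∑-cong []       h = refl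
  ∑-cong (x ∷ xs) h = cong₂ _+_ (h x) (∑-cong xs h)

  ∑-+ : ∀ (xs : List A) (f g : A → ℚ) → ∑ℚ xs (λ a → f a + g a) ≡ ∑ℚ xs f + ∑ℚ xs g
  ∑-+ []       f g = refl
  ∑-+ (x ∷ xs) f g = trans (cong (f x + g x +_) (∑-+ xs f g)) (lem (f x) (g x) (∑ℚ xs f) (∑ℚ xs g))
    where
    lem : ∀ a b c d → a + b + (c + d) ≡ a + c + (b + d)
    lem = solve-∀ ring

  ∑-*ˡ : ∀ c (xs : List A) (f : A → ℚ) → ∑ℚ xs (λ a → c * f a) ≡ c * ∑ℚ xs f
  ∑-*ˡ c []       f = sym (ℚ.*-zeroʳ c)
  ∑-*ˡ c (x ∷ xs) f = trans (cong (c * f x +_) (∑-*ˡ c xs f))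
    (sym (ℚ.*-distribˡ-+ c (f x) (∑ℚ xs f)))

  ∑-*ʳ : ∀ c (xs : List A) (f : A → ℚ) → ∑ℚ xs (λ a → f a * c) ≡ ∑ℚ xs f * c
  ∑-*ʳ c xs f = trans (∑-cong xs (λ a → ℚ.*-comm (f a) c))
    (trans (∑-*ˡ c xs f) (ℚ.*-comm c (∑ℚ xs f)))

  ∑-zero : ∀ (xs : List A) (f : A → ℚ) → (∀ a → f a ≡ 0ℚ) → ∑ℚ xs f ≡ 0ℚ
  ∑-zero []       f h = refl
  ∑-zero (x ∷ xs) f h = cong₂ _+_ (h x) (∑-zero xs f h)

  ∑-↭ : ∀ {xs ys : List A} (f : A → ℚ) → xs ↭ ys → ∑ℚ xs f ≡ ∑ℚ ys f
  ∑-↭ f ↭-refl = refl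
  ∑-↭ f (prep x p) = cong (f x +_) (∑-↭ f p)
  ∑-↭ f (swap {xs} {ys} x y p) = trans (cong (λ s → f x + (f y + s)) (∑-↭ f p))
    (lem (f x) (f y) (∑ℚ ys f))
    where
    lem : ∀ a b c → a + (b + c) ≡ b + (a + c)
    lem = solve-∀ ring
  ∑-↭ f (↭-trans p q) = trans (∑-↭ f p) (∑-↭ f q)

  ∑-++ : ∀ (xs ys : List A) (f : A → ℚ) → ∑ℚ (xs ++ ys) f ≡ ∑ℚ xs f + ∑ℚ ys f
  ∑-++ []       ys f = sym (ℚ.+-identityˡ (∑ℚ ys f))
  ∑-++ (x ∷ xs) ys f = trans (cong (f x +_) (∑-++ xs ys f))
    (sym (ℚ.+-assoc (f x) (∑ℚ xs f) (∑ℚ ys f)))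

  ∑-map : ∀ {B : Set} (g : B → A) xs (f : A → ℚ) → ∑ℚ (map g xs) f ≡ ∑ℚ xs (λ b → f (g b))
  ∑-map g []       f = refl
  ∑-map g (x ∷ xs) f = cong (f (g x) +_) (∑-map g xs f)

  ∑-cartesianProductWith : ∀ {B C : Set} (g : B → C → A) xs ys (f : A → ℚ) →
    ∑ℚ (cartesianProductWith g xs ys) f ≡ ∑ℚ xs (λ x → ∑ℚ ys (λ y → f (g x y)))
  ∑-cartesianProductWith g []       ys f = refl
  ∑-cartesianProductWith g (x ∷ xs) ys f = trans (∑-++ (map (g x) ys) _ f)
    (cong₂ _+_ (∑-map (g x) ys f) (∑-cartesianProductWith g xs ys f))

  ∑-mono : ∀ (xs : List A) {f g : A → ℚ} → (∀ a → f a ≤ g a) → ∑ℚ xs f ≤ ∑ℚ xs g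
  ∑-mono []       h = ℚ.≤-refl
  ∑-mono (x ∷ xs) h = ℚ.+-mono-≤ (h x) (∑-mono xs h)

  ∑-abs : ∀ (xs : List A) (f : A → ℚ) → ∣ ∑ℚ xs f ∣ ≤ ∑ℚ xs (λ a → ∣ f a ∣)
  ∑-abs []       f = ℚ.≤-refl
  ∑-abs (x ∷ xs) f = ℚ.≤-trans (ℚ.∣p+q∣≤∣p∣+∣q∣ (f x) (∑ℚ xs f)) (ℚ.+-monoʳ-≤ ∣ f x ∣ (∑-abs xs f))

∑-swap : ∀ {A B : Set} (xs : List A) (ys : List B) (f : A → B → ℚ) →
  ∑ℚ xs (λ x → ∑ℚ ys (f x)) ≡ ∑ℚ ys (λ y → ∑ℚ xs (λ x → f x y))
∑-swap []       ys f = sym (∑-zero ys (λ _ → 0ℚ) (λ _ → refl))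
∑-swap (x ∷ xs) ys f = trans (cong (∑ℚ ys (f x) +_) (∑-swap xs ys f))
  (sym (∑-+ ys (f x) (λ y → ∑ℚ xs (λ x → f x y))))

indicator : Bool → ℚ
indicator true  = 1ℚ
indicator false = 0ℚ

indicator-∧ : ∀ b c → indicator (b ∧ c) ≡ indicator b * indicator c
indicator-∧ true  c = sym (ℚ.*-identityˡ (indicator c))
indicator-∧ false c = sym (ℚ.*-zeroˡ (indicator c))

∑-filter : ∀ {A : Set} {P : Pred A 0ℓ} (P? : Decidable P) xs (f : A → ℚ) →
  ∑ℚ (filter P? xs) f ≡ ∑ℚ xs (λ a → indicator (does (P? a)) * f a)
∑-filter P? []       f = refl
∑-filter P? (x ∷ xs) f with does (P? x)
... | true  = cong₂ _+_ (sym (ℚ.*-identityˡ (f x))) (∑-filter P? xs f)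
... | false = trans (∑-filter P? xs f) (sym (trans
  (cong (_+ ∑ℚ xs (λ a → indicator (does (P? a)) * f a)) (ℚ.*-zeroˡ (f x))) (ℚ.+-identityˡ _)))

-- Transfer of weights through a single column

-- Columns are read from the bottom. In a column to be put to the left of a
-- tableau, v marks the rows of the tableau without β, from the bottom.
noSymbols : ∀ m → Vec Symbol m
noSymbols m = replicate m empty

keep : Symbol → Bool → Bool
keep beta _ = false
keep _    b = b

update↑ : ∀ {m} → Vec Symbol m → Vec Bool m → Vec Bool m
update↑ []      []      = []
update↑ (s ∷ d) (b ∷ v) = keep s b ∷ update↑ d v

-- The bottom box starts a row of its own, so its status before the column is `true`.
update : ∀ {m} → Vec Symbol (suc m) → Vec Bool m → Vec Bool (suc m)
update (s ∷ d) v = keep s true ∷ update↑ d v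

update↑-noSymbols : ∀ {m} (v : Vec Bool m) → update↑ (noSymbols m) v ≡ v
update↑-noSymbols []      = refl
update↑-noSymbols (b ∷ v) = cong (b ∷_) (update↑-noSymbols v)

isα : Symbol → ℕ
isα alpha = 1
isα _     = 0

-- Entry 2 from the bottom of the leftmost column is its box on the third diagonal; a column with
-- fewer than three boxes yields `empty` there.
mark : ∀ {m} → Vec Symbol m → ℕ
mark d = isα (entry d 2)

entry-noSymbols : ∀ m j → entry (noSymbols m) j ≡ empty
entry-noSymbols zero    j       = refl
entry-noSymbols (suc m) zero    = refl
entry-noSymbols (suc m) (suc j) = entry-noSymbols m j

-- A filling stored by columns, the leftmost outermost, so that peeling it off is pattern matching.
data Board : ℕ → Set where
  []  : Board 0
  _◂_ : ∀ {n} → Vec Symbol (suc n) → Board n → Board (suc n)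

boards : ∀ n → List (Board n)
boards zero    = [] ∷ []
boards (suc n) = cartesianProductWith (λ S d → d ◂ S) (boards n) (rows (suc n))

free : ∀ {n} → Board n → Vec Bool n
free []      = []
free (d ◂ S) = update d (free S)

marks : ∀ {n} → Board n → ℕ
marks []      = 0
marks (d ◂ S) = mark d ℕ.+ marks S

rows-suc : ∀ m (h : Vec Symbol (suc m) → ℚ) → ∑ℚ (rows (suc m)) h ≡
  ∑ℚ (rows m) (λ d → h (empty ∷ d)) +
  (∑ℚ (rows m) (λ d → h (alpha ∷ d)) + ∑ℚ (rows m) (λ d → h (beta ∷ d)))
rows-suc m h = trans (∑-cartesianProductWith _∷_ (empty ∷ alpha ∷ beta ∷ []) (rows m) h)
  (cong (λ z → ∑ℚ (rows m) (λ d → h (empty ∷ d)) + (∑ℚ (rows m) (λ d → h (alpha ∷ d)) + z))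
    (ℚ.+-identityʳ _))

difference : (ℕ → ℚ) → ℕ → ℚ
difference c a = c (suc a) - c a

binomial : ℕ → ℕ → ℚ
binomial zero    a       = 1ℚ
binomial (suc r) zero    = 0ℚ
binomial (suc r) (suc a) = binomial (suc r) a + binomial r a

difference-binomial : ∀ r a → difference (binomial (suc r)) a ≡ binomial r a
difference-binomial r a = lem (binomial (suc r) a) (binomial r a)
  where
  lem : ∀ p q → p + q - p ≡ q
  lem = solve-∀ ring

0≤binomial : ∀ r a → 0ℚ ≤ binomial r a
0≤binomial zero    a       = 0≤1
0≤binomial (suc r) zero    = ℚ.≤-refl
0≤binomial (suc r) (suc a) = 0≤+ _ _ (0≤binomial (suc r) a) (0≤binomial r a)

module Transfer (α β : ℚ) where

  noneWeight : ∀ {m} → Vec Symbol m → ℚ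
  noneWeight []          = 1ℚ
  noneWeight (empty ∷ d) = noneWeight d
  noneWeight (alpha ∷ d) = 0ℚ
  noneWeight (beta ∷ d)  = 0ℚ

  -- Read upwards, a column carries β's on free rows until an α, if any, ends it; only empty boxes
  -- may follow. Every symbol needs a free row, since a β further right empties the boxes to its
  -- left.
  upWeight : ∀ {m} → Vec Symbol m → Vec Bool m → ℚ
  upWeight []          []      = 1ℚ
  upWeight (empty ∷ d) (b ∷ v) = upWeight d v
  upWeight (alpha ∷ d) (b ∷ v) = indicator b * (α * noneWeight d)
  upWeight (beta ∷ d)  (b ∷ v) = indicator b * (β * upWeight d v)

  -- The bottom box lies on the main diagonal: it must be full, and no box to its right can forbid a
  -- symbol.
  columnWeight : ∀ {m} → Vec Symbol (suc m) → Vec Bool m → ℚ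
  columnWeight (empty ∷ d) v = 0ℚ
  columnWeight (alpha ∷ d) v = α * noneWeight d
  columnWeight (beta ∷ d)  v = β * upWeight d v

  weight : ∀ {n} → Board n → ℚ
  weight []      = 1ℚ
  weight (d ◂ S) = columnWeight d (free S) * weight S

  sum↑ : ∀ {m} → Vec Bool m → (Vec Symbol m → ℚ) → ℚ
  sum↑ {m} v φ = ∑ℚ (rows m) (λ d → upWeight d v * φ d)

  columnSum : ∀ {m} → Vec Bool m → (Vec Symbol (suc m) → ℚ) → ℚ
  columnSum {m} v φ = ∑ℚ (rows (suc m)) (λ d → columnWeight d v * φ d)

  sum-none : ∀ m (φ : Vec Symbol m → ℚ) → ∑ℚ (rows m) (λ d → noneWeight d * φ d) ≡ φ (noSymbols m)
  sum-none zero    φ = trans (ℚ.+-identityʳ _) (ℚ.*-identityˡ (φ []))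
  sum-none (suc m) φ = trans (rows-suc m (λ d → noneWeight d * φ d))
    (trans (cong₂ _+_ (sum-none m (λ d → φ (empty ∷ d)))
        (cong₂ _+_ (∑-zero (rows m) _ (λ d → ℚ.*-zeroˡ (φ (alpha ∷ d))))
                   (∑-zero (rows m) _ (λ d → ℚ.*-zeroˡ (φ (beta ∷ d))))))
      (ℚ.+-identityʳ _))

  sum↑-zero : ∀ {m} (v : Vec Bool m) {φ} → (∀ d → φ d ≡ 0ℚ) → sum↑ v φ ≡ 0ℚ
  sum↑-zero {m} v h = ∑-zero (rows m) _
    (λ d → trans (cong (upWeight d v *_) (h d)) (ℚ.*-zeroʳ (upWeight d v)))

  sum↑-* : ∀ {m} (v : Vec Bool m) c φ → sum↑ v (λ d → c * φ d) ≡ c * sum↑ v φ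
  sum↑-* {m} v c φ = trans (∑-cong (rows m) (λ d → lem (upWeight d v) c (φ d)))
    (∑-*ˡ c (rows m) (λ d → upWeight d v * φ d))
    where
    lem : ∀ u c p → u * (c * p) ≡ c * (u * p)
    lem = solve-∀ ring

  sum↑-∷ : ∀ {m} b (v : Vec Bool m) φ → sum↑ (b ∷ v) φ ≡
    sum↑ v (λ d → φ (empty ∷ d)) +
    indicator b * (α * φ (alpha ∷ noSymbols m) + β * sum↑ v (λ d → φ (beta ∷ d)))
  sum↑-∷ {m} b v φ = trans (rows-suc m (λ d → upWeight d (b ∷ v) * φ d))
    (cong (sum↑ v (λ d → φ (empty ∷ d)) +_) (trans (cong₂ _+_
      (trans (∑-cong (rows m) (λ d → lem (indicator b) α (noneWeight d) (φ (alpha ∷ d))))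
        (trans (∑-*ˡ (indicator b * α) (rows m) _)
          (cong (indicator b * α *_) (sum-none m (λ d → φ (alpha ∷ d))))))
      (trans (∑-cong (rows m) (λ d → lem (indicator b) β (upWeight d v) (φ (beta ∷ d))))
        (∑-*ˡ (indicator b * β) (rows m) _)))
      (lem′ (indicator b) α β (φ (alpha ∷ noSymbols m)) (sum↑ v (λ d → φ (beta ∷ d))))))
    where
    lem : ∀ i a e p → i * (a * e) * p ≡ i * a * (e * p)
    lem = solve-∀ ring
    lem′ : ∀ i a b p q → i * a * p + i * b * q ≡ i * (a * p + b * q)
    lem′ = solve-∀ ring

  columnSum-≡ : ∀ {m} (v : Vec Bool m) φ → columnSum v φ ≡
    α * φ (alpha ∷ noSymbols m) + β * sum↑ v (λ d → φ (beta ∷ d))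
  columnSum-≡ {m} v φ = trans (rows-suc m (λ d → columnWeight d v * φ d))
    (trans (cong₂ _+_ (∑-zero (rows m) _ (λ d → ℚ.*-zeroˡ (φ (empty ∷ d)))) (cong₂ _+_
      (trans (∑-cong (rows m) (λ d → ℚ.*-assoc α (noneWeight d) (φ (alpha ∷ d))))
        (trans (∑-*ˡ α (rows m) _) (cong (α *_) (sum-none m (λ d → φ (alpha ∷ d))))))
      (trans (∑-cong (rows m) (λ d → ℚ.*-assoc β (upWeight d v) (φ (beta ∷ d))))
        (∑-*ˡ β (rows m) _))))
    (ℚ.+-identityˡ _))

  factor : ℚ → Bool → ℚ
  factor x true  = x
  factor x false = 1ℚ

  monomial : ∀ {n} → ℚ → Vec Bool n → ℚ
  monomial x []      = 1ℚ
  monomial x (b ∷ v) = factor x b * monomial x v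

  monomial-1 : ∀ {n} (v : Vec Bool n) → monomial 1ℚ v ≡ 1ℚ
  monomial-1 []          = refl
  monomial-1 (true ∷ v)  = trans (ℚ.*-identityˡ _) (monomial-1 v)
  monomial-1 (false ∷ v) = trans (ℚ.*-identityˡ _) (monomial-1 v)

  -- A demand on the lowest row, the trace left by a mark further to the left.
  bottomFree : ∀ {n} → (∀ {m} → Vec Bool m → ℚ) → Vec Bool n → ℚ
  bottomFree ψ []          = 0ℚ
  bottomFree ψ (true ∷ v)  = ψ v
  bottomFree ψ (false ∷ v) = 0ℚ

  -- β · sum↑ avoids a division by β.
  sum↑-monomial : ∀ {m} x (v : Vec Bool m) → β * sum↑ v (λ d → monomial x (update↑ d v)) ≡
    (α * x + β) * monomial (x + β) v - α * x * monomial x v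
  sum↑-monomial x []      = lem α β x
    where
    lem : ∀ a b x → b * (1ℚ * 1ℚ + 0ℚ) ≡ (a * x + b) * 1ℚ - a * x * 1ℚ
    lem = solve-∀ ring
  sum↑-monomial {suc m} x (b ∷ v) = trans
    (cong (β *_) (trans (sum↑-∷ b v (λ d → monomial x (update↑ d (b ∷ v))))
      (cong₂ (λ p q → p + indicator
        b * (α * (factor x b * monomial x (update↑ (noSymbols m) v)) + β * q))
        (sum↑-* v (factor x b) (λ d → monomial x (update↑ d v)))
        (sum↑-* v 1ℚ (λ d → monomial x (update↑ d v))))))
    (trans (cong (λ w → β *
      (factor x b * U + indicator b * (α * (factor x b * monomial x w) + β * (1ℚ * U))))
        (update↑-noSymbols v))
      (final b))
    where
    U : ℚ
    U = sum↑ v (λ d → monomial x (update↑ d v))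
    lem₁ : ∀ a b x u p → b * (x * u + 1ℚ * (a * (x * p) + b * (1ℚ * u))) ≡
      (x + b) * (b * u) + a * b * x * p
    lem₁ = solve-∀ ring
    lem₂ : ∀ a b x p p′ → (x + b) * ((a * x + b) * p′ - a * x * p) + a * b * x * p ≡
      (a * x + b) * ((x + b) * p′) - a * x * (x * p)
    lem₂ = solve-∀ ring
    lem₃ : ∀ a b x u p → b * (1ℚ * u + 0ℚ * (a * (1ℚ * p) + b * (1ℚ * u))) ≡ b * u
    lem₃ = solve-∀ ring
    lem₄ : ∀ a b x p p′ → (a * x + b) * p′ - a * x * p ≡ (a * x + b) * (1ℚ * p′) - a * x * (1ℚ * p)
    lem₄ = solve-∀ ring
    final : ∀ b → β * (factor x b * U + indicator
      b * (α * (factor x b * monomial x v) + β * (1ℚ * U))) ≡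
      (α * x + β) * (factor (x + β) b * monomial (x + β) v) - α * x * (factor x b * monomial x v)
    final true  = trans (lem₁ α β x U (monomial x v))
      (trans (cong (λ z → (x + β) * z + α * β * x * monomial x v) (sum↑-monomial x v))
        (lem₂ α β x (monomial x v) (monomial (x + β) v)))
    final false = trans (lem₃ α β x U (monomial x v))
      (trans (sum↑-monomial x v) (lem₄ α β x (monomial x v) (monomial (x + β) v)))

  -- The dual form of the transfer: a function of the free rows after a column is added becomes a
  -- function of those before.
  plain marked : ∀ {m} → (Vec Bool (suc m) → ℚ) → Vec Bool m → ℚ
  plain  ψ v = columnSum v (λ d → ψ (update d v))
  marked ψ v = columnSum v (λ d → ι (mark d) * ψ (update d v))

  -- An α in the bottom box contributes `α * x * monomial x v`, exactly what is subtracted in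
  -- `sum↑-monomial` as the end term of a geometric sum.
  plain-monomial : ∀ {m} x (v : Vec Bool m) → plain (monomial x) v ≡ (α * x + β) * monomial (x + β)
    v
  plain-monomial x v = trans (columnSum-≡ v (λ d → monomial x (update d v)))
    (trans (cong₂ (λ w q → α * (x * monomial x w) + β * q) (update↑-noSymbols v)
        (sum↑-* v 1ℚ (λ d → monomial x (update↑ d v))))
      (trans (cong (α * (x * monomial x v) +_)
        (trans (cong (β *_) (ℚ.*-identityˡ _)) (sum↑-monomial x v)))
        (lem α β x (monomial x v) (monomial (x + β) v))))
    where
    lem : ∀ a b x p q → a * (x * p) + ((a * x + b) * q - a * x * p) ≡ (a * x + b) * q
    lem = solve-∀ ring

  sum↑-mark : ∀ {m} b (v : Vec Bool m) (g : Vec Symbol (suc m) → ℚ) →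
    sum↑ (b ∷ v) (λ d → ι (isα (entry d 0)) * g d) ≡
    indicator b * (α * g (alpha ∷ noSymbols m))
  sum↑-mark {m} b v g = trans (sum↑-∷ b v (λ d → ι (isα (entry d 0)) * g d))
    (trans (cong₂ (λ p q → p + indicator b * (α * (1ℚ * g (alpha ∷ noSymbols m)) + β * q))
        (sum↑-zero v (λ d → ℚ.*-zeroˡ (g (empty ∷ d))))
          (sum↑-zero v (λ d → ℚ.*-zeroˡ (g (beta ∷ d)))))
      (lem (indicator b) α β (g (alpha ∷ noSymbols m))))
    where
    lem : ∀ i a b g → 0ℚ + i * (a * (1ℚ * g) + b * 0ℚ) ≡ i * (a * g)
    lem = solve-∀ ring

  mark-noSymbols : ∀ m j p → ι (isα (entry (noSymbols m) j)) * p ≡ 0ℚ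
  mark-noSymbols m j p = trans (cong (λ s → ι (isα s) * p) (entry-noSymbols m j)) (ℚ.*-zeroˡ p)

  -- The marked box lies in the third row from the bottom, which must be free; the
  -- second row from the bottom then holds β or nothing.
  second : ∀ {n} → ℚ → Vec Bool n → ℚ
  second x []      = 0ℚ
  second x (b ∷ v) = factor (x + β) b * bottomFree (λ w → x * monomial x w) v

  -- An α in the bottom box would empty the marked box, so the bottom box holds β. This gives the
  -- factor `β`, and the mark itself gives `α`.
  marked-monomial : ∀ {m} x (v : Vec Bool m) → marked (monomial x) v ≡ α * β * second x v
  marked-monomial x [] = trans (columnSum-≡ [] (λ d → ι (mark d) * monomial x (update d [])))
    (lem α β (x * 1ℚ) (1ℚ * 1ℚ))
    where
    lem : ∀ a b p q → a * (0ℚ * p) + b * (1ℚ * (0ℚ * q) + 0ℚ) ≡ a * b * 0ℚ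
    lem = solve-∀ ring
  marked-monomial {suc m} x (p ∷ v) = trans
    (columnSum-≡ (p ∷ v) (λ d → ι (mark d) * monomial x (update d (p ∷ v))))
    (trans (cong₂ (λ y z → α * y + β * z)
      (mark-noSymbols (suc m) 1 (monomial x (update (alpha ∷ noSymbols (suc m)) (p ∷ v))))
      (trans (sum↑-∷ p v φ)
        (cong (λ y → sum↑ v (λ d → φ (empty ∷ d)) + indicator
          p * (α * y + β * sum↑ v (λ d → φ (beta ∷ d))))
          (mark-noSymbols m 0 (1ℚ * monomial x (update↑ (alpha ∷ noSymbols m) (p ∷ v)))))))
      (final v))
    where
    φ : Vec Symbol (suc m) → ℚ
    φ d = ι (isα (entry d 1)) * (1ℚ * monomial x (update↑ d (p ∷ v)))
    lem₁ : ∀ a b x m → a * 0ℚ + b *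
      (1ℚ * (a * (1ℚ * (x * (x * m)))) + 1ℚ * (a * 0ℚ + b * (1ℚ * (a * (1ℚ * (1ℚ * (x * m))))))) ≡
      a * b * ((x + b) * (x * m))
    lem₁ = solve-∀ ring
    lem₂ : ∀ a b x m n → a * 0ℚ + b * (1ℚ * (a * (1ℚ * (1ℚ * (x * m)))) + 0ℚ * (a * 0ℚ + b * n)) ≡
      a * b * (1ℚ * (x * m))
    lem₂ = solve-∀ ring
    lem₃ : ∀ a b f u u′ i → a * 0ℚ + b * (0ℚ * u + i * (a * 0ℚ + b * (0ℚ * u′))) ≡ a * b * (f * 0ℚ)
    lem₃ = solve-∀ ring
    final : ∀ {m} (v : Vec Bool m) →
      α * 0ℚ + β * (sum↑ v (λ d →
        ι (isα (entry d 0)) * (1ℚ * (factor x p * monomial x (update↑ d v)))) +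
        indicator p * (α * 0ℚ +
          β * sum↑ v (λ d → ι (isα (entry d 0)) * (1ℚ * (1ℚ * monomial x (update↑ d v)))))) ≡
      α * β * (factor (x + β) p * bottomFree (λ w → x * monomial x w) v)
    final []      = go p
      where
      lem : ∀ a b i f → a * 0ℚ + b *
        (1ℚ * (0ℚ * (1ℚ * (i * 1ℚ))) + 0ℚ + f * (a * 0ℚ + b * (1ℚ * (0ℚ * (1ℚ * (1ℚ * 1ℚ))) + 0ℚ)))
          ≡ 0ℚ
      lem = solve-∀ ring
      lem′ : ∀ a b f → 0ℚ ≡ a * b * (f * 0ℚ)
      lem′ = solve-∀ ring
      go : ∀ p → α * 0ℚ + β * (1ℚ * (0ℚ * (1ℚ * (factor x p * 1ℚ))) + 0ℚ +
        indicator p * (α * 0ℚ + β * (1ℚ * (0ℚ * (1ℚ * (1ℚ * 1ℚ))) + 0ℚ))) ≡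
        α * β * (factor (x + β) p * 0ℚ)
      go p = trans (lem α β (factor x p) (indicator p)) (lem′ α β (factor (x + β) p))
    final {suc m} (q ∷ v) = trans
      (cong₂ (λ y z → α * 0ℚ + β * (y + indicator p * (α * 0ℚ + β * z)))
        (trans (sum↑-mark q v (λ d → 1ℚ * (factor x p * monomial x (update↑ d (q ∷ v)))))
          (cong (λ w → indicator q * (α * (1ℚ * (factor x p * (factor x q * monomial x w)))))
            (update↑-noSymbols v)))
        (trans (sum↑-mark q v (λ d → 1ℚ * (1ℚ * monomial x (update↑ d (q ∷ v)))))
          (cong (λ w → indicator q * (α * (1ℚ * (1ℚ * (factor x q * monomial x w)))))
            (update↑-noSymbols v))))
      (go p q)
      where
      go : ∀ p q → α * 0ℚ + β *
        (indicator q * (α * (1ℚ * (factor x p * (factor x q * monomial x v)))) +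
        indicator p * (α * 0ℚ + β *
          (indicator q * (α * (1ℚ * (1ℚ * (factor x q * monomial x v))))))) ≡
        α * β * (factor (x + β) p * bottomFree (λ w → x * monomial x w) (q ∷ v))
      go true  true  = lem₁ α β x (monomial x v)
      go false true  = lem₂ α β x (monomial x v) (1ℚ * (α * (1ℚ * (1ℚ * (x * monomial x v)))))
      go p     false = lem₃ α β (factor (x + β) p) (α * (1ℚ * (factor x p * (1ℚ * monomial x v))))
        (α * (1ℚ * (1ℚ * (1ℚ * monomial x v)))) (indicator p)

  third : ∀ {n} → ℚ → Vec Bool n → ℚ
  third x v = double (α * β * x) * monomial x v + x * (α * x + β) * monomial (x + β) v

  -- The demanded row has to stay free. A bottom α gives the factor `x + β`; under a bottom β the
  -- demanded row takes nothing or an α. The coefficient 2 collects one `α * β * x` from the `β` in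
  -- `x + β` and one from that α.
  plain-second : ∀ {m} x (v : Vec Bool m) → plain (second x) v ≡ bottomFree (third x) v
  plain-second x []      = trans (columnSum-≡ [] (λ d → second x (update d [])))
    (lem α β (x + β))
    where
    lem : ∀ a b f → a * (f * 0ℚ) + b * (1ℚ * (1ℚ * 0ℚ) + 0ℚ) ≡ 0ℚ
    lem = solve-∀ ring
  plain-second {suc m} x (q ∷ v) = trans (columnSum-≡ (q ∷ v) (λ d → second x (update d (q ∷ v))))
    (trans (cong₂ (λ w z → α * ((x + β) * bottomFree ψ w) + β * z)
        (update↑-noSymbols (q ∷ v))
        (trans (sum↑-* (q ∷ v) 1ℚ (λ d → bottomFree ψ (update↑ d (q ∷ v))))
          (cong (1ℚ *_) (trans (sum↑-∷ q v (λ d → bottomFree ψ (update↑ d (q ∷ v))))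
            (cong₂ (λ w z → sum↑ v (λ d → bottomFree ψ (q ∷ update↑ d v)) +
                indicator q * (α * bottomFree ψ (q ∷ w) + β * z))
              (update↑-noSymbols v) (sum↑-zero v (λ d → refl)))))))
      (final q))
    where
    ψ : ∀ {n} → Vec Bool n → ℚ
    ψ w = x * monomial x w
    lem₁ : ∀ a b x m u → a * ((x + b) * (x * m)) + b * (1ℚ * (x * u + 1ℚ * (a * (x * m) + b * 0ℚ)))
      ≡
      a * (x + b) * (x * m) + a * b * x * m + x * (b * u)
    lem₁ = solve-∀ ring
    lem₂ : ∀ a b x m m′ → a * (x + b) * (x * m) + a * b * x * m + x * ((a * x + b) * m′ - a * x * m)
      ≡
      (a * b * x + a * b * x) * m + x * (a * x + b) * m′
    lem₂ = solve-∀ ring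
    lem₃ : ∀ a b s → a * (s * 0ℚ) + b * (1ℚ * (0ℚ + 0ℚ * (a * 0ℚ + b * 0ℚ))) ≡ 0ℚ
    lem₃ = solve-∀ ring
    final : ∀ q → α * ((x + β) * bottomFree ψ (q ∷ v)) +
      β * (1ℚ * (sum↑ v (λ d → bottomFree ψ (q ∷ update↑ d v)) + indicator
        q * (α * bottomFree ψ (q ∷ v) + β * 0ℚ))) ≡
      bottomFree (third x) (q ∷ v)
    final true  = trans
      (cong (λ u → α * ((x + β) * (x * monomial x v)) + β *
        (1ℚ * (u + 1ℚ * (α * (x * monomial x v) + β * 0ℚ))))
        (sum↑-* v x (λ d → monomial x (update↑ d v))))
      (trans (lem₁ α β x (monomial x v) (sum↑ v (λ d → monomial x (update↑ d v))))
        (trans (cong (λ z → α * (x + β) * (x * monomial x v) + α * β * x * monomial x v + x * z)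
            (sum↑-monomial x v))
          (lem₂ α β x (monomial x v) (monomial (x + β) v))))
    final false = trans
      (cong (λ u → α * ((x + β) * 0ℚ) + β * (1ℚ * (u + 0ℚ * (α * 0ℚ + β * 0ℚ))))
        (sum↑-zero v (λ d → refl)))
      (lem₃ α β (x + β))

  consecutive : ∀ {n} → ℚ → Vec Bool n → ℚ
  consecutive x v = α * β * x * bottomFree (λ w → x * monomial x w) v

  -- Marks in two neighbouring columns: the bottom box is β, the box on the demanded row is empty,
  -- and the α stands just above it. What remains is a demand on each of the two lowest rows.
  marked-second : ∀ {m} x (v : Vec Bool m) → marked (second x) v ≡ bottomFree (consecutive x) v
  marked-second x []      = trans (columnSum-≡ [] (λ d → ι (mark d) * second x (update d [])))
    (lem α β (x + β))
    where
    lem : ∀ a b f → a * (0ℚ * (f * 0ℚ)) + b * (1ℚ * (0ℚ * (1ℚ * 0ℚ)) + 0ℚ) ≡ 0ℚ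
    lem = solve-∀ ring
  marked-second {suc m} x (q ∷ v) = trans
    (columnSum-≡ (q ∷ v) (λ d → ι (mark d) * second x (update d (q ∷ v))))
    (trans (cong₂ (λ y z → α * y + β * z)
      (mark-noSymbols (suc m) 1 (second x (update (alpha ∷ noSymbols (suc m)) (q ∷ v))))
      (trans (sum↑-∷ q v φ)
        (cong₂ (λ y z → sum↑ v (λ d → φ (empty ∷ d)) + indicator q * (α * y + β * z))
          (mark-noSymbols m 0 (1ℚ * bottomFree ψ (update↑ (alpha ∷ noSymbols m) (q ∷ v))))
          (sum↑-zero v (λ d → lem₀ (ι (isα (entry d 0))))))))
      (final q v))
    where
    ψ : ∀ {n} → Vec Bool n → ℚ
    ψ w = x * monomial x w
    φ : Vec Symbol (suc m) → ℚ
    φ d = ι (isα (entry d 1)) * (1ℚ * bottomFree ψ (update↑ d (q ∷ v)))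
    lem₀ : ∀ i → i * (1ℚ * 0ℚ) ≡ 0ℚ
    lem₀ = solve-∀ ring
    lem₁ : ∀ a b s i → a * 0ℚ + b * (s + i * (a * 0ℚ + b * 0ℚ)) ≡ b * s
    lem₁ = solve-∀ ring
    lem₂ : ∀ a b x m → b * (1ℚ * (a * (1ℚ * (x * (x * m))))) ≡ a * b * x * (x * m)
    lem₂ = solve-∀ ring
    lem₃ : ∀ a b x s → b * (0ℚ * s) ≡ a * b * x * 0ℚ
    lem₃ = solve-∀ ring
    inner : ∀ {m} (v : Vec Bool m) →
      β * sum↑ v (λ d → ι (isα (entry d 0)) * (1ℚ * (x * monomial x (update↑ d v)))) ≡
        consecutive x v
    inner []      = lem α β x
      where
      lem : ∀ a b x → b * (1ℚ * (0ℚ * (1ℚ * (x * 1ℚ))) + 0ℚ) ≡ a * b * x * 0ℚ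
      lem = solve-∀ ring
    inner (p ∷ v) = trans
      (cong (β *_) (trans (sum↑-mark p v (λ d → 1ℚ * (x * monomial x (update↑ d (p ∷ v)))))
        (cong (λ w → indicator p * (α * (1ℚ * (x * (factor x p * monomial x w)))))
          (update↑-noSymbols v))))
      (go p)
      where
      go : ∀ p → β * (indicator p * (α * (1ℚ * (x * (factor x p * monomial x v))))) ≡
        consecutive x (p ∷ v)
      go true  = lem₂ α β x (monomial x v)
      go false = lem₃ α β x (α * (1ℚ * (x * (1ℚ * monomial x v))))
    final : ∀ {m} q (v : Vec Bool m) →
      α * 0ℚ + β * (sum↑ v (λ d → ι (isα (entry d 0)) * (1ℚ * bottomFree ψ (q ∷ update↑ d v))) +
        indicator q * (α * 0ℚ + β * 0ℚ)) ≡ bottomFree (consecutive x) (q ∷ v)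
    final true  v = trans
      (lem₁ α β (sum↑ v (λ d → ι (isα (entry d 0)) * (1ℚ * (x * monomial x (update↑ d v))))) 1ℚ)
        (inner v)
    final false v = trans (lem₁ α β (sum↑ v (λ d → ι (isα (entry d 0)) * (1ℚ * 0ℚ))) 0ℚ)
      (trans (cong (β *_) (sum↑-zero v (λ d → lem₀ (ι (isα (entry d 0)))))) (ℚ.*-zeroʳ β))

  -- The bottom row stays free only if its diagonal box holds α, and then the rest of the column is
  -- empty. Meeting a demand thus costs one column and a factor `α`, and leaves no room for a mark
  -- in that column.
  plain-bottomFree : ∀ {m} (ψ : ∀ {n} → Vec Bool n → ℚ) (v : Vec Bool m) → plain (bottomFree ψ) v ≡
    α * ψ v
  plain-bottomFree ψ v = trans (columnSum-≡ v (λ d → bottomFree ψ (update d v)))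
    (trans (cong₂ (λ w z → α * ψ w + β * z) (update↑-noSymbols v) (sum↑-zero v (λ d → refl)))
      (lem β (α * ψ v)))
    where
    lem : ∀ b p → p + b * 0ℚ ≡ p
    lem = solve-∀ ring

  marked-bottomFree : ∀ {m} (ψ : ∀ {n} → Vec Bool n → ℚ) (v : Vec Bool m) → marked (bottomFree ψ)
    v ≡ 0ℚ
  marked-bottomFree {m} ψ v = trans (columnSum-≡ v (λ d → ι (mark d) * bottomFree ψ (update d v)))
    (trans (cong₂ (λ y z → α * y + β * z)
        (mark-noSymbols m 1 (ψ (update↑ (noSymbols m) v)))
        (sum↑-zero v (λ d → ℚ.*-zeroʳ (ι (mark (beta ∷ d))))))
      (lem α β))
    where
    lem : ∀ a b → a * 0ℚ + b * 0ℚ ≡ 0ℚ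
    lem = solve-∀ ring

-- The moment recursion from weighted sums over boards

size-suc : ∀ r k → size r (suc k) ≡ suc (size r k)
size-suc zero    k = refl
size-suc (suc r) k = cong (λ n → suc (suc n)) (size-suc r k)

module Moments (α β : ℚ) where
  open Transfer α β

  E : ∀ n → (Vec Bool n → ℚ) → (ℕ → ℚ) → ℚ
  E n ψ c = ∑ℚ (boards n) (λ S → weight S * (ψ (free S) * c (marks S)))

  E-cong : ∀ n {ψ φ : Vec Bool n → ℚ} c → (∀ v → ψ v ≡ φ v) → E n ψ c ≡ E n φ c
  E-cong n c h = ∑-cong (boards n) (λ S → cong (λ p → weight S * (p * c (marks S))) (h (free S)))

  E-congʳ : ∀ n ψ {c e : ℕ → ℚ} → (∀ a → c a ≡ e a) → E n ψ c ≡ E n ψ e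
  E-congʳ n ψ h = ∑-cong (boards n) (λ S → cong (λ p → weight S * (ψ (free S) * p)) (h (marks S)))

  E-* : ∀ n k ψ c → E n (λ v → k * ψ v) c ≡ k * E n ψ c
  E-* n k ψ c = trans (∑-cong (boards n) (λ S → lem (weight S) k (ψ (free S)) (c (marks S))))
    (∑-*ˡ k (boards n) (λ S → weight S * (ψ (free S) * c (marks S))))
    where
    lem : ∀ w k p c → w * (k * p * c) ≡ k * (w * (p * c))
    lem = solve-∀ ring

  E-+ : ∀ n ψ φ c → E n (λ v → ψ v + φ v) c ≡ E n ψ c + E n φ c
  E-+ n ψ φ c = trans
    (∑-cong (boards n) (λ S → lem (weight S) (ψ (free S)) (φ (free S)) (c (marks S))))
    (∑-+ (boards n) (λ S → weight S * (ψ (free S) * c (marks S)))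
      (λ S → weight S * (φ (free S) * c (marks S))))
    where
    lem : ∀ w p q c → w * ((p + q) * c) ≡ w * (p * c) + w * (q * c)
    lem = solve-∀ ring

  E-zero : ∀ n ψ c → (∀ v → ψ v ≡ 0ℚ) → E n ψ c ≡ 0ℚ
  E-zero n ψ c h = ∑-zero (boards n) _ (λ S →
    trans (cong (λ p → weight S * (p * c (marks S))) (h (free S))) (lem (weight S) (c (marks S))))
    where
    lem : ∀ w c → w * (0ℚ * c) ≡ 0ℚ
    lem = solve-∀ ring

  E-zeroʳ : ∀ n ψ c → (∀ a → c a ≡ 0ℚ) → E n ψ c ≡ 0ℚ
  E-zeroʳ n ψ c h = ∑-zero (boards n) _ (λ S →
    trans (cong (λ p → weight S * (ψ (free S) * p)) (h (marks S))) (lem (weight S) (ψ (free S))))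
    where
    lem : ∀ w c → w * (c * 0ℚ) ≡ 0ℚ
    lem = solve-∀ ring

  mark-difference : ∀ {m} (d : Vec Symbol m) c a → c (mark d ℕ.+ a) ≡ c a + ι (mark d) * difference
    c a
  mark-difference d c a with entry d 2
  ... | empty = lem (c a) (difference c a)
    where
    lem : ∀ p q → p ≡ p + 0ℚ * q
    lem = solve-∀ ring
  ... | alpha = lem (c a) (c (suc a))
    where
    lem : ∀ p q → q ≡ p + 1ℚ * (q - p)
    lem = solve-∀ ring
  ... | beta  = lem (c a) (difference c a)
    where
    lem : ∀ p q → p ≡ p + 0ℚ * q
    lem = solve-∀ ring

  -- `mark d` is 0 or 1, so `c` of the new count is `c` of the old one plus `mark d` times a
  -- difference. For binomial coefficients the difference lowers `r` by one.
  E-suc : ∀ n ψ c → E (suc n) ψ c ≡ E n (plain ψ) c + E n (marked ψ) (difference c)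
  E-suc n ψ c = trans
    (∑-cartesianProductWith (λ S d → d ◂ S) (boards n) (rows (suc n))
      (λ S → weight S * (ψ (free S) * c (marks S))))
    (trans (∑-cong (boards n) step)
      (∑-+ (boards n) (λ S → weight S * (plain ψ (free S) * c (marks S)))
        (λ S → weight S * (marked ψ (free S) * difference c (marks S)))))
    where
    lem₁ : ∀ u w p c i d → u * w * (p * (c + i * d)) ≡ w * c * (u * p) + w * d * (u * (i * p))
    lem₁ = solve-∀ ring
    lem₂ : ∀ w c p d q → w * c * p + w * d * q ≡ w * (p * c) + w * (q * d)
    lem₂ = solve-∀ ring
    step : ∀ S → ∑ℚ (rows (suc n)) (λ d → columnWeight d (free S) * weight S *
        (ψ (update d (free S)) * c (mark d ℕ.+ marks S))) ≡
      weight S * (plain ψ (free S) * c (marks S)) + weight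
        S * (marked ψ (free S) * difference c (marks S))
    step S = trans
      (∑-cong (rows (suc n)) (λ d → trans
        (cong (λ z → columnWeight d v * w * (ψ (update d v) * z)) (mark-difference d c a))
        (lem₁ (columnWeight d v) w (ψ (update d v)) (c a) (ι (mark d)) (difference c a))))
      (trans (∑-+ (rows (suc n)) (λ d → w * c a * (columnWeight d v * ψ (update d v)))
          (λ d → w * difference c a * (columnWeight d v * (ι (mark d) * ψ (update d v)))))
        (trans (cong₂ _+_
            (∑-*ˡ (w * c a) (rows (suc n)) (λ d → columnWeight d v * ψ (update d v)))
            (∑-*ˡ (w * difference c a) (rows (suc n))
              (λ d → columnWeight d v * (ι (mark d) * ψ (update d v)))))
          (lem₂ w (c a) (plain ψ v) (difference c a) (marked ψ v))))
      where
      v = free S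
      w = weight S
      a = marks S

  G : ℕ → (ℕ → ℚ) → ℚ → ℚ
  G n c x = E n (monomial x) c

  G-suc : ∀ n c x → G (suc n) c x ≡
    (α * x + β) * G n c (x + β) + α * β * E n (second x) (difference c)
  G-suc n c x = trans (E-suc n (monomial x) c) (cong₂ _+_
    (trans (E-cong n c (plain-monomial x)) (E-* n (α * x + β) (monomial (x + β)) c))
    (trans (E-cong n (difference c) (marked-monomial x)) (E-* n (α * β) (second x) (difference c))))

  E-bottomFree-suc : ∀ n (ψ : ∀ {m} → Vec Bool m → ℚ) c → E (suc n) (bottomFree ψ) c ≡ α * E n ψ c
  E-bottomFree-suc n ψ c = trans (E-suc n (bottomFree ψ) c)
    (trans (cong₂ _+_
        (trans (E-cong n c (plain-bottomFree ψ)) (E-* n α ψ c))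
        (E-zero n (marked (bottomFree ψ)) (difference c) (marked-bottomFree ψ)))
      (ℚ.+-identityʳ _))

  E-bottomFree-zero : ∀ (ψ : ∀ {m} → Vec Bool m → ℚ) c → E 0 (bottomFree ψ) c ≡ 0ℚ
  E-bottomFree-zero ψ c = lem (c 0)
    where
    lem : ∀ c → 1ℚ * (0ℚ * c) + 0ℚ ≡ 0ℚ
    lem = solve-∀ ring

  E-second-suc : ∀ n x c → E (suc n) (second x) c ≡
    E n (bottomFree (third x)) c + E n (bottomFree (consecutive x)) (difference c)
  E-second-suc n x c = trans (E-suc n (second x) c)
    (cong₂ _+_ (E-cong n c (plain-second x)) (E-cong n (difference c) (marked-second x)))

  E-second-0 : ∀ x c → E 0 (second x) c ≡ 0ℚ
  E-second-0 x c = lem (c 0)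
    where
    lem : ∀ c → 1ℚ * (0ℚ * c) + 0ℚ ≡ 0ℚ
    lem = solve-∀ ring

  E-second-1 : ∀ x c → E 1 (second x) c ≡ 0ℚ
  E-second-1 x c = trans (E-second-suc 0 x c)
    (cong₂ _+_ (E-bottomFree-zero (third x) c) (E-bottomFree-zero (consecutive x) (difference c)))

  -- The remainder of a neighbouring pair of marks, with one demand still open; `J-suc` meets it
  -- with one more column.
  J : ℕ → (ℕ → ℚ) → ℚ → ℚ
  J n c x = E n (bottomFree (λ w → x * monomial x w)) c

  J-suc : ∀ n c x → J (suc n) c x ≡ α * (x * G n c x)
  J-suc n c x = trans (E-bottomFree-suc n (λ w → x * monomial x w) c)
    (cong (α *_) (E-* n x (monomial x) c))

  E-second-2+ : ∀ n x c → E (suc (suc n)) (second x) c ≡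
    α * (double (α * β * x) * G n c x + x * (α * x + β) * G n c (x + β)) +
    α * (α * β * x * J n (difference c) x)
  E-second-2+ n x c = trans (E-second-suc (suc n) x c) (cong₂ _+_
    (trans (E-bottomFree-suc n (third x) c) (cong (α *_) (trans
      (E-+ n (λ v → double (α * β * x) * monomial x v) (λ v → x * (α * x + β) * monomial (x + β) v)
        c)
      (cong₂ _+_ (E-* n (double (α * β * x)) (monomial x) c)
                 (E-* n (x * (α * x + β)) (monomial (x + β)) c)))))
    (trans (E-bottomFree-suc n (consecutive x) (difference c)) (cong (α *_)
      (E-* n (α * β * x) (bottomFree (λ w → x * monomial x w)) (difference c)))))

  module Scaled (a b : ℚ) (αa≡1 : α * a ≡ 1ℚ) (βb≡1 : β * b ≡ 1ℚ) where

    s : ℚ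
    s = a * b

    g : ℕ → ℕ → ℚ → ℚ
    g r n y = pow s n * G n (binomial r) (β * y)

    -- One mark and one column fewer than `g r n`, as `J-suc` spends a further column; where there
    -- is none, a pair of marks contributes 0.
    g⁻ : ℕ → ℕ → ℚ → ℚ
    g⁻ zero    n       y = 0ℚ
    g⁻ (suc r) zero    y = 0ℚ
    g⁻ (suc r) (suc n) y = g r n y

    shift : ∀ y → β * y + β ≡ β * (y + 1ℚ)
    shift y = lem β y
      where
      lem : ∀ b y → b * y + b ≡ b * (y + 1ℚ)
      lem = solve-∀ ring

    first-term : ∀ S y G → s * S * ((α * (β * y) + β) * G) ≡ (y + a) * (S * G)
    first-term S y G = trans (lem a b α β S y G) (trans
      (cong₂ (λ u w → (u * w * y + a * w) * (S * G)) αa≡1 βb≡1) (lem′ y a S G))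
      where
      lem : ∀ a b α β S y G → a * b * S * ((α * (β * y) + β) * G) ≡
        (α * a * (β * b) * y + a * (β * b)) * (S * G)
      lem = solve-∀ ring
      lem′ : ∀ y a S G → (1ℚ * 1ℚ * y + a * 1ℚ) * (S * G) ≡ (y + a) * (S * G)
      lem′ = solve-∀ ring

    g-suc : ∀ r n y → g r (suc n) y ≡
      (y + a) * g r n (y + 1ℚ) + s * pow s
        n * (α * β * E n (second (β * y)) (difference (binomial r)))
    g-suc r n y = trans (cong (s * pow s n *_) (G-suc n (binomial r) (β * y)))
      (trans (ℚ.*-distribˡ-+ (s * pow s n) ((α * (β * y) + β) * G n (binomial r) (β * y + β)) _)
        (cong (_+ s * pow s n * (α * β * E n (second (β * y)) (difference (binomial r))))
          (trans (first-term (pow s n) y (G n (binomial r) (β * y + β)))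
            (cong (λ x → (y + a) * (pow s n * G n (binomial r) x)) (shift y)))))

    second-zero : ∀ n x → E n (second x) (difference (binomial 0)) ≡ 0ℚ
    second-zero n x = E-zeroʳ n (second x) (difference (binomial 0)) (λ _ → refl)

    g-suc-zero : ∀ r n y → E n (second (β * y)) (difference (binomial r)) ≡ 0ℚ →
      g r (suc n) y ≡ (y + a) * g r n (y + 1ℚ)
    g-suc-zero r n y h = trans (g-suc r n y)
      (trans (cong (λ z → (y + a) * g r n (y + 1ℚ) + s * pow s n * (α * β * z)) h)
        (lem ((y + a) * g r n (y + 1ℚ)) (s * pow s n) (α * β)))
      where
      lem : ∀ p q r → p + q * (r * 0ℚ) ≡ p
      lem = solve-∀ ring

    J-step : ∀ r n y S → S ≡ pow s n →
      s * (s * (s * S)) * (α * β * (α * (α * β * (β * y) * J n (difference (binomial r)) (β * y))))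
        ≡
      y * y * g⁻ r n y
    J-step zero    n y S eq = trans
      (cong (λ j → s * (s * (s * S)) * (α * β * (α * (α * β * (β * y) * j))))
        (E-zeroʳ n (bottomFree (λ w → β * y * monomial (β * y) w)) (difference (binomial 0))
          (λ _ → refl)))
      (lem (s * (s * (s * S))) (α * β) α (α * β * (β * y)) y)
      where
      lem : ∀ p q r t y → p * (q * (r * (t * 0ℚ))) ≡ y * y * 0ℚ
      lem = solve-∀ ring
    J-step (suc r) zero y S eq = trans
      (cong (λ j → s * (s * (s * S)) * (α * β * (α * (α * β * (β * y) * j))))
        (E-bottomFree-zero (λ w → β * y * monomial (β * y) w) (difference (binomial (suc r)))))
      (lem (s * (s * (s * S))) (α * β) α (α * β * (β * y)) y)
      where
      lem : ∀ p q r t y → p * (q * (r * (t * 0ℚ))) ≡ y * y * 0ℚ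
      lem = solve-∀ ring
    J-step (suc r) (suc n) y S eq = trans
      (cong₂ (λ S j → s * (s * (s * S)) * (α * β * (α * (α * β * (β * y) * j)))) eq
        (trans (E-congʳ (suc n) (bottomFree (λ w → β * y * monomial (β * y) w))
          (difference-binomial r)) (J-suc n (binomial r) (β * y))))
      (trans (lem a b α β y (pow s n) (G n (binomial r) (β * y)))
        (trans (cong₂ (λ u w →
          u * u * (u * u) * (w * w * (w * w)) * (y * y * (pow s n * G n (binomial r) (β * y))))
            αa≡1 βb≡1)
          (lem′ (y * y * (pow s n * G n (binomial r) (β * y))))))
      where
      lem : ∀ a b α β y S G →
        a * b * (a * b * (a * b * (a * b * S))) *
          (α * β * (α * (α * β * (β * y) * (α * (β * y * G))))) ≡
        α * a * (α * a) * (α * a * (α * a)) * (β * b * (β * b) * (β * b * (β * b))) *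
          (y * y * (S * G))
      lem = solve-∀ ring
      lem′ : ∀ p → 1ℚ * 1ℚ * (1ℚ * 1ℚ) * (1ℚ * 1ℚ * (1ℚ * 1ℚ)) * p ≡ p
      lem′ = solve-∀ ring

    g-3+ : ∀ r n y → g (suc r) (suc (suc (suc n))) y ≡
      (y + a) * g (suc r) (suc (suc n)) (y + 1ℚ) +
      (y * (y + a) * g r n (y + 1ℚ) + double y * g r n y + y * y * g⁻ r n y)
    g-3+ r n y = trans (g-suc (suc r) (suc (suc n)) y)
      (cong ((y + a) * g (suc r) (suc (suc n)) (y + 1ℚ) +_)
        (trans (cong (λ z → s * (s * (s * S)) * (α * β * z))
            (trans (E-congʳ (suc (suc n)) (second x) (difference-binomial r))
              (E-second-2+ n x (binomial r))))
          (trans (lem₁ (s * (s * (s * S))) (α * β)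
            (α * (double (α * β * x) * G₀ + x * (α * x + β) * G₁))
              (α * (α * β * x * J n (difference (binomial r)) x)))
            (cong₂ _+_
              (trans (lem₂ a b α β y S G₀ G₁)
                (trans (cong₂ (λ u w → u * u * (w * w) * y * ((u * w * y + a * w) * (S * G₁)) +
                    double (u * u * u * (w * w * w) * y * (S * G₀))) αa≡1 βb≡1)
                  (trans (lem₃ a y S G₀ G₁)
                    (cong (λ x → y * (y + a) * (S * G n (binomial r) x) + double y * (S * G₀))
                      (shift y)))))
              (J-step r n y S refl)))))
      where
      x S G₀ G₁ : ℚ
      x = β * y
      S = pow s n
      G₀ = G n (binomial r) x
      G₁ = G n (binomial r) (x + β)
      lem₁ : ∀ p q u v → p * (q * (u + v)) ≡ p * (q * u) + p * (q * v)
      lem₁ = solve-∀ ring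
      lem₂ : ∀ a b α β y S G₀ G₁ →
        a * b * (a * b * (a * b * S)) * (α * β *
          (α * ((α * β * (β * y) + α * β * (β * y)) * G₀ + β * y * (α * (β * y) + β) * G₁))) ≡
        α * a * (α * a) * (β * b * (β * b)) * y * ((α * a * (β * b) * y + a * (β * b)) * (S * G₁)) +
        (α * a * (α * a) * (α * a) * (β * b * (β * b) * (β * b)) * y * (S * G₀) +
         α * a * (α * a) * (α * a) * (β * b * (β * b) * (β * b)) * y * (S * G₀))
      lem₂ = solve-∀ ring
      lem₃ : ∀ a y S G₀ G₁ →
        1ℚ * 1ℚ * (1ℚ * 1ℚ) * y * ((1ℚ * 1ℚ * y + a * 1ℚ) * (S * G₁)) +
        (1ℚ * 1ℚ * 1ℚ * (1ℚ * 1ℚ * 1ℚ) * y * (S * G₀) + 1ℚ * 1ℚ * 1ℚ * (1ℚ * 1ℚ * 1ℚ) * y *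
          (S * G₀)) ≡
        y * (y + a) * (S * G₁) + (y + y) * (S * G₀)
      lem₃ = solve-∀ ring

    g-0 : ∀ r y → g (suc r) 0 y ≡ 0ℚ
    g-0 r y = refl

    g-1 : ∀ r y → g (suc r) 1 y ≡ 0ℚ
    g-1 r y = trans (g-suc-zero (suc r) 0 y (E-second-0 (β * y) (difference (binomial (suc r)))))
      (ℚ.*-zeroʳ (y + a))

    g-2 : ∀ r y → g (suc r) 2 y ≡ 0ℚ
    g-2 r y = trans (g-suc-zero (suc r) 1 y (E-second-1 (β * y) (difference (binomial (suc r)))))
      (trans (cong ((y + a) *_) (g-1 r (y + 1ℚ))) (ℚ.*-zeroʳ (y + a)))

    vanish : ∀ p u q v w → p * 0ℚ + (u * 0ℚ + q * 0ℚ + v * w) ≡ v * w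
    vanish = solve-∀ ring

    -- Fewer than `2 r` columns have no room for `r` marks. At `k = 0` the recursion refers to such
    -- sizes, which `γ` does not index.
    g-vanish : ∀ r n y → n ℕ.< size r 0 → g r n y ≡ 0ℚ
    g-vanish (suc r) 0 y h = g-0 r y
    g-vanish (suc r) 1 y h = g-1 r y
    g-vanish (suc r) 2 y h = g-2 r y
    g-vanish (suc zero) (suc (suc (suc n))) y (ℕ.s≤s (ℕ.s≤s ()))
    g-vanish (suc (suc r)) (suc (suc (suc n))) y (ℕ.s≤s (ℕ.s≤s h@(ℕ.s≤s h′))) =
      trans (g-3+ (suc r) n y)
        (trans (cong₂ (λ p q →
          (y + a) * p + (y * (y + a) * q + double y * g (suc r) n y + y * y * g⁻ (suc r) n y))
            (g-vanish (suc (suc r)) (suc (suc n)) (y + 1ℚ)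
              (ℕ.s≤s (ℕ.s≤s (ℕ.≤-trans (ℕ.n≤1+n _) h))))
            (g-vanish (suc r) n (y + 1ℚ) h″))
          (trans (cong₂ (λ p q → (y + a) * 0ℚ + (y * (y + a) * 0ℚ + double y * p + y * y * q))
              (g-vanish (suc r) n y h″) (g⁻-vanish n h′))
            (trans (vanish (y + a) (y * (y + a)) (double y) (y * y) 0ℚ) (ℚ.*-zeroʳ (y * y)))))
      where
      h″ : n ℕ.< size (suc r) 0
      h″ = ℕ.≤-trans (ℕ.n≤1+n _) h
      g⁻-vanish : ∀ n → suc n ℕ.≤ suc (size r 0) → g⁻ (suc r) n y ≡ 0ℚ
      g⁻-vanish zero    h = refl
      g⁻-vanish (suc n) (ℕ.s≤s h) = g-vanish r n y h

    γ : ℕ → ℕ → ℚ → ℚ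
    γ r k y = g r (size r k) y

    momentRecursion : MomentRecursion a γ
    momentRecursion = record
      { zero-zero = λ _ → refl
      ; zero-suc  = λ k y → g-suc-zero 0 k y (second-zero k (β * y))
      ; suc-zero  = suc-zero
      ; suc-suc   = suc-suc
      }
      where
      suc-zero : ∀ r y → γ (suc r) 0 y ≡ y * y * previous γ r 0 y
      suc-zero zero    y = trans (g-2 0 y) (sym (ℚ.*-zeroʳ (y * y)))
      suc-zero (suc r) y = trans (g-3+ (suc r) (suc (size r 0)) y)
        (trans (cong₂ (λ p q →
          (y + a) * p + (y * (y + a) * q + double y * g (suc r) (suc (size r 0)) y + y * y * g r
            (size r 0) y))
            (g-vanish (suc (suc r)) _ (y + 1ℚ) ℕ.≤-refl)
            (g-vanish (suc r) _ (y + 1ℚ) ℕ.≤-refl))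
          (trans (cong (λ p → (y + a) * 0ℚ + (y * (y + a) * 0ℚ + double y * p + y * y * g r
            (size r 0) y))
              (g-vanish (suc r) _ y ℕ.≤-refl))
            (vanish (y + a) (y * (y + a)) (double y) (y * y) (g r (size r 0) y))))
      previous-g⁻ : ∀ r k y → g⁻ r (size r k) y ≡ previous γ r (suc k) y
      previous-g⁻ zero    k y = refl
      previous-g⁻ (suc r) k y = cong (λ n → g r n y) (sym (size-suc r k))
      suc-suc : ∀ r k y → γ (suc r) (suc k) y ≡ (y + a) * γ (suc r) k (y + 1ℚ) +
        (y * (y + a) * γ r k (y + 1ℚ) + double y * γ r k y + y * y * previous γ r (suc k) y)
      suc-suc r k y = trans (cong (λ n → g (suc r) n y) (size-suc (suc r) k))
        (trans (g-3+ r (size r k) y)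
          (cong (λ p → (y + a) * γ (suc r) k (y + 1ℚ) +
              (y * (y + a) * γ r k (y + 1ℚ) + double y * γ r k y + y * y * p))
            (previous-g⁻ r k y)))

-- Boards and fillings in bijection

entry-≥ : ∀ {m} (r : Vec Symbol m) j → m ℕ.≤ j → entry r j ≡ empty
entry-≥ []      j       h         = refl
entry-≥ (s ∷ r) (suc j) (ℕ.s≤s h) = entry-≥ r j h

entry-∷ʳ-last : ∀ {m} (r : Vec Symbol m) s → entry (r ∷ʳ s) m ≡ s
entry-∷ʳ-last []      s = refl
entry-∷ʳ-last (_ ∷ r) s = entry-∷ʳ-last r s

entry-∷ʳ-init : ∀ {m} (r : Vec Symbol m) s j → j ℕ.< m → entry (r ∷ʳ s) j ≡ entry r j
entry-∷ʳ-init (_ ∷ r) s zero    h         = refl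
entry-∷ʳ-init (_ ∷ r) s (suc j) (ℕ.s≤s h) = entry-∷ʳ-init r s j h

entry-reverse : ∀ {n} (d : Vec Symbol (suc n)) i p → i ℕ.+ p ≡ n → entry (reverse d) i ≡ entry d p
entry-reverse (s ∷ d) i zero    eq = trans (cong (λ r → entry r i) (Vec.reverse-∷ s d))
  (trans (cong (entry (reverse d ∷ʳ s)) (trans (sym (ℕ.+-identityʳ i)) eq))
    (entry-∷ʳ-last (reverse d) s))
entry-reverse {zero}  (s ∷ []) i (suc p) eq with () ← trans (sym (ℕ.+-suc i p)) eq
entry-reverse {suc n} (s ∷ d)  i (suc p) eq = trans (cong (λ r → entry r i) (Vec.reverse-∷ s d))
  (trans (entry-∷ʳ-init (reverse d) s i (subst (i ℕ.<_) (cong suc i+p≡n) (ℕ.s≤s (ℕ.m≤m+n i p))))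
    (entry-reverse d i p i+p≡n))
  where
  i+p≡n : i ℕ.+ p ≡ n
  i+p≡n = ℕ.suc-injective (trans (sym (ℕ.+-suc i p)) eq)

isOne : Symbol → Symbol → ℕ
isOne s t with does (s ≟ t)
... | true  = 1
... | false = 0

count-∷ : ∀ {m} s t (r : Vec Symbol m) → Vec.count (s ≟_) (t ∷ r) ≡ isOne s t ℕ.+ Vec.count (s ≟_) r
count-∷ s t r with does (s ≟ t)
... | true  = refl
... | false = refl

count-∷ʳ : ∀ {m} s t (r : Vec Symbol m) → Vec.count (s ≟_) (r ∷ʳ t) ≡ isOne s t ℕ.+ Vec.count (s ≟_)
  r
count-∷ʳ s t []      = count-∷ s t []
count-∷ʳ s t (x ∷ r) = trans (count-∷ s x (r ∷ʳ t))
  (trans (cong (isOne s x ℕ.+_) (count-∷ʳ s t r))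
    (trans (ℕ.+-comm (isOne s x) _)
      (trans (ℕ.+-assoc (isOne s t) _ (isOne s x))
        (cong (isOne s t ℕ.+_) (trans (ℕ.+-comm _ (isOne s x)) (sym (count-∷ s x r)))))))

count-reverse : ∀ {m} s (r : Vec Symbol m) → Vec.count (s ≟_) (reverse r) ≡ Vec.count (s ≟_) r
count-reverse s []      = refl
count-reverse s (t ∷ r) = trans (cong (Vec.count (s ≟_)) (Vec.reverse-∷ t r))
  (trans (count-∷ʳ s t (reverse r))
    (trans (cong (isOne s t ℕ.+_) (count-reverse s r)) (sym (count-∷ s t r))))

addColumn : ∀ {n} → Vec Symbol (suc n) → Filling n → Filling (suc n)
addColumn (s ∷ c)  (r ∷ T) = (s ∷ r) ∷ addColumn c T
addColumn (s ∷ []) []      = (s ∷ []) ∷ []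

addColumn-zero : ∀ {n} c (T : Filling n) i → addColumn c T [ i , 0 ] ≡ entry c i
addColumn-zero (s ∷ []) []      zero    = refl
addColumn-zero (s ∷ []) []      (suc i) = refl
addColumn-zero (s ∷ c)  (r ∷ T) zero    = refl
addColumn-zero (s ∷ c)  (r ∷ T) (suc i) = addColumn-zero c T i

addColumn-suc : ∀ {n} c (T : Filling n) i j → addColumn c T [ i , suc j ] ≡ T [ i , j ]
addColumn-suc (s ∷ []) []      zero    j = refl
addColumn-suc (s ∷ []) []      (suc i) j = refl
addColumn-suc (s ∷ c)  (r ∷ T) zero    j = refl
addColumn-suc (s ∷ c)  (r ∷ T) (suc i) j = addColumn-suc c T i j

∷-injective : ∀ {n} {r r′ : Vec Symbol (suc n)} {T T′ : Filling n} →
  Filling._∷_ r T ≡ r′ ∷ T′ → r ≡ r′ × T ≡ T′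
∷-injective refl = refl , refl

addColumn-injective : ∀ {n} {c c′ : Vec Symbol (suc n)} {T T′ : Filling n} →
  addColumn c T ≡ addColumn c′ T′ → c ≡ c′ × T ≡ T′
addColumn-injective {c = s ∷ []} {s′ ∷ []} {[]} {[]} refl = refl , refl
addColumn-injective {c = s ∷ c} {s′ ∷ c′} {r ∷ T} {r′ ∷ T′} eq with ∷-injective eq
... | refl , eq′ with addColumn-injective {c = c} {c′} {T} {T′} eq′
...   | refl , refl = refl , refl

addColumn-surjective : ∀ {n} (T : Filling (suc n)) → ∃ λ c → ∃ λ T′ → addColumn c T′ ≡ T
addColumn-surjective ((s ∷ []) ∷ [])      = s ∷ [] , [] , refl
addColumn-surjective ((s ∷ r) ∷ T@(_ ∷ _)) with addColumn-surjective T
... | c , T′ , eq = s ∷ c , r ∷ T′ , cong ((s ∷ r) ∷_) eq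

number-addColumn : ∀ {n} s c (T : Filling n) →
  number s (addColumn c T) ≡ Vec.count (s ≟_) c ℕ.+ number s T
number-addColumn s (t ∷ []) []      = refl
number-addColumn s (t ∷ c)  (r ∷ T) = trans
  (cong₂ ℕ._+_ (count-∷ s t r) (number-addColumn s c T))
  (trans (lem (isOne s t) (Vec.count (s ≟_) r) (Vec.count (s ≟_) c) (number s T))
    (cong (ℕ._+ (Vec.count (s ≟_) r ℕ.+ number s T)) (sym (count-∷ s t c))))
  where
  lem : ∀ a b c d → (a ℕ.+ b) ℕ.+ (c ℕ.+ d) ≡ (a ℕ.+ c) ℕ.+ (b ℕ.+ d)
  lem a b c d = trans (ℕ.+-assoc a b (c ℕ.+ d)) (trans (cong (a ℕ.+_)
    (trans (sym (ℕ.+-assoc b c d)) (trans (cong (ℕ._+ d) (ℕ.+-comm b c)) (ℕ.+-assoc c b d))))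
    (sym (ℕ.+-assoc a c (b ℕ.+ d))))

-- Columns of a board run upwards and rows of a filling downwards, hence `reverse`.
toFilling : ∀ {n} → Board n → Filling n
toFilling []      = []
toFilling (d ◂ S) = addColumn (reverse d) (toFilling S)

toFilling-injective : ∀ {n} {S S′ : Board n} → toFilling S ≡ toFilling S′ → S ≡ S′
toFilling-injective {S = []}    {[]}      eq = refl
toFilling-injective {S = d ◂ S} {d′ ◂ S′} eq
  with addColumn-injective {c = reverse d} {reverse d′} {toFilling S} {toFilling S′} eq
... | p , q = cong₂ _◂_ (Vec.reverse-injective p) (toFilling-injective q)

toFilling-surjective : ∀ {n} (T : Filling n) → ∃ λ S → toFilling S ≡ T
toFilling-surjective []        = [] , refl
toFilling-surjective T@(_ ∷ _) with addColumn-surjective T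
... | c , T′ , eq with toFilling-surjective T′
...   | S , refl = reverse c ◂ S ,
  trans (cong (λ c → addColumn c (toFilling S)) (Vec.reverse-involutive c)) eq

∈-boards : ∀ {n} (S : Board n) → S ∈ boards n
∈-boards []      = here refl
∈-boards (d ◂ S) = ∈.∈-cartesianProductWith⁺ (λ S d → d ◂ S) (∈-boards S) (∈-rows d)

boards-unique : ∀ n → Unique (boards n)
boards-unique zero    = All.[] AllPairs.∷ AllPairs.[]
boards-unique (suc n) = Unique.cartesianProductWith⁺ (λ S d → d ◂ S) (λ { refl → refl , refl })
  (boards-unique n) (rows-unique (suc n))

-- Both lists are complete and free of repetitions, so they agree up to order, which a sum does not
-- see.
boards-↭ : ∀ n → map toFilling (boards n) ↭ fillings n
boards-↭ n = ∼bag⇒↭ (unique∧set⇒bag (Unique.map⁺ toFilling-injective (boards-unique n))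
  (fillings-unique n)
  (λ {T} → mk⇔ (λ _ → ∈-fillings T) (λ _ → from T)))
  where
  from : ∀ T → T ∈ map toFilling (boards n)
  from T with toFilling-surjective T
  ... | S , refl = ∈.∈-map⁺ toFilling (∈-boards S)

length-filter-cong : ∀ {P Q : Pred ℕ 0ℓ} (P? : Decidable P) (Q? : Decidable Q) (f g : ℕ → ℕ) m →
  (∀ j → does (P? (f j)) ≡ does (Q? (g j))) →
  length (filter P? (List.applyUpTo f m)) ≡ length (filter Q? (List.applyUpTo g m))
length-filter-cong P? Q? f g zero    h = refl
length-filter-cong P? Q? f g (suc m) h with does (P? (f 0)) | does (Q? (g 0)) | h 0
... | true  | true  | _ = cong suc (length-filter-cong P? Q? (f ∘ suc) (g ∘ suc) m (h ∘ suc))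
... | false | false | _ = length-filter-cong P? Q? (f ∘ suc) (g ∘ suc) m (h ∘ suc)

A⁽³⁾-addColumn : ∀ {n} (d : Vec Symbol (suc n)) (T : Filling n) →
  A⁽³⁾ (addColumn (reverse d) T) ≡ mark d ℕ.+ A⁽³⁾ T
-- Sizes 1 and 2 have no third diagonal, and `mark` then reads beyond the end of the column.
A⁽³⁾-addColumn {zero}        (_ ∷ [])     T = refl
A⁽³⁾-addColumn {suc zero}    (_ ∷ _ ∷ []) T = refl
A⁽³⁾-addColumn {suc (suc m)} d            T = trans head-tail
  (cong (mark d ℕ.+_) (length-filter-cong
    (λ j → addColumn (reverse d) T [ m ℕ.∸ j , j ] ≟ alpha) (λ j → T [ m ℕ.∸ 1 ℕ.∸ j , j ] ≟ alpha)
      suc (λ j → j) m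
    (λ j → cong (λ s → does (s ≟ alpha)) (trans (addColumn-suc (reverse d) T (m ℕ.∸ suc j) j)
      (cong (λ i → T [ i , j ]) (sym (ℕ.∸-+-assoc m 1 j)))))))
  where
  top : addColumn (reverse d) T [ m , 0 ] ≡ entry d 2
  top = trans (addColumn-zero (reverse d) T m) (entry-reverse d m 2 (ℕ.+-comm m 2))
  head-tail : A⁽³⁾ (addColumn (reverse d) T) ≡ mark d ℕ.+
    length (filter (λ j → addColumn (reverse d) T [ m ℕ.∸ j , j ] ≟ alpha) (List.applyUpTo suc m))
  head-tail rewrite top with entry d 2
  ... | empty = refl
  ... | alpha = refl
  ... | beta  = refl

marks-toFilling : ∀ {n} (S : Board n) → A⁽³⁾ (toFilling S) ≡ marks S
marks-toFilling []      = refl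
marks-toFilling (d ◂ S) = trans (A⁽³⁾-addColumn d (toFilling S))
  (cong (mark d ℕ.+_) (marks-toFilling S))

-- The tableau conditions, column by column

noneOk : ∀ {m} → Vec Symbol m → Bool
noneOk []          = true
noneOk (empty ∷ d) = noneOk d
noneOk (_ ∷ d)     = false

upOk : ∀ {m} → Vec Symbol m → Vec Bool m → Bool
upOk []          []      = true
upOk (empty ∷ d) (b ∷ v) = upOk d v
upOk (alpha ∷ d) (b ∷ v) = b ∧ noneOk d
upOk (beta ∷ d)  (b ∷ v) = b ∧ upOk d v

columnOk : ∀ {m} → Vec Symbol (suc m) → Vec Bool m → Bool
columnOk (empty ∷ d) v = false
columnOk (alpha ∷ d) v = noneOk d
columnOk (beta ∷ d)  v = upOk d v

at : ∀ {m} → Vec Bool m → ℕ → Bool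
at []      _       = false
at (b ∷ _) zero    = b
at (_ ∷ v) (suc p) = at v p

EmptyFurtherUp : ∀ {m} → Vec Symbol m → Set
EmptyFurtherUp d = ∀ p q → p ℕ.< q → entry d p ≡ alpha → entry d q ≡ empty

OnFreeRows : ∀ {m} → Vec Symbol m → Vec Bool m → Set
OnFreeRows d v = ∀ p → entry d p ≢ empty → at v p ≡ true

noneOk-sound : ∀ {m} (d : Vec Symbol m) → noneOk d ≡ true → ∀ p → entry d p ≡ empty
noneOk-sound []          ok p       = refl
noneOk-sound (empty ∷ d) ok zero    = refl
noneOk-sound (empty ∷ d) ok (suc p) = noneOk-sound d ok p

noneOk-complete : ∀ {m} (d : Vec Symbol m) → (∀ p → entry d p ≡ empty) → noneOk d ≡ true
noneOk-complete []          h = refl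
noneOk-complete (empty ∷ d) h = noneOk-complete d (λ p → h (suc p))
noneOk-complete (alpha ∷ d) h with () ← h 0
noneOk-complete (beta ∷ d)  h with () ← h 0

∧-true : ∀ {b c} → b ∧ c ≡ true → b ≡ true × c ≡ true
∧-true {true} {true} refl = refl , refl

upOk-sound : ∀ {m} (d : Vec Symbol m) v → upOk d v ≡ true → EmptyFurtherUp d × OnFreeRows d v
upOk-sound []          []      ok = (λ _ _ _ _ → refl) , λ _ h → ⊥-elim (h refl)
upOk-sound (empty ∷ d) (b ∷ v) ok with upOk-sound d v ok
... | up , on = (λ { (suc p) (suc q) (ℕ.s≤s lt) eq → up p q lt eq }) ,
                λ { zero h → ⊥-elim (h refl) ; (suc p) h → on p h }
upOk-sound (alpha ∷ d) (b ∷ v) ok with ∧-true {b} ok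
... | b≡true , ok′ =
  (λ { zero (suc q) _ _ → noneOk-sound d ok′ q
     ; (suc p) (suc q) _ _ → noneOk-sound d ok′ q }) ,
  λ { zero h → b≡true ; (suc p) h → ⊥-elim (h (noneOk-sound d ok′ p)) }
upOk-sound (beta ∷ d)  (b ∷ v) ok with ∧-true {b} ok
... | b≡true , ok′ with upOk-sound d v ok′
...   | up , on = (λ { (suc p) (suc q) (ℕ.s≤s lt) eq → up p q lt eq }) ,
                  λ { zero h → b≡true ; (suc p) h → on p h }

upOk-complete : ∀ {m} (d : Vec Symbol m) v → EmptyFurtherUp d → OnFreeRows d v → upOk d v ≡ true
upOk-complete []          []      up on = refl
upOk-complete (empty ∷ d) (b ∷ v) up on =
  upOk-complete d v (λ p q lt → up (suc p) (suc q) (ℕ.s≤s lt)) (λ p → on (suc p))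
upOk-complete (alpha ∷ d) (b ∷ v) up on = cong₂ _∧_ (on 0 (λ ()))
  (noneOk-complete d (λ q → up 0 (suc q) (ℕ.s≤s ℕ.z≤n) refl))
upOk-complete (beta ∷ d)  (b ∷ v) up on = cong₂ _∧_ (on 0 (λ ()))
  (upOk-complete d v (λ p q lt → up (suc p) (suc q) (ℕ.s≤s lt)) (λ p → on (suc p)))

-- The index is shifted by one because `v` has no entry for the row of the bottom box.
OnFreeRowsAbove : ∀ {m} → Vec Symbol (suc m) → Vec Bool m → Set
OnFreeRowsAbove d v = ∀ p → entry d (suc p) ≢ empty → at v p ≡ true

columnOk-sound : ∀ {m} (d : Vec Symbol (suc m)) v → columnOk d v ≡ true →
  entry d 0 ≢ empty × EmptyFurtherUp d × OnFreeRowsAbove d v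
columnOk-sound (alpha ∷ d) v ok = (λ ()) ,
  (λ { zero (suc q) _ _ → noneOk-sound d ok q ; (suc p) (suc q) _ _ → noneOk-sound d ok q }) ,
  λ p h → ⊥-elim (h (noneOk-sound d ok p))
columnOk-sound (beta ∷ d) v ok with upOk-sound d v ok
... | up , on = (λ ()) , (λ { (suc p) (suc q) (ℕ.s≤s lt) eq → up p q lt eq }) , on

columnOk-complete : ∀ {m} (d : Vec Symbol (suc m)) v →
  entry d 0 ≢ empty → EmptyFurtherUp d → OnFreeRowsAbove d v → columnOk d v ≡ true
columnOk-complete (empty ∷ d) v ne up on = ⊥-elim (ne refl)
columnOk-complete (alpha ∷ d) v ne up on = noneOk-complete d (λ q → up 0 (suc q) (ℕ.s≤s ℕ.z≤n) refl)
columnOk-complete (beta ∷ d)  v ne up on =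
  upOk-complete d v (λ p q lt → up (suc p) (suc q) (ℕ.s≤s lt)) on

entry-< : ∀ {m} (r : Vec Symbol m) j → entry r j ≢ empty → j ℕ.< m
entry-< r j h = ℕ.≰⇒> (λ m≤j → h (entry-≥ r j m≤j))

inside : ∀ {n} (T : Filling n) i j → T [ i , j ] ≢ empty → i ℕ.+ j ℕ.< n
inside []      i       j h = ⊥-elim (h refl)
inside (r ∷ T) zero    j h = entry-< r j h
inside (r ∷ T) (suc i) j h = ℕ.s≤s (inside T i j h)

-- The conditions for all natural numbers: outside the shape the content is empty.
EmptyAboveα′ EmptyLeftOfβ′ FullDiagonal′ IsTableau′ : ∀ {n} → Filling n → Set
EmptyAboveα′ T = ∀ i j k → T [ i , j ] ≡ alpha → k ℕ.< i → T [ k , j ] ≡ empty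
EmptyLeftOfβ′ T = ∀ i j k → T [ i , j ] ≡ beta → k ℕ.< j → T [ i , k ] ≡ empty
FullDiagonal′ {n} T = ∀ i j → suc (i ℕ.+ j) ≡ n → T [ i , j ] ≢ empty
IsTableau′ T = EmptyAboveα′ T × EmptyLeftOfβ′ T × FullDiagonal′ T

module _ {n} (P : ℕ → Set) (h : ∀ (i : Fin n) → P (toℕ i)) where
  all-below : ∀ i → i ℕ.< n → P i
  all-below i i<n = subst P (toℕ-fromℕ< i<n) (h (fromℕ< i<n))

symbol≢empty : ∀ {s t} → t ≢ empty → s ≡ t → s ≢ empty
symbol≢empty h refl = h

isTableau⇒′ : ∀ {n} (T : Filling n) → IsTableau T → IsTableau′ T
isTableau⇒′ {n} T (above , left , full) = above′ , left′ , full′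
  where
  above′ : EmptyAboveα′ T
  above′ i j k eq k<i = all-below (λ k → k ℕ.< i → T [ k , j ] ≡ empty)
    (all-below (λ j → T [ i , j ] ≡ alpha → ∀ (k : Fin n) → toℕ k ℕ.< i → T [ toℕ k , j ] ≡ empty)
      (all-below (λ i → ∀ (j : Fin n) → T [ i , toℕ j ] ≡ alpha → ∀ (k : Fin n) → toℕ k ℕ.< i →
        T [ toℕ k , toℕ j ] ≡ empty)
        above i i<n)
      j (ℕ.≤-<-trans (ℕ.m≤n+m j i) ij<n) eq)
    k (ℕ.<-trans k<i i<n) k<i
    where
    ij<n : i ℕ.+ j ℕ.< n
    ij<n = inside T i j (symbol≢empty (λ ()) eq)
    i<n : i ℕ.< n
    i<n = ℕ.≤-<-trans (ℕ.m≤m+n i j) ij<n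
  left′ : EmptyLeftOfβ′ T
  left′ i j k eq k<j = all-below (λ k → k ℕ.< j → T [ i , k ] ≡ empty)
    (all-below (λ j → T [ i , j ] ≡ beta → ∀ (k : Fin n) → toℕ k ℕ.< j → T [ i , toℕ k ] ≡ empty)
      (all-below (λ i → ∀ (j : Fin n) → T [ i , toℕ j ] ≡ beta → ∀ (k : Fin n) → toℕ k ℕ.< toℕ j →
        T [ i , toℕ k ] ≡ empty)
        left i (ℕ.≤-<-trans (ℕ.m≤m+n i j) ij<n))
      j j<n eq)
    k (ℕ.<-trans k<j j<n) k<j
    where
    ij<n : i ℕ.+ j ℕ.< n
    ij<n = inside T i j (symbol≢empty (λ ()) eq)
    j<n : j ℕ.< n
    j<n = ℕ.≤-<-trans (ℕ.m≤n+m j i) ij<n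
  full′ : FullDiagonal′ T
  full′ i j eq = all-below (λ j → suc (i ℕ.+ j) ≡ n → T [ i , j ] ≢ empty)
    (all-below (λ i → ∀ (j : Fin n) → suc (i ℕ.+ toℕ j) ≡ n → T [ i , toℕ j ] ≢ empty)
      full i (subst (i ℕ.<_) eq (ℕ.s≤s (ℕ.m≤m+n i j))))
    j (subst (j ℕ.<_) eq (ℕ.s≤s (ℕ.m≤n+m j i))) eq

isTableau⇐′ : ∀ {n} (T : Filling n) → IsTableau′ T → IsTableau T
isTableau⇐′ T (above , left , full) =
  (λ i j eq k → above (toℕ i) (toℕ j) (toℕ k) eq) ,
  (λ i j eq k → left (toℕ i) (toℕ j) (toℕ k) eq) ,
  (λ i j → full (toℕ i) (toℕ j))

NoβInRow : ∀ {n} → Filling n → ℕ → Set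
NoβInRow T i = ∀ j → T [ i , j ] ≢ beta

-- Ties the vector computed along a board to the β's of its filling. `at` counts rows from the
-- bottom and the filling from the top, hence `i + suc p ≡ n`.
record Frees {n} (v : Vec Bool n) (T : Filling n) : Set where
  field
    sound    : ∀ i p → i ℕ.+ suc p ≡ n → at v p ≡ true → NoβInRow T i
    complete : ∀ i p → i ℕ.+ suc p ≡ n → NoβInRow T i → at v p ≡ true

outside-β : ∀ {n} (T : Filling n) j → T [ n , j ] ≢ beta
outside-β {n} T j eq = ℕ.<-irrefl refl
  (ℕ.≤-<-trans (ℕ.m≤m+n n j) (inside T n j (symbol≢empty (λ ()) eq)))

keep-true : ∀ s b → keep s b ≡ true → b ≡ true × s ≢ beta
keep-true empty b h = h , λ ()
keep-true alpha b h = h , λ ()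

keep-true⁻¹ : ∀ s b → b ≡ true → s ≢ beta → keep s b ≡ true
keep-true⁻¹ empty b h ne = h
keep-true⁻¹ alpha b h ne = h
keep-true⁻¹ beta  b h ne = ⊥-elim (ne refl)

at-update↑ : ∀ {m} (d : Vec Symbol m) v p → p ℕ.< m → at (update↑ d v) p ≡ keep (entry d p) (at v p)
at-update↑ (s ∷ d) (b ∷ v) zero    h         = refl
at-update↑ (s ∷ d) (b ∷ v) (suc p) (ℕ.s≤s h) = at-update↑ d v p h

module _ {n} (d : Vec Symbol (suc n)) (T : Filling n) where

  column : ∀ i p → i ℕ.+ p ≡ n → addColumn (reverse d) T [ i , 0 ] ≡ entry d p
  column i p eq = trans (addColumn-zero (reverse d) T i) (entry-reverse d i p eq)

  module _ {v : Vec Bool n} (fr : Frees v T) where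

    frees-addColumn : Frees (update d v) (addColumn (reverse d) T)
    frees-addColumn = record { sound = sound′ d refl ; complete = complete′ d refl }
      where
      -- `d` is a module parameter; a copy `d′` together with an equation makes it possible to match
      -- on it.
      sound′ : ∀ d′ → d′ ≡ d → ∀ i p → i ℕ.+ suc p ≡ suc n → at (update d′ v) p ≡ true →
        NoβInRow (addColumn (reverse d) T) i
      sound′ (s ∷ d′) refl i zero    eq h zero    e with keep-true s true h
      ... | _ , s≢β = s≢β (trans (sym (column i 0 (ℕ.suc-injective (trans (sym (ℕ.+-suc i 0)) eq))))
        e)
      sound′ (s ∷ d′) refl i zero    eq h (suc j) e = outside-β T j
        (trans (cong (λ i → T [ i , j ])
          (sym (trans (sym (ℕ.+-identityʳ i)) (ℕ.suc-injective (trans (sym (ℕ.+-suc i 0)) eq)))))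
          (trans (sym (addColumn-suc (reverse d) T i j)) e))
      sound′ (s ∷ d′) refl i (suc p) eq h j e
        with keep-true (entry d′ p) (at v p) (trans (sym (at-update↑ d′ v p p<n)) h)
        where
        p<n : p ℕ.< n
        p<n = subst (p ℕ.<_) (ℕ.suc-injective (trans (sym (ℕ.+-suc i (suc p))) eq))
          (ℕ.m≤n+m (suc p) i)
      sound′ (s ∷ d′) refl i (suc p) eq h zero    e | _ , s≢β =
        s≢β (trans (sym (column i (suc p) (ℕ.suc-injective (trans (sym (ℕ.+-suc i (suc p))) eq))))
          e)
      sound′ (s ∷ d′) refl i (suc p) eq h (suc j) e | at≡true , _ =
        Frees.sound fr i p (ℕ.suc-injective (trans (sym (ℕ.+-suc i (suc p))) eq)) at≡true j
          (trans (sym (addColumn-suc (reverse d) T i j)) e)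
      complete′ : ∀ d′ → d′ ≡ d → ∀ i p → i ℕ.+ suc p ≡ suc n →
        NoβInRow (addColumn (reverse d) T) i → at (update d′ v) p ≡ true
      complete′ (s ∷ d′) refl i zero    eq noβ = keep-true⁻¹ s true refl
        (λ s≡β → noβ 0 (trans (column i 0 (ℕ.suc-injective (trans (sym (ℕ.+-suc i 0)) eq))) s≡β))
      complete′ (s ∷ d′) refl i (suc p) eq noβ = trans (at-update↑ d′ v p p<n)
        (keep-true⁻¹ (entry d′ p) (at v p)
          (Frees.complete fr i p i+sp≡n
            (λ j e → noβ (suc j) (trans (addColumn-suc (reverse d) T i j) e)))
          (λ e → noβ 0 (trans (column i (suc p) i+sp≡n) e)))
        where
        i+sp≡n : i ℕ.+ suc p ≡ n
        i+sp≡n = ℕ.suc-injective (trans (sym (ℕ.+-suc i (suc p))) eq)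
        p<n : p ℕ.< n
        p<n = subst (p ℕ.<_) i+sp≡n (ℕ.m≤n+m (suc p) i)

    addColumn-tableau : IsTableau′ (addColumn (reverse d) T) → columnOk d v ≡ true × IsTableau′ T
    addColumn-tableau (above , left , full) = columnOk-complete d v bottom up on ,
      (λ i j k eq lt → trans (sym (addColumn-suc (reverse d) T k j))
        (above i (suc j) k (trans (addColumn-suc (reverse d) T i j) eq) lt)) ,
      (λ i j k eq lt → trans (sym (addColumn-suc (reverse d) T i k))
        (left i (suc j) (suc k) (trans (addColumn-suc (reverse d) T i j) eq) (ℕ.s≤s lt))) ,
      (λ i j eq e → full i (suc j) (cong suc (trans (ℕ.+-suc i j) eq))
        (trans (addColumn-suc (reverse d) T i j) e))
      where
      bottom : entry d 0 ≢ empty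
      bottom e = full n 0 (cong suc (ℕ.+-identityʳ n)) (trans (column n 0 (ℕ.+-identityʳ n)) e)
      up : EmptyFurtherUp d
      up p q p<q e with q ℕ.≤? n
      ... | no q≰n = entry-≥ d q (ℕ.≰⇒> q≰n)
      ... | yes q≤n = trans (sym (column (n ℕ.∸ q) q (ℕ.m∸n+n≡m q≤n)))
        (above (n ℕ.∸ p) 0 (n ℕ.∸ q)
          (trans (column (n ℕ.∸ p) p (ℕ.m∸n+n≡m (ℕ.≤-trans (ℕ.<⇒≤ p<q) q≤n))) e)
          (ℕ.∸-monoʳ-< p<q q≤n))
      on : OnFreeRowsAbove d v
      on p h = Frees.complete fr (n ℕ.∸ suc p) p (ℕ.m∸n+n≡m sp≤n) (λ j e →
        h (trans (sym (column (n ℕ.∸ suc p) (suc p) (ℕ.m∸n+n≡m sp≤n)))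
          (left (n ℕ.∸ suc p) (suc j) 0 (trans (addColumn-suc (reverse d) T (n ℕ.∸ suc p) j) e)
            (ℕ.s≤s ℕ.z≤n))))
        where
        sp≤n : suc p ℕ.≤ n
        sp≤n = ℕ.≤-pred (entry-< d (suc p) h)

    tableau-addColumn : columnOk d v ≡ true → IsTableau′ T → IsTableau′ (addColumn (reverse d) T)
    tableau-addColumn ok (above , left , full) with columnOk-sound d v ok
    ... | bottom , up , on = above′ , left′ , full′
      where
      above′ : EmptyAboveα′ (addColumn (reverse d) T)
      above′ i zero k eq k<i = trans (column k (n ℕ.∸ k) (ℕ.m+[n∸m]≡n (ℕ.≤-trans (ℕ.<⇒≤ k<i) i≤n)))
        (up (n ℕ.∸ i) (n ℕ.∸ k) (ℕ.∸-monoʳ-< k<i i≤n)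
          (trans (sym (column i (n ℕ.∸ i) (ℕ.m+[n∸m]≡n i≤n))) eq))
        where
        i≤n : i ℕ.≤ n
        i≤n = ℕ.≤-pred (subst (ℕ._< suc n) (ℕ.+-identityʳ i)
          (inside (addColumn (reverse d) T) i 0 (symbol≢empty (λ ()) eq)))
      above′ i (suc j) k eq k<i = trans (addColumn-suc (reverse d) T k j)
        (above i j k (trans (sym (addColumn-suc (reverse d) T i j)) eq) k<i)
      left′ : EmptyLeftOfβ′ (addColumn (reverse d) T)
      left′ i (suc j) zero    eq lt = trans (column i (suc p) i+sp≡n) (go (entry d (suc p) ≟ empty))
        where
        eq′ : T [ i , j ] ≡ beta
        eq′ = trans (sym (addColumn-suc (reverse d) T i j)) eq
        i<n : i ℕ.< n
        i<n = ℕ.≤-<-trans (ℕ.m≤m+n i j) (inside T i j (symbol≢empty (λ ()) eq′))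
        p : ℕ
        p = n ℕ.∸ suc i
        i+sp≡n : i ℕ.+ suc p ≡ n
        i+sp≡n = trans (ℕ.+-suc i p) (ℕ.m+[n∸m]≡n i<n)
        go : Dec (entry d (suc p) ≡ empty) → entry d (suc p) ≡ empty
        go (yes e) = e
        go (no ne) = ⊥-elim (Frees.sound fr i p i+sp≡n (on p ne) j eq′)
      left′ i (suc j) (suc k) eq (ℕ.s≤s lt) = trans (addColumn-suc (reverse d) T i k)
        (left i j k (trans (sym (addColumn-suc (reverse d) T i j)) eq) lt)
      full′ : FullDiagonal′ (addColumn (reverse d) T)
      full′ i zero    eq e = bottom (trans (sym (column i 0 (ℕ.suc-injective eq))) e)
      full′ i (suc j) eq e = full i j (trans (sym (ℕ.+-suc i j)) (ℕ.suc-injective eq))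
        (trans (sym (addColumn-suc (reverse d) T i j)) e)

frees : ∀ {n} (S : Board n) → Frees (free S) (toFilling S)
frees []      = record
  { sound = λ i p eq → ⊥-elim (ℕ.m+1+n≢0 i eq) ; complete = λ i p eq → ⊥-elim (ℕ.m+1+n≢0 i eq) }
frees (d ◂ S) = frees-addColumn d (toFilling S) (frees S)

does-≡ : ∀ {P : Set} (P? : Dec P) b → (P → b ≡ true) → (b ≡ true → P) → does P? ≡ b
does-≡ (yes p) b     f g = sym (f p)
does-≡ (no ¬p) true  f g = ⊥-elim (¬p (g refl))
does-≡ (no ¬p) false f g = refl

does-true : ∀ {P : Set} (P? : Dec P) → P → does P? ≡ true
does-true (yes _) p = refl
does-true (no ¬p) p = ⊥-elim (¬p p)

does-true⁻¹ : ∀ {P : Set} (P? : Dec P) → does P? ≡ true → P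
does-true⁻¹ (yes p) _ = p

-- Validity splits into a test of the new column and validity of the rest, in step with the product
-- that defines `weight`.
does-isTableau? : ∀ {n} (d : Vec Symbol (suc n)) (S : Board n) →
  does (isTableau? (toFilling (d ◂ S))) ≡ columnOk d (free S) ∧ does (isTableau? (toFilling S))
does-isTableau? d S = does-≡ (isTableau? (toFilling (d ◂ S))) _ to from
  where
  U = toFilling S
  to : IsTableau (toFilling (d ◂ S)) → columnOk d (free S) ∧ does (isTableau? U) ≡ true
  to t with addColumn-tableau d U (frees S) (isTableau⇒′ (toFilling (d ◂ S)) t)
  ... | ok , t′ = cong₂ _∧_ ok (does-true (isTableau? U) (isTableau⇐′ U t′))
  from : columnOk d (free S) ∧ does (isTableau? U) ≡ true → IsTableau (toFilling (d ◂ S))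
  from h with ∧-true {columnOk d (free S)} h
  ... | ok , t = isTableau⇐′ (toFilling (d ◂ S)) (tableau-addColumn d U (frees S) ok
    (isTableau⇒′ U (does-true⁻¹ (isTableau? U) t)))

-- Sums over tableaux as sums over boards

module TableauSums (α β : ℚ) where
  open Transfer α β
  open Moments α β

  columnMonomial : ∀ {m} → Vec Symbol m → ℚ
  columnMonomial d = pow α (Vec.count (alpha ≟_) d) * pow β (Vec.count (beta ≟_) d)

  wtℚ : ∀ {n} → Filling n → ℚ
  wtℚ T = pow α (number alpha T) * pow β (number beta T)

  noneWeight-≡ : ∀ {m} (d : Vec Symbol m) → noneWeight d ≡ indicator (noneOk d) * columnMonomial d
  noneWeight-≡ []          = refl
  noneWeight-≡ (empty ∷ d) = noneWeight-≡ d
  noneWeight-≡ (alpha ∷ d) = sym (ℚ.*-zeroˡ (columnMonomial (alpha ∷ d)))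
  noneWeight-≡ (beta ∷ d)  = sym (ℚ.*-zeroˡ (columnMonomial (beta ∷ d)))

  lemα : ∀ i j a p q → i * (a * (j * (p * q))) ≡ i * j * (a * p * q)
  lemα = solve-∀ ring

  lemβ : ∀ i j b p q → i * (b * (j * (p * q))) ≡ i * j * (p * (b * q))
  lemβ = solve-∀ ring

  upWeight-≡ : ∀ {m} (d : Vec Symbol m) v → upWeight d v ≡ indicator (upOk d v) * columnMonomial d
  upWeight-≡ []          []      = refl
  upWeight-≡ (empty ∷ d) (b ∷ v) = upWeight-≡ d v
  upWeight-≡ (alpha ∷ d) (b ∷ v) = trans (cong (λ w → indicator b * (α * w)) (noneWeight-≡ d))
    (trans (lemα (indicator b) (indicator (noneOk d)) α (pow α (Vec.count (alpha ≟_) d))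
      (pow β (Vec.count (beta ≟_) d)))
      (cong (_* columnMonomial (alpha ∷ d)) (sym (indicator-∧ b (noneOk d)))))
  upWeight-≡ (beta ∷ d)  (b ∷ v) = trans (cong (λ w → indicator b * (β * w)) (upWeight-≡ d v))
    (trans (lemβ (indicator b) (indicator (upOk d v)) β (pow α (Vec.count (alpha ≟_) d))
      (pow β (Vec.count (beta ≟_) d)))
      (cong (_* columnMonomial (beta ∷ d)) (sym (indicator-∧ b (upOk d v)))))

  columnWeight-≡ : ∀ {m} (d : Vec Symbol (suc m)) v → columnWeight d v ≡
    indicator (columnOk d v) * columnMonomial d
  columnWeight-≡ (empty ∷ d) v = sym (ℚ.*-zeroˡ (columnMonomial (empty ∷ d)))
  columnWeight-≡ (alpha ∷ d) v = trans (cong (α *_) (noneWeight-≡ d))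
    (lem (indicator (noneOk d)) α (pow α (Vec.count (alpha ≟_) d)) (pow β (Vec.count (beta ≟_) d)))
    where
    lem : ∀ j a p q → a * (j * (p * q)) ≡ j * (a * p * q)
    lem = solve-∀ ring
  columnWeight-≡ (beta ∷ d)  v = trans (cong (β *_) (upWeight-≡ d v))
    (lem (indicator (upOk d v)) β (pow α (Vec.count (alpha ≟_) d)) (pow β (Vec.count (beta ≟_) d)))
    where
    lem : ∀ j b p q → b * (j * (p * q)) ≡ j * (p * (b * q))
    lem = solve-∀ ring

  wtℚ-addColumn : ∀ {n} (d : Vec Symbol (suc n)) (T : Filling n) →
    wtℚ (addColumn (reverse d) T) ≡ columnMonomial d * wtℚ T
  wtℚ-addColumn d T = trans
    (cong₂ (λ p q → pow α p * pow β q) (eq alpha) (eq beta))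
    (trans (cong₂ _*_ (pow-+ α (Vec.count (alpha ≟_) d) (number alpha T))
      (pow-+ β (Vec.count (beta ≟_) d) (number beta T)))
      (lem (pow α (Vec.count (alpha ≟_) d)) (pow α (number alpha T)) (pow β (Vec.count (beta ≟_) d))
        (pow β (number beta T))))
    where
    eq : ∀ s → number s (addColumn (reverse d) T) ≡ Vec.count (s ≟_) d ℕ.+ number s T
    eq s = trans (number-addColumn s (reverse d) T) (cong (ℕ._+ number s T) (count-reverse s d))
    lem : ∀ a b c d → a * b * (c * d) ≡ a * c * (b * d)
    lem = solve-∀ ring

  weight-≡ : ∀ {n} (S : Board n) →
    weight S ≡ indicator (does (isTableau? (toFilling S))) * wtℚ (toFilling S)
  weight-≡ []      = refl
  weight-≡ (d ◂ S) = trans (cong₂ _*_ (columnWeight-≡ d (free S)) (weight-≡ S))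
    (trans (lem (indicator (columnOk d (free S))) (columnMonomial d) _ (wtℚ (toFilling S)))
      (cong₂ _*_
        (trans (sym (indicator-∧ (columnOk d (free S)) _))
          (cong indicator (sym (does-isTableau? d S))))
        (sym (wtℚ-addColumn d (toFilling S)))))
    where
    lem : ∀ i p j q → i * p * (j * q) ≡ i * j * (p * q)
    lem = solve-∀ ring

  -- `x = 1` switches off the count of free rows, which serves only the recursion; in the scaled
  -- variable this is `y = b`.
  ∑-tableaux : ∀ n c → ∑ℚ (tableaux n) (λ T → wtℚ T * c (A⁽³⁾ T)) ≡ G n c 1ℚ
  ∑-tableaux n c = trans (∑-filter isTableau? (fillings n) (λ T → wtℚ T * c (A⁽³⁾ T)))
    (trans (sym (∑-↭ h (boards-↭ n)))
      (trans (∑-map toFilling (boards n) h)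
        (∑-cong (boards n) (λ S → trans
          (sym (ℚ.*-assoc (indicator (does (isTableau? (toFilling S)))) (wtℚ (toFilling S))
            (c (A⁽³⁾ (toFilling S)))))
          (cong₂ _*_ (sym (weight-≡ S))
            (trans (cong c (marks-toFilling S))
              (trans (sym (ℚ.*-identityˡ (c (marks S))))
                (cong (_* c (marks S)) (sym (monomial-1 (free S)))))))))))
    where
    h : Filling n → ℚ
    h T = indicator (does (isTableau? T)) * (wtℚ T * c (A⁽³⁾ T))

-- Finite differences and Newton interpolation

∑-applyUpTo : ∀ {A : Set} (h : ℕ → A) n (f : A → ℚ) → ∑ℚ (List.applyUpTo h n) f ≡
  ∑ℚ (upTo n) (λ k → f (h k))
∑-applyUpTo h n f = trans (cong (λ xs → ∑ℚ xs f) (sym (List.map-applyUpTo (λ k → k) h n)))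
  (∑-map h (upTo n) f)

∑-upTo-suc : ∀ n (f : ℕ → ℚ) → ∑ℚ (upTo (suc n)) f ≡ f 0 + ∑ℚ (upTo n) (λ k → f (suc k))
∑-upTo-suc n f = cong (f 0 +_) (∑-applyUpTo suc n f)

∑-upTo-last : ∀ n (f : ℕ → ℚ) → ∑ℚ (upTo (suc n)) f ≡ ∑ℚ (upTo n) f + f n
∑-upTo-last zero    f = ℚ.+-comm (f 0) 0ℚ
∑-upTo-last (suc n) f = trans (∑-upTo-suc (suc n) f)
  (trans (cong (f 0 +_) (∑-upTo-last n (λ k → f (suc k))))
    (trans (sym (ℚ.+-assoc (f 0) (∑ℚ (upTo n) (λ k → f (suc k))) (f (suc n))))
      (cong (_+ f (suc n)) (sym (∑-upTo-suc n f)))))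

∑-upTo-cong : ∀ n {f g : ℕ → ℚ} → (∀ k → k ℕ.< n → f k ≡ g k) → ∑ℚ (upTo n) f ≡ ∑ℚ (upTo n) g
∑-upTo-cong zero            h = refl
∑-upTo-cong (suc n) {f} {g} h = trans (∑-upTo-last n f)
  (trans (cong₂ _+_ (∑-upTo-cong n (λ k k<n → h k (ℕ.m<n⇒m<1+n k<n))) (h n ℕ.≤-refl))
    (sym (∑-upTo-last n g)))

∑-upTo-truncate : ∀ {U} d {f : ℕ → ℚ} → (∀ k → U ℕ.≤ k → f k ≡ 0ℚ) → ∑ℚ (upTo (d ℕ.+ U)) f ≡
  ∑ℚ (upTo U) f
∑-upTo-truncate     zero    h = refl
∑-upTo-truncate {U} (suc d) {f} h = trans (∑-upTo-last (d ℕ.+ U) f)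
  (trans (cong₂ _+_ (∑-upTo-truncate d h) (h (d ℕ.+ U) (ℕ.m≤n+m U d))) (ℚ.+-identityʳ _))

∑-upTo-≤ : ∀ n (f : ℕ → ℚ) {η} → (∀ k → f k ≤ η) → ∑ℚ (upTo n) f ≤ ι n * η
∑-upTo-≤ zero    f {η} h = ℚ.≤-reflexive (sym (ℚ.*-zeroˡ η))
∑-upTo-≤ (suc n) f {η} h = subst₂ _≤_ (sym (∑-upTo-last n f))
  (trans (lem (ι n) η) (cong (_* η) (sym (ι-suc n))))
  (ℚ.+-mono-≤ (∑-upTo-≤ n f h) (h n))
  where
  lem : ∀ i η → i * η + η ≡ (1ℚ + i) * η
  lem = solve-∀ ring

differences : ℕ → (ℕ → ℚ) → ℕ → ℚ
differences zero    g = g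
differences (suc r) g = differences r (difference g)

newton : ℕ → (ℕ → ℚ) → ℕ → ℚ
newton R g a = ∑ℚ (upTo R) (λ r → differences r g 0 * binomial r a)

newton-0 : ∀ R g → newton (suc R) g 0 ≡ g 0
newton-0 R g = trans (∑-upTo-suc R (λ r → differences r g 0 * binomial r 0))
  (trans (cong (g 0 * 1ℚ +_) (∑-zero (upTo R) _ (λ r → ℚ.*-zeroʳ (differences r (difference g) 0))))
    (lem (g 0)))
  where
  lem : ∀ p → p * 1ℚ + 0ℚ ≡ p
  lem = solve-∀ ring

newton-suc : ∀ R g a → newton (suc R) g (suc a) ≡ newton (suc R) g a + newton R (difference g) a
newton-suc R g a = trans (∑-upTo-suc R (λ r → differences r g 0 * binomial r (suc a)))
  (trans (cong (g 0 * 1ℚ +_) (trans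
      (∑-cong (upTo R) (λ r → ℚ.*-distribˡ-+ (D r) (binomial (suc r) a) (binomial r a)))
      (∑-+ (upTo R) (λ r → D r * binomial (suc r) a) (λ r → D r * binomial r a))))
    (trans (sym (ℚ.+-assoc (g 0 * 1ℚ) (∑ℚ (upTo R) (λ r → D r * binomial (suc r) a))
      (newton R (difference g) a)))
      (cong (_+ newton R (difference g) a)
        (sym (∑-upTo-suc R (λ r → differences r g 0 * binomial r a))))))
  where
  D : ℕ → ℚ
  D r = differences r (difference g) 0

-- Both sides satisfy Pascal's rule.
newton-remainder : ∀ R g {M} → 0ℚ ≤ M → (∀ j → ∣ differences R g j ∣ ≤ M) →
  ∀ a → ∣ g a - newton R g a ∣ ≤ M * binomial R a
newton-remainder zero    g {M} 0≤M h a = subst₂ _≤_ (cong ∣_∣ (lem (g a))) (sym (ℚ.*-identityʳ M))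
  (h a)
  where
  lem : ∀ p → p ≡ p - 0ℚ
  lem = solve-∀ ring
newton-remainder (suc R) g {M} 0≤M h zero = ℚ.≤-reflexive (trans
  (cong ∣_∣ (trans (cong (λ z → g 0 - z) (newton-0 R g)) (ℚ.+-inverseʳ (g 0)))) (sym (ℚ.*-zeroʳ M)))
newton-remainder (suc R) g {M} 0≤M h (suc a) = subst₂ _≤_
  (cong ∣_∣ (trans (lem (g a) (g (suc a)) (newton (suc R) g a) (newton R (difference g) a))
    (cong (λ z → g (suc a) - z) (sym (newton-suc R g a)))))
  (sym (ℚ.*-distribˡ-+ M (binomial (suc R) a) (binomial R a)))
  (ℚ.≤-trans (ℚ.∣p+q∣≤∣p∣+∣q∣ (g a - newton (suc R) g a)
    (difference g a - newton R (difference g) a))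
    (ℚ.+-mono-≤ (newton-remainder (suc R) g 0≤M h a) (newton-remainder R (difference g) 0≤M h a)))
  where
  lem : ∀ p q x y → p - x + (q - p - y) ≡ q - (x + y)
  lem = solve-∀ ring

-- Taking a difference at most doubles a bound.
differences-bound : ∀ R g {M} → (∀ j → ∣ g j ∣ ≤ M) → ∀ j → ∣ differences R g j ∣ ≤
  pow (1ℚ + 1ℚ) R * M
differences-bound zero    g {M} h j = subst (∣ g j ∣ ≤_) (sym (ℚ.*-identityˡ M)) (h j)
differences-bound (suc R) g {M} h j = subst (∣ differences R (difference g) j ∣ ≤_)
  (lem (pow (1ℚ + 1ℚ) R) M)
  (differences-bound R (difference g)
    (λ j → ℚ.≤-trans (ℚ.∣p-q∣≤∣p∣+∣q∣ (g (suc j)) (g j)) (ℚ.+-mono-≤ (h (suc j)) (h j))) j)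
  where
  lem : ∀ p M → p * (M + M) ≡ (1ℚ + 1ℚ) * p * M
  lem = solve-∀ ring

differences-difference : ∀ r g j → differences r (difference g) j ≡
  differences r g (suc j) - differences r g j
differences-difference zero    g j = refl
differences-difference (suc r) g j = differences-difference r (difference g) j

differences-shift : ∀ r g j → differences r (λ k → g (suc k)) j ≡ differences r g (suc j)
differences-shift zero    g j = refl
differences-shift (suc r) g j = trans (differences-difference r (λ k → g (suc k)) j)
  (trans (cong₂ _-_ (differences-shift r g (suc j)) (differences-shift r g j))
    (sym (differences-difference r g (suc j))))

-- Newton coefficients against Poisson moments

-- Multiplication of exponential generating functions in q: the coefficients
-- Δʳ g(0) arise from those of g by multiplication with exp(- q).
module Convolution (q : ℚ) where

  suc*expTerm : ∀ p k → ι (suc k) * expTerm p (suc k) ≡ p * expTerm p k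
  suc*expTerm p k = absorb (ι (suc k)) (expTerm p k) p (recip k) (ι-recip k)

  -- The recursion shifts `F` and so avoids truncated subtraction in the induction; `convolution-∑`
  -- shows the Cauchy product.
  convolution : (ℕ → ℚ) → (ℕ → ℚ) → ℕ → ℚ
  convolution g F zero    = g 0 * expTerm q 0 * F 0
  convolution g F (suc r) = convolution g (F ∘ suc) r + g (suc r) * expTerm q (suc r) * F 0

  -- The product rule for formal derivatives: the total degree `j + suc r` is split into the degree
  -- of `expTerm q k` and that of `H`. The offset `j` has to vary since `convolution` shifts its
  -- second argument.
  convolution-suc : ∀ g j H r → (∀ i → ι (j ℕ.+ i) * H (suc i) ≡ (- q) * H i) →
    ι (j ℕ.+ suc r) * convolution g (H ∘ suc) (suc r) ≡
    q * (convolution (g ∘ suc) (H ∘ suc) r - convolution g H (suc r))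
  convolution-suc g j H zero h = trans
    (lem₁ (ι (j ℕ.+ 1)) (g 0) (g 1) (expTerm q 1) (H 1) (H 2))
    (trans (cong₂ (λ u v → g 0 * u + g 1 * expTerm q 1 * v) (h 1)
        (trans (cong (_* H 1) (trans (ι-+ j 1) (cong (_+ 1ℚ) (cong ι (sym (ℕ.+-identityʳ j))))))
          (trans (ℚ.*-distribʳ-+ (H 1) (ι (j ℕ.+ 0)) 1ℚ) (cong (_+ 1ℚ * H 1) (h 0)))))
      (trans (lem₂ q (g 0) (g 1) (expTerm q 1) (H 0) (H 1))
        (trans (cong (λ e → (- q) * g 0 * H 1 + g 1 * (e * H 1) - q * (g 1 * expTerm q 1 * H 0))
          (suc*expTerm q 0))
          (lem₃ q (g 0) (g 1) (expTerm q 1) (H 0) (H 1)))))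
    where
    lem₁ : ∀ i g₀ g₁ e h₁ h₂ → i * (g₀ * 1ℚ * h₂ + g₁ * e * h₁) ≡ g₀ * (i * h₂) + g₁ * e * (i * h₁)
    lem₁ = solve-∀ ring
    lem₂ : ∀ q g₀ g₁ e h₀ h₁ → g₀ * ((- q) * h₁) + g₁ * e * ((- q) * h₀ + 1ℚ * h₁) ≡
      (- q) * g₀ * h₁ + g₁ * ((1ℚ * e) * h₁) - q * (g₁ * e * h₀)
    lem₂ = solve-∀ ring
    lem₃ : ∀ q g₀ g₁ e h₀ h₁ → (- q) * g₀ * h₁ + g₁ * ((q * 1ℚ) * h₁) - q * (g₁ * e * h₀) ≡
      q * (g₁ * 1ℚ * h₁ - (g₀ * 1ℚ * h₁ + g₁ * e * h₀))
    lem₃ = solve-∀ ring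
  convolution-suc g j H (suc r) h = trans
    (lem₁ (ι (j ℕ.+ suc (suc r))) C₂ (g (suc (suc r))) e₂ (H 1))
    (trans (cong₂ (λ u v → u + g (suc (suc r)) * e₂ * v)
        (trans (cong (λ n → ι n * C₂) (ℕ.+-suc j (suc r)))
          (convolution-suc g (suc j) (H ∘ suc) r
            (λ i → trans (cong (λ n → ι n * H (suc (suc i))) (sym (ℕ.+-suc j i))) (h (suc i)))))
        (trans (cong (_* H 1)
          (trans (ι-+ j (suc (suc r)))
            (cong (λ n → ι n + ι (suc (suc r))) (sym (ℕ.+-identityʳ j)))))
          (trans (ℚ.*-distribʳ-+ (H 1) (ι (j ℕ.+ 0)) (ι (suc (suc r))))
            (cong (_+ ι (suc (suc r)) * H 1) (h 0)))))
      (trans (lem₂ q (convolution (g ∘ suc) (H ∘ suc ∘ suc) r) (convolution g (H ∘ suc) (suc r))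
          (g (suc (suc r))) e₂ (ι (suc (suc r))) (H 0) (H 1))
        (trans (cong (λ e → q * (convolution (g ∘ suc) (H ∘ suc ∘ suc) r - convolution g (H ∘ suc)
          (suc r)) +
            g (suc (suc r)) * (e * H 1) - q * (g (suc (suc r)) * e₂ * H 0)) (suc*expTerm q (suc r)))
          (lem₃ q (convolution (g ∘ suc) (H ∘ suc ∘ suc) r) (convolution g (H ∘ suc) (suc r))
            (g (suc (suc r))) e₂ (expTerm q (suc r)) (H 0) (H 1)))))
    where
    C₂ e₂ : ℚ
    C₂ = convolution g (H ∘ suc ∘ suc) (suc r)
    e₂ = expTerm q (suc (suc r))
    lem₁ : ∀ i c g e h → i * (c + g * e * h) ≡ i * c + g * e * (i * h)
    lem₁ = solve-∀ ring
    lem₂ : ∀ q c d g e i h₀ h₁ → q * (c - d) + g * e * ((- q) * h₀ + i * h₁) ≡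
      q * (c - d) + g * ((i * e) * h₁) - q * (g * e * h₀)
    lem₂ = solve-∀ ring
    lem₃ : ∀ q c d g e e′ h₀ h₁ → q * (c - d) + g * ((q * e′) * h₁) - q * (g * e * h₀) ≡
      q * (c + g * e′ * h₁ - (d + g * e * h₀))
    lem₃ = solve-∀ ring

  -- The series of exp(- q) moved by one place, with 0 as its term of degree -1, which starts the
  -- product rule at `j = 0`.
  expTerm⁻ : ℕ → ℚ
  expTerm⁻ zero    = 0ℚ
  expTerm⁻ (suc i) = expTerm (- q) i

  -- The next difference of `g` at 0 is that of the shifted function minus that of `g`, which is the
  -- relation that `convolution-suc` gives for the other side.
  differences-convolution : ∀ r g → differences r g 0 * expTerm q r ≡ convolution g (expTerm (- q))
    r
  differences-convolution zero    g = sym (ℚ.*-identityʳ (g 0 * 1ℚ))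
  differences-convolution (suc r) g = trans
    (cong (_* (e * (q * recip r))) (trans (differences-difference r g 0)
      (cong (λ z → z - differences r g 0) (sym (differences-shift r g 0)))))
    (trans (lem₁ (differences r (g ∘ suc) 0) (differences r g 0) e q (recip r))
      (trans (cong₂ (λ u v → recip r * (q * (u - v))) (differences-convolution r (g ∘ suc))
        (differences-convolution r g))
        (trans (cong (λ c → recip r * (q * (convolution (g ∘ suc) (expTerm (- q)) r - c)))
            (lem₂ (convolution g (expTerm (- q)) r) (g (suc r) * expTerm q (suc r))))
          (trans (cong (recip r *_) (sym (convolution-suc g 0 expTerm⁻ r hyp)))
            (trans (lem₃ (recip r) (ι (suc r)) C)
              (trans (cong (_* C) (ι-recip r)) (ℚ.*-identityˡ C)))))))
    where
    e C : ℚ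
    e = expTerm q r
    C = convolution g (expTerm (- q)) (suc r)
    hyp : ∀ i → ι (0 ℕ.+ i) * expTerm⁻ (suc i) ≡ (- q) * expTerm⁻ i
    hyp zero    = trans (ℚ.*-zeroˡ (expTerm (- q) 0)) (sym (ℚ.*-zeroʳ (- q)))
    hyp (suc i) = suc*expTerm (- q) i
    lem₁ : ∀ d d′ e q s → (d - d′) * (e * (q * s)) ≡ s * (q * (d * e - d′ * e))
    lem₁ = solve-∀ ring
    lem₂ : ∀ c w → c ≡ c + w * 0ℚ
    lem₂ = solve-∀ ring
    lem₃ : ∀ s i c → s * (i * c) ≡ i * s * c
    lem₃ = solve-∀ ring

  convolution-+ : ∀ g F F′ r → convolution g (λ i → F i + F′ i) r ≡ convolution g F r + convolution
    g F′ r
  convolution-+ g F F′ zero    = ℚ.*-distribˡ-+ (g 0 * 1ℚ) (F 0) (F′ 0)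
  convolution-+ g F F′ (suc r) = trans
    (cong (_+ g (suc r) * expTerm q (suc r) * (F 0 + F′ 0))
      (convolution-+ g (F ∘ suc) (F′ ∘ suc) r))
    (lem (convolution g (F ∘ suc) r) (convolution g (F′ ∘ suc) r) (g (suc r) * expTerm q (suc r))
      (F 0) (F′ 0))
    where
    lem : ∀ c c′ w f f′ → c + c′ + w * (f + f′) ≡ c + w * f + (c′ + w * f′)
    lem = solve-∀ ring

  ∑-convolution : ∀ g R → ∑ℚ (upTo (suc R)) (convolution g (expTerm (- q))) ≡
    convolution g (λ i → expSum (- q) (suc i)) R
  ∑-convolution g zero    = lem (g 0)
    where
    lem : ∀ g → g * 1ℚ * 1ℚ + 0ℚ ≡ g * 1ℚ * (0ℚ + 1ℚ)
    lem = solve-∀ ring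
  ∑-convolution g (suc R) = trans (∑-upTo-last (suc R) (convolution g (expTerm (- q))))
    (trans (cong (_+ convolution g (expTerm (- q)) (suc R)) (∑-convolution g R))
      (trans (lem (convolution g P R) (convolution g (expTerm (- q) ∘ suc) R)
        (g (suc R) * expTerm q (suc R)))
        (cong (_+ g (suc R) * expTerm q (suc R) * (0ℚ + 1ℚ))
          (sym (convolution-+ g P (expTerm (- q) ∘ suc) R)))))
    where
    P : ℕ → ℚ
    P i = expSum (- q) (suc i)
    lem : ∀ p c w → p + (c + w * 1ℚ) ≡ p + c + w * (0ℚ + 1ℚ)
    lem = solve-∀ ring

  convolution-∑ : ∀ g F r → convolution g F r ≡ ∑ℚ (upTo (suc r))
    (λ k → g k * expTerm q k * F (r ℕ.∸ k))
  convolution-∑ g F zero    = sym (ℚ.+-identityʳ _)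
  convolution-∑ g F (suc r) = trans
    (cong₂ _+_ (trans (convolution-∑ g (F ∘ suc) r) (∑-upTo-cong (suc r) (λ k k<1+r →
        cong (λ i → g k * expTerm q k * F i) (sym (ℕ.+-∸-assoc 1 (ℕ.≤-pred k<1+r))))))
      (cong (λ i → g (suc r) * expTerm q (suc r) * F i) (sym (ℕ.n∸n≡0 r))))
    (sym (∑-upTo-last (suc r) (λ k → g k * expTerm q k * F (suc r ℕ.∸ k))))

  -- A Newton sum cut at `R` and fed with the Poisson moments gives Poisson probabilities in which
  -- e^(-q) is replaced by a partial sum, whose length depends on `k`.
  newton-poisson : ∀ g R → ∑ℚ (upTo (suc R)) (λ r → differences r g 0 * expTerm q r) ≡
    ∑ℚ (upTo (suc R)) (λ k → g k * expTerm q k * expSum (- q) (suc (R ℕ.∸ k)))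
  newton-poisson g R = trans (∑-cong (upTo (suc R)) (λ r → differences-convolution r g))
    (trans (∑-convolution g R) (convolution-∑ g (λ i → expSum (- q) (suc i)) R))

-- Means under the law and convergence of factorial moments

-- The law at one rational approximation of the parameters: `a`, `b` and `z` are the reciprocals of
-- `α`, `β` and the partition function. Only `c` is shared by all approximations.
record Weights (c : ℚ) (n : ℕ) : Set where
  field
    α β a b z : ℚ
    0≤α : 0ℚ ≤ α
    0≤β : 0ℚ ≤ β
    0≤a : 0ℚ ≤ a
    0≤b : 0ℚ ≤ b
    0≤z : 0ℚ ≤ z
    a≤c : a ≤ c
    b≤c : b ≤ c
    αa≡1 : α * a ≡ 1ℚ
    βb≡1 : β * b ≡ 1ℚ
  open TableauSums α β public
  field
    Zz≡1 : ∑ℚ (tableaux n) wtℚ * z ≡ 1ℚ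

  mean : (ℕ → ℚ) → ℚ
  mean g = ∑ℚ (tableaux n) (λ T → wtℚ T * z * g (A⁽³⁾ T))

  mean-G : ∀ g → mean g ≡ Moments.G α β n g 1ℚ * z
  mean-G g = trans
    (∑-cong (tableaux n) (λ T → lem (wtℚ T) z (g (A⁽³⁾ T))))
    (trans (∑-*ʳ z (tableaux n) (λ T → wtℚ T * g (A⁽³⁾ T))) (cong (_* z) (∑-tableaux n g)))
    where
    lem : ∀ w z g → w * z * g ≡ w * g * z
    lem = solve-∀ ring

  Gz≡1 : Moments.G α β n (binomial 0) 1ℚ * z ≡ 1ℚ
  Gz≡1 = trans (sym (mean-G (binomial 0)))
    (trans (∑-cong (tableaux n) (λ T → ℚ.*-identityʳ (wtℚ T * z)))
      (trans (∑-*ʳ z (tableaux n) wtℚ) Zz≡1))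

  mean-close : ∀ g h k → (∀ j → ∣ g j - h j ∣ ≤ k j) → ∣ mean g - mean h ∣ ≤ mean k
  mean-close g h k close = subst (λ p → ∣ p ∣ ≤ mean k) eq
    (ℚ.≤-trans (∑-abs (tableaux n) (λ T → wtℚ T * z * (g (A⁽³⁾ T) - h (A⁽³⁾ T))))
      (∑-mono (tableaux n) (λ T → subst (_≤ wtℚ T * z * k (A⁽³⁾ T))
        (sym (trans (ℚ.∣p*q∣≡∣p∣*∣q∣ (wtℚ T * z) (g (A⁽³⁾ T) - h (A⁽³⁾ T)))
          (cong (_* ∣ g (A⁽³⁾ T) - h (A⁽³⁾ T) ∣) (ℚ.0≤p⇒∣p∣≡p (0≤wz T)))))
        (*-monoʳ (wtℚ T * z) (0≤wz T) (close (A⁽³⁾ T))))))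
    where
    0≤wz : ∀ T → 0ℚ ≤ wtℚ T * z
    0≤wz T = 0≤* (wtℚ T) z (0≤* (pow α (number alpha T)) (pow β (number beta T))
      (0≤pow (number alpha T) 0≤α) (0≤pow (number beta T) 0≤β)) 0≤z
    lem₁ : ∀ w g h → w * (g - h) ≡ w * g + (- 1ℚ) * (w * h)
    lem₁ = solve-∀ ring
    lem₂ : ∀ p q → p + (- 1ℚ) * q ≡ p - q
    lem₂ = solve-∀ ring
    eq : ∑ℚ (tableaux n) (λ T → wtℚ T * z * (g (A⁽³⁾ T) - h (A⁽³⁾ T))) ≡ mean g - mean h
    eq = trans (∑-cong (tableaux n) (λ T → lem₁ (wtℚ T * z) (g (A⁽³⁾ T)) (h (A⁽³⁾ T))))
      (trans (∑-+ (tableaux n) (λ T → wtℚ T * z * g (A⁽³⁾ T))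
        (λ T → (- 1ℚ) * (wtℚ T * z * h (A⁽³⁾ T))))
        (trans (cong (mean g +_) (∑-*ˡ (- 1ℚ) (tableaux n) (λ T → wtℚ T * z * h (A⁽³⁾ T))))
          (lem₂ (mean g) (mean h))))

  mean-newton : ∀ R g → mean (newton R g) ≡
    ∑ℚ (upTo R) (λ r → differences r g 0 * mean (binomial r))
  mean-newton R g = trans
    (∑-cong (tableaux n) (λ T → trans
      (sym (∑-*ˡ (wtℚ T * z) (upTo R) (λ r → differences r g 0 * binomial r (A⁽³⁾ T))))
      (∑-cong (upTo R) (λ r → lem (wtℚ T * z) (differences r g 0) (binomial r (A⁽³⁾ T))))))
    (trans (∑-swap (tableaux n) (upTo R)
      (λ T r → differences r g 0 * (wtℚ T * z * binomial r (A⁽³⁾ T))))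
      (∑-cong (upTo R) (λ r → ∑-*ˡ (differences r g 0) (tableaux n)
        (λ T → wtℚ T * z * binomial r (A⁽³⁾ T)))))
    where
    lem : ∀ w d b → w * (d * b) ≡ d * (w * b)
    lem = solve-∀ ring

  mean-scale : ∀ M g → mean (λ a → M * g a) ≡ M * mean g
  mean-scale M g = trans (∑-cong (tableaux n) (λ T → lem (wtℚ T * z) M (g (A⁽³⁾ T))))
    (∑-*ˡ M (tableaux n) (λ T → wtℚ T * z * g (A⁽³⁾ T)))
    where
    lem : ∀ w d b → w * (d * b) ≡ d * (w * b)
    lem = solve-∀ ring

open Weights using (mean; mean-close; mean-newton; mean-scale)


size-split : ∀ r N {n} → size r N ℕ.≤ n → ∃ λ k → N ℕ.≤ k × size r k ≡ n
size-split zero    N h = _ , h , refl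
size-split (suc r) N (ℕ.s≤s (ℕ.s≤s h)) with size-split r N h
... | k , N≤k , eq = k , N≤k , cong (λ n → suc (suc n)) eq

module _ {c : ℚ} (r k : ℕ) (w : Weights c (size r k)) where
  open Weights w hiding (mean)
  open Moments α β
  open Scaled a b αa≡1 βb≡1

  -- Cancels `pow s n` and divides by the partition function at once; it is therefore the reciprocal
  -- of the rising factorial that `MomentLimit` asks for.
  unscale : ℚ
  unscale = z * pow (α * β) (size r k)

  0≤unscale : 0ℚ ≤ unscale
  0≤unscale = 0≤* z _ 0≤z (0≤pow (size r k) (0≤* α β 0≤α 0≤β))

  scaled-G : ∀ c → pow s (size r k) * G (size r k) c (β * b) * unscale ≡ G (size r k) c 1ℚ * z
  scaled-G c = trans (cong (λ x → pow s n * G n c x * unscale) βb≡1)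
    (trans (lem (pow s n) (G n c 1ℚ) z (pow (α * β) n))
      (trans (cong (_* (G n c 1ℚ * z)) sαβ≡1) (ℚ.*-identityˡ _)))
    where
    n : ℕ
    n = size r k
    lem : ∀ p g z q → p * g * (z * q) ≡ p * q * (g * z)
    lem = solve-∀ ring
    lem′ : ∀ a b α β → a * b * (α * β) ≡ α * a * (β * b)
    lem′ = solve-∀ ring
    sαβ≡1 : pow s n * pow (α * β) n ≡ 1ℚ
    sαβ≡1 = trans (sym (pow-* s (α * β) n))
      (trans (cong (λ p → pow p n) (trans (lem′ a b α β) (cong₂ _*_ αa≡1 βb≡1))) (pow-1 n))

  rising-unscale : rising a (size r k) b * unscale ≡ 1ℚ
  rising-unscale = trans
    (cong (_* unscale) (sym (Bounds.γ-zero a 0≤a γ momentRecursion (size r k) b)))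
    (trans (scaled-G (binomial 0)) Gz≡1)

  γ-mean : γ r k b * unscale ≡ mean w (binomial r)
  γ-mean = trans (scaled-G (binomial r)) (sym (mean-G (binomial r)))

moment-close-at : ∀ {r c ε N} → MomentLimit r c ε N → ∀ n → size r N ℕ.≤ n → ∀ (w : Weights c n) →
  ∣ mean w (binomial r) - expTerm ½ r ∣ ≤ ε
moment-close-at {r} {c} {ε} {N} limit n h w with size-split r N h
... | k , N≤k , refl = subst (λ p → ∣ p - expTerm ½ r ∣ ≤ ε) (γ-mean r k w)
  (limit k N≤k 0≤a (Moments.Scaled.momentRecursion α β a b αa≡1 βb≡1) b 0≤b a≤c b≤c
    (unscale r k w) (0≤unscale r k w) (rising-unscale r k w))
  where open Weights w hiding (mean)

moment-close : ∀ r c ε → 0ℚ ≤ c → 0ℚ < ε → ∃ λ N → ∀ n → N ℕ.≤ n → ∀ (w : Weights c n) →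
  ∣ mean w (binomial r) - expTerm ½ r ∣ ≤ ε
moment-close r c ε 0≤c 0<ε = size r (proj₁ limit) , moment-close-at (proj₂ limit)
  where
  limit : ∃ (MomentLimit r c ε)
  limit = moment-limit r c ε 0≤c 0<ε

∣expTerm∣≤1 : ∀ k → ∣ expTerm ½ k ∣ ≤ 1ℚ
∣expTerm∣≤1 k = subst (_≤ 1ℚ) (sym (ℚ.0≤p⇒∣p∣≡p (0≤expTerm 0≤½ k))) (≤1 k)
  where
  0≤½ : 0ℚ ≤ ½
  0≤½ = ℚ.nonNegative⁻¹ ½
  recip≤1 : ∀ k → recip k ≤ 1ℚ
  recip≤1 k = subst₂ _≤_ (ℚ.*-identityˡ (recip k)) (ι-recip k)
    (*-monoˡ (recip k) (ℚ.<⇒≤ (recip-pos k)) (ι-mono {1} {suc k} (ℕ.s≤s ℕ.z≤n)))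
  ≤1 : ∀ k → expTerm ½ k ≤ 1ℚ
  ≤1 zero    = ℚ.≤-refl
  ≤1 (suc k) = *-mono-≤ (expTerm ½ k) 1ℚ (½ * recip k) 1ℚ (0≤expTerm 0≤½ k) 0≤1 (≤1 k)
    (*-mono-≤ ½ 1ℚ (recip k) 1ℚ 0≤½ 0≤1 (≤-by ½ 0≤½ refl) (recip≤1 k))

-- Turns the limiting size of Newton's remainder into a term of the series of e.
expTerm-2^ : ∀ R → pow (1ℚ + 1ℚ) R * expTerm ½ R ≡ expTerm 1ℚ R
expTerm-2^ zero    = refl
expTerm-2^ (suc R) = trans (lem (1ℚ + 1ℚ) (pow (1ℚ + 1ℚ) R) (expTerm ½ R) ½ (recip R))
  (cong (_* (1ℚ * recip R)) (expTerm-2^ R))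
  where
  lem : ∀ t p e h s → t * p * (e * (h * s)) ≡ p * e * (t * h * s)
  lem = solve-∀ ring


abs-triangle : ∀ p q r {ε η} → ∣ p - q ∣ ≤ ε → ∣ q - r ∣ ≤ η → ∣ p - r ∣ ≤ ε + η
abs-triangle p q r {ε} {η} h k = subst (λ s → ∣ s ∣ ≤ ε + η) (lem p q r)
  (ℚ.≤-trans (ℚ.∣p+q∣≤∣p∣+∣q∣ (p - q) (q - r)) (ℚ.+-mono-≤ h k))
  where
  lem : ∀ p q r → p - q + (q - r) ≡ p - r
  lem = solve-∀ ring

-- Dividing by `∣ d ∣ + 1` rather than by `∣ d ∣` covers `d = 0`.
scaled-close : ∀ d p q ε → ∣ p - q ∣ ≤ ε * inv (∣ d ∣ + 1ℚ) → 0ℚ ≤ ε → ∣ d * p - d * q ∣ ≤ ε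
scaled-close d p q ε h 0≤ε = begin
  ∣ d * p - d * q ∣              ≡⟨ cong ∣_∣ (lem₁ d p q) ⟩
  ∣ d * (p - q) ∣                ≡⟨ ℚ.∣p*q∣≡∣p∣*∣q∣ d (p - q) ⟩
  ∣ d ∣ * ∣ p - q ∣              ≤⟨ *-mono-≤ (∣ d ∣) e (∣ p - q ∣) (ε * inv e) (ℚ.0≤∣p∣ d)
                                     (ℚ.≤-trans (ℚ.0≤∣p∣ (p - q)) h) (p≤p+q (∣ d ∣) 1ℚ 0≤1) h ⟩
  e * (ε * inv e)                ≡⟨ lem₂ e ε (inv e) ⟩
  e * inv e * ε                  ≡⟨ cong (_* ε) (inv-right (0≤+pos ∣ d ∣ (ℚ.0≤∣p∣ d))) ⟩
  1ℚ * ε                         ≡⟨ ℚ.*-identityˡ ε ⟩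
  ε                              ∎
  where
  open ℚ.≤-Reasoning
  e : ℚ
  e = ∣ d ∣ + 1ℚ
  lem₁ : ∀ d p q → d * p - d * q ≡ d * (p - q)
  lem₁ = solve-∀ ring
  lem₂ : ∀ e ε i → e * (ε * i) ≡ e * i * ε
  lem₂ = solve-∀ ring


scaled-moment-close : ∀ d r c ε → 0ℚ ≤ c → 0ℚ < ε → ∃ λ N → ∀ n → N ℕ.≤ n → ∀ (w : Weights c n) →
  ∣ d * mean w (binomial r) - d * expTerm ½ r ∣ ≤ ε
scaled-moment-close d r c ε 0≤c 0<ε = proj₁ m , λ n N≤n w →
  scaled-close d (mean w (binomial r)) (expTerm ½ r) ε (proj₂ m n N≤n w) (ℚ.<⇒≤ 0<ε)
  where
  m = moment-close r c (ε * inv (∣ d ∣ + 1ℚ)) 0≤c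
    (pos*pos ε (inv (∣ d ∣ + 1ℚ)) 0<ε (inv-pos (0≤+pos ∣ d ∣ (ℚ.0≤∣p∣ d))))

moment-sum-close : ∀ (D : ℕ → ℚ) R c ε → 0ℚ ≤ c → 0ℚ < ε → ∃ λ N → ∀ n → N ℕ.≤ n →
  ∀ (w : Weights c n) →
  ∣ ∑ℚ (upTo R) (λ r → D r * mean w (binomial r)) - ∑ℚ (upTo R) (λ r → D r * expTerm ½ r) ∣ ≤ ε
moment-sum-close D zero    c ε 0≤c 0<ε = 0 , λ _ _ _ → ℚ.<⇒≤ 0<ε
moment-sum-close D (suc R) c ε 0≤c 0<ε = proj₁ s ℕ.⊔ proj₁ m , λ n N≤n w → subst₂ _≤_
  (cong₂ (λ p q → ∣ p - q ∣) (sym (∑-upTo-last R (λ r → D r * mean w (binomial r))))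
    (sym (∑-upTo-last R (λ r → D r * expTerm ½ r))))
  (halves ε)
  (subst (λ p → ∣ p ∣ ≤ ε * ½ + ε * ½)
    (lem (∑ℚ (upTo R) (λ r → D r * mean w (binomial r))) (∑ℚ (upTo R) (λ r → D r * expTerm ½ r))
      (D R * mean w (binomial R)) (D R * expTerm ½ R))
    (ℚ.≤-trans (ℚ.∣p+q∣≤∣p∣+∣q∣
        (∑ℚ (upTo R) (λ r → D r * mean w (binomial r)) - ∑ℚ (upTo R) (λ r → D r * expTerm ½ r))
        (D R * mean w (binomial R) - D R * expTerm ½ R))
      (ℚ.+-mono-≤ (proj₂ s n (ℕ.≤-trans (ℕ.m≤m⊔n (proj₁ s) (proj₁ m)) N≤n) w)
        (proj₂ m n (ℕ.≤-trans (ℕ.m≤n⊔m (proj₁ s) (proj₁ m)) N≤n) w))))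
  where
  s = moment-sum-close D R c (ε * ½) 0≤c (half-pos ε 0<ε)
  m = scaled-moment-close (D R) R c (ε * ½) 0≤c (half-pos ε 0<ε)
  lem : ∀ a b c d → a - b + (c - d) ≡ a + c - (b + d)
  lem = solve-∀ ring


-- From moments to probabilities, uniformly in the parameters

module Uniform (c : ℚ) (0≤c : 0ℚ ≤ c) (g : ℕ → ℚ) (U : ℕ) (∣g∣≤1 : ∀ j → ∣ g j ∣ ≤ 1ℚ)
  (g≡0 : ∀ k → U ℕ.≤ k → g k ≡ 0ℚ) (ε : ℚ) (0<ε : 0ℚ < ε) where
  open Convolution ½
  open ℚ.≤-Reasoning

  δ η : ℚ
  -- Two quarters of ε go to Newton's remainder, one to the moments and one to the partial sums of
  -- e^(-1/2).
  δ = ε * ½ * ½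
  η = δ * inv (ι (suc U))

  0<δ : 0ℚ < δ
  0<δ = half-pos (ε * ½) (half-pos ε 0<ε)

  0<η : 0ℚ < η
  0<η = pos*pos δ (inv (ι (suc U))) 0<δ (inv-pos (ι-pos U))

  tail : ∃ λ I → ∀ m n → I ℕ.≤ m → I ℕ.≤ n → ∣ expSum (- ½) m - expSum (- ½) n ∣ < η
  tail = ExpCauchy.expSum-cauchy (- ½) η 0<η

  I M R : ℕ
  I = proj₁ tail
  M = suc (ceil ((ExpCauchy.C 1ℚ + ExpCauchy.C 1ℚ) * inv δ)) ℕ.⊔ ExpCauchy.N 1ℚ
  -- `M` makes `1 / (suc R) !` at most δ; `I` and `U` together keep the partial sum for every
  -- `k ≤ U` at least as long as `I`.
  R = I ℕ.+ M ℕ.+ U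

  D : ℕ → ℚ
  D r = differences r g 0

  moments : ∃ λ N → ∀ n → N ℕ.≤ n → ∀ (w : Weights c n) →
    ∣ ∑ℚ (upTo (suc R)) (λ r → D r * mean w (binomial r)) - ∑ℚ (upTo (suc R))
      (λ r → D r * expTerm ½ r) ∣ ≤ δ
  moments = moment-sum-close D (suc R) c δ 0≤c 0<δ

  last-moment : ∃ λ N → ∀ n → N ℕ.≤ n → ∀ (w : Weights c n) →
    ∣ pow (1ℚ + 1ℚ) (suc R) * mean w (binomial (suc R)) - pow (1ℚ + 1ℚ) (suc R) * expTerm ½ (suc R)
      ∣ ≤ δ
  last-moment = scaled-moment-close (pow (1ℚ + 1ℚ) (suc R)) (suc R) c δ 0≤c 0<δ

  -- One δ is the distance of the scaled last moment from its limit, the other bounds the limit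
  -- itself.
  remainder : ∀ n → proj₁ last-moment ℕ.≤ n → ∀ (w : Weights c n) →
    ∣ mean w g - ∑ℚ (upTo (suc R)) (λ r → D r * mean w (binomial r)) ∣ ≤ δ + δ
  remainder n h w = begin
    ∣ mean w g - ∑ℚ (upTo (suc R)) (λ r → D r * mean w (binomial r)) ∣
      ≡⟨ cong (λ p → ∣ mean w g - p ∣) (mean-newton w (suc R) g) ⟨
    ∣ mean w g - mean w (newton (suc R) g) ∣
      ≤⟨ mean-close w g (newton (suc R) g) (λ a → P * binomial (suc R) a)
           (newton-remainder (suc R) g (0≤pow (suc R) (0≤double 0≤1))
             (λ j → subst (∣ differences (suc R) g j ∣ ≤_) (ℚ.*-identityʳ P)
               (differences-bound (suc R) g ∣g∣≤1 j))) ⟩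
    mean w (λ a → P * binomial (suc R) a)
      ≡⟨ mean-scale w P (binomial (suc R)) ⟩
    X
      ≡⟨ lem X Y ⟩
    (X - Y) + Y
      ≤⟨ ℚ.+-mono-≤ (ℚ.≤-trans (p≤∣p∣ (X - Y)) (proj₂ last-moment n h w)) Y≤δ ⟩
    δ + δ ∎
    where
    P X Y : ℚ
    P = pow (1ℚ + 1ℚ) (suc R)
    X = P * mean w (binomial (suc R))
    Y = P * expTerm ½ (suc R)
    lem : ∀ x y → x ≡ x - y + y
    lem = solve-∀ ring
    Y≤δ : Y ≤ δ
    Y≤δ = subst (_≤ δ) (sym (expTerm-2^ (suc R))) (ℚ.≤-trans
      (p≤p+q (expTerm 1ℚ (suc R)) (expTerm 1ℚ (suc R)) (0≤expTerm 0≤1 (suc R)))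
      (ℚ.<⇒≤ (ExpCauchy.small 1ℚ δ 0<δ (suc R)
        (ℕ.m≤n⇒m≤1+n (ℕ.≤-trans (ℕ.m≤n+m M I) (ℕ.m≤m+n (I ℕ.+ M) U))))))

  -- Approximation `i` of the Poisson mass uses `i` terms of e^(-1/2), the Newton sum `suc (R ∸ k)`
  -- terms. Both numbers are at least `I`, so each of the `U` summands is off by at most η.
  poisson : ∀ i → I ℕ.≤ i → ∣ ∑ℚ (upTo (suc R)) (λ r → D r * expTerm ½ r) -
    ∑ℚ (upTo U) (λ k → g k * (expSum (- ½) i * expTerm ½ k)) ∣ ≤ δ
  poisson i I≤i = begin
    ∣ ∑ℚ (upTo (suc R)) (λ r → D r * expTerm ½ r) - ∑ℚ (upTo U) h ∣
      ≡⟨ cong (λ p → ∣ p - ∑ℚ (upTo U) h ∣) (trans (newton-poisson g R)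
           (∑-upTo-truncate (suc (I ℕ.+ M)) (λ k U≤k → trans
             (cong (λ p → p * expTerm ½ k * expSum (- ½) (suc (R ℕ.∸ k))) (g≡0 k U≤k))
             (lem₀ (expTerm ½ k) (expSum (- ½) (suc (R ℕ.∸ k))))))) ⟩
    ∣ ∑ℚ (upTo U) f - ∑ℚ (upTo U) h ∣
      ≡⟨ cong ∣_∣ (trans (lem₁ (∑ℚ (upTo U) f) (∑ℚ (upTo U) h))
           (trans (cong (∑ℚ (upTo U) f +_) (sym (∑-*ˡ (- 1ℚ) (upTo U) h)))
             (trans (sym (∑-+ (upTo U) f (λ k → (- 1ℚ) * h k)))
               (∑-cong (upTo U) (λ k → lem₂ (g k) (expTerm ½ k) (expSum (- ½) (suc (R ℕ.∸ k)))
                 (expSum (- ½) i)))))) ⟩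
    ∣ ∑ℚ (upTo U) e ∣
      ≤⟨ ∑-abs (upTo U) e ⟩
    ∑ℚ (upTo U) (λ k → ∣ e k ∣)
      ≤⟨ ∑-upTo-≤ U (λ k → ∣ e k ∣) ∣e∣≤η ⟩
    ι U * η
      ≤⟨ *-monoˡ η (ℚ.<⇒≤ 0<η) (ι-mono (ℕ.n≤1+n U)) ⟩
    ι (suc U) * (δ * inv (ι (suc U)))
      ≡⟨ lem₃ (ι (suc U)) δ (inv (ι (suc U))) ⟩
    ι (suc U) * inv (ι (suc U)) * δ
      ≡⟨ cong (_* δ) (inv-right (ι-pos U)) ⟩
    1ℚ * δ
      ≡⟨ ℚ.*-identityˡ δ ⟩
    δ ∎
    where
    f h e : ℕ → ℚ
    f k = g k * expTerm ½ k * expSum (- ½) (suc (R ℕ.∸ k))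
    h k = g k * (expSum (- ½) i * expTerm ½ k)
    e k = g k * expTerm ½ k * (expSum (- ½) (suc (R ℕ.∸ k)) - expSum (- ½) i)
    lem₀ : ∀ p q → 0ℚ * p * q ≡ 0ℚ
    lem₀ = solve-∀ ring
    lem₁ : ∀ p q → p - q ≡ p + (- 1ℚ) * q
    lem₁ = solve-∀ ring
    lem₂ : ∀ g e s x → g * e * s + (- 1ℚ) * (g * (x * e)) ≡ g * e * (s - x)
    lem₂ = solve-∀ ring
    lem₃ : ∀ u δ i → u * (δ * i) ≡ u * i * δ
    lem₃ = solve-∀ ring
    ∣e∣≤η : ∀ k → ∣ e k ∣ ≤ η
    ∣e∣≤η k with ℕ.≤-total U k
    ... | inj₁ U≤k = subst (_≤ η) (sym (cong ∣_∣ (trans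
      (cong (λ p → p * expTerm ½ k * (expSum (- ½) (suc (R ℕ.∸ k)) - expSum (- ½) i)) (g≡0 k U≤k))
      (lem₀ (expTerm ½ k) (expSum (- ½) (suc (R ℕ.∸ k)) - expSum (- ½) i))))) (ℚ.<⇒≤ 0<η)
    ... | inj₂ k≤U = begin
      ∣ e k ∣
        ≡⟨ trans (ℚ.∣p*q∣≡∣p∣*∣q∣ (g k * expTerm ½ k) d)
          (cong (_* ∣ d ∣) (ℚ.∣p*q∣≡∣p∣*∣q∣ (g k) (expTerm ½ k))) ⟩
      ∣ g k ∣ * ∣ expTerm ½ k ∣ * ∣ d ∣
        ≤⟨ *-mono-≤ (∣ g k ∣ * ∣ expTerm ½ k ∣) (1ℚ * 1ℚ) (∣ d ∣) η
             (0≤* (∣ g k ∣) (∣ expTerm ½ k ∣) (ℚ.0≤∣p∣ (g k)) (ℚ.0≤∣p∣ (expTerm ½ k))) (ℚ.<⇒≤ 0<η)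
             (*-mono-≤ (∣ g k ∣) 1ℚ (∣ expTerm ½ k ∣) 1ℚ (ℚ.0≤∣p∣ (g k)) 0≤1 (∣g∣≤1 k)
               (∣expTerm∣≤1 k))
             (ℚ.<⇒≤ (proj₂ tail (suc (R ℕ.∸ k)) i (ℕ.m≤n⇒m≤1+n I≤R∸k) I≤i)) ⟩
      1ℚ * 1ℚ * η
        ≡⟨ trans (cong (_* η) (ℚ.*-identityˡ 1ℚ)) (ℚ.*-identityˡ η) ⟩
      η ∎
      where
      d : ℚ
      d = expSum (- ½) (suc (R ℕ.∸ k)) - expSum (- ½) i
      I≤R∸k : I ℕ.≤ R ℕ.∸ k
      I≤R∸k = ℕ.≤-trans (ℕ.m≤m+n I M)
        (ℕ.≤-trans (ℕ.≤-reflexive (sym (ℕ.m+n∸n≡m (I ℕ.+ M) U))) (ℕ.∸-monoʳ-≤ R k≤U))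

  N : ℕ
  N = proj₁ moments ℕ.⊔ proj₁ last-moment

  close : ∀ n → N ℕ.≤ n → ∀ i → I ℕ.≤ i → ∀ (w : Weights c n) →
    ∣ mean w g - ∑ℚ (upTo U) (λ k → g k * (expSum (- ½) i * expTerm ½ k)) ∣ ≤ ε
  close n N≤n i I≤i w =
    subst (∣ mean w g - ∑ℚ (upTo U) (λ k → g k * (expSum (- ½) i * expTerm ½ k)) ∣ ≤_)
    (trans (ℚ.+-assoc (δ + δ) δ δ) (trans (cong₂ _+_ (halves (ε * ½)) (halves (ε * ½))) (halves ε)))
    (abs-triangle (mean w g) S₁ (∑ℚ (upTo U) (λ k → g k * (expSum (- ½) i * expTerm ½ k)))
      (abs-triangle (mean w g) S₀ S₁
        (remainder n (ℕ.≤-trans (ℕ.m≤n⊔m (proj₁ moments) (proj₁ last-moment)) N≤n) w)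
        (proj₂ moments n (ℕ.≤-trans (ℕ.m≤m⊔n (proj₁ moments) (proj₁ last-moment)) N≤n) w))
      (poisson i I≤i))
    where
    S₀ S₁ : ℚ
    S₀ = ∑ℚ (upTo (suc R)) (λ r → D r * mean w (binomial r))
    S₁ = ∑ℚ (upTo (suc R)) (λ r → D r * expTerm ½ r)

abstract
  uniform : ∀ c → 0ℚ ≤ c → ∀ g U → (∀ j → ∣ g j ∣ ≤ 1ℚ) → (∀ k → U ℕ.≤ k → g k ≡ 0ℚ) →
    ∀ ε → 0ℚ < ε → ∃ λ N → ∃ λ I → ∀ n → N ℕ.≤ n → ∀ i → I ℕ.≤ i → ∀ (w : Weights c n) →
    ∣ mean w g - ∑ℚ (upTo U) (λ k → g k * (expSum (- ½) i * expTerm ½ k)) ∣ ≤ ε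
  uniform c 0≤c g U ∣g∣≤1 g≡0 ε 0<ε = N , I , close
    where open Uniform c 0≤c g U ∣g∣≤1 g≡0 ε 0<ε

-- Passage to real parameters

seq-^ : ∀ x k i → seq (x ^ℝ k) i ≡ pow (seq x i) k
seq-^ x zero    i = refl
seq-^ x (suc k) i = cong (seq x i *_) (seq-^ x k i)

module _ (x : ℝ) (x∉ℕ : x ∉ℕ) where

  below : ℕ → ℚ
  below k = indicator (does (k ≤?[ x , x∉ℕ ]))

  ∣below∣≤1 : ∀ j → ∣ below j ∣ ≤ 1ℚ
  ∣below∣≤1 j with does (j ≤?[ x , x∉ℕ ])
  ... | true  = ℚ.≤-refl
  ... | false = 0≤1

  below≡0 : ∀ k → upperBound x ℕ.≤ k → below k ≡ 0ℚ
  below≡0 k U≤k = cong indicator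
    (does-≡ (k ≤?[ x , x∉ℕ ]) false (λ k≤x → ⊥-elim (k≤x (x<k (x<upperBound x)))) (λ ()))
    where
    x<k : x <ℝ fromℕ (upperBound x) → x <ℝ fromℕ k
    x<k (δ , 0<δ , K , h) = δ , 0<δ , K , λ i i≥ → ℚ.≤-trans (h i i≥) (ι-mono U≤k)

  seq-Poisson : ∀ q i → seq (Poisson q x x∉ℕ) i ≡
    ∑ℚ (upTo (upperBound x)) (λ k → below k * (expSum (- q) i * expTerm q k))
  seq-Poisson q i = trans (seq-∑ (filter (_≤?[ x , x∉ℕ ]) (upTo (upperBound x))) (poissonPMF q) i)
    (∑-filter (_≤?[ x , x∉ℕ ]) (upTo (upperBound x)) (λ k → expSum (- q) i * expTerm q k))

module Pointwise (α β : ℝ) (0<α : 0ℝ <ℝ α) (0<β : 0ℝ <ℝ β) (n i : ℕ) where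
  open Law α β 0<α 0<β
  open TableauSums (seq α i) (seq β i) using (wtℚ)

  seq-wt : ∀ (T : Filling n) → seq (wt T) i ≡ wtℚ T
  seq-wt T = cong₂ _*_ (seq-^ α (number alpha T) i) (seq-^ β (number beta T) i)

  seq-Z : seq (Z n) i ≡ ∑ℚ (tableaux n) wtℚ
  seq-Z = trans (seq-∑ (tableaux n) wt i) (∑-cong (tableaux n) seq-wt)

  seq-distribution : ∀ x x∉ℕ → seq (distribution n A⁽³⁾ x x∉ℕ) i ≡
    ∑ℚ (tableaux n) (λ T → wtℚ T * inv (seq (Z n) i) * below x x∉ℕ (A⁽³⁾ T))
  seq-distribution x x∉ℕ = trans (seq-∑ (filter (λ T → A⁽³⁾ T ≤?[ x , x∉ℕ ]) (tableaux n)) mass i)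
    (trans (∑-filter (λ T → A⁽³⁾ T ≤?[ x , x∉ℕ ]) (tableaux n) (λ T → seq (mass T) i))
      (∑-cong (tableaux n) (λ T →
        trans (ℚ.*-comm (below x x∉ℕ (A⁽³⁾ T)) (seq (wt T) i * inv (seq (Z n) i)))
        (cong (λ w → w * inv (seq (Z n) i) * below x x∉ℕ (A⁽³⁾ T)) (seq-wt T)))))

  weights : ∀ {δα δβ} → 0ℚ < δα → 0ℚ < δβ → δα ≤ seq α i → δβ ≤ seq β i → 0ℚ < seq (Z n) i →
    Weights (inv δα + inv δβ) n
  weights {δα} {δβ} 0<δα 0<δβ δα≤ δβ≤ 0<Zᵢ = record
    { α = seq α i ; β = seq β i ; a = inv (seq α i) ; b = inv (seq β i) ; z = inv (seq (Z n) i)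
    ; 0≤α = ℚ.<⇒≤ 0<αᵢ ; 0≤β = ℚ.<⇒≤ 0<βᵢ
    ; 0≤a = ℚ.<⇒≤ (inv-pos 0<αᵢ) ; 0≤b = ℚ.<⇒≤ (inv-pos 0<βᵢ)
    ; 0≤z = ℚ.<⇒≤ (inv-pos 0<Zᵢ)
    ; a≤c = ℚ.≤-trans (inv-anti 0<δα δα≤) (p≤p+q (inv δα) (inv δβ) (ℚ.<⇒≤ (inv-pos 0<δβ)))
    ; b≤c = ℚ.≤-trans (inv-anti 0<δβ δβ≤)
        (≤-by (inv δα) (ℚ.<⇒≤ (inv-pos 0<δα)) (ℚ.+-comm (inv δα) (inv δβ)))
    ; αa≡1 = inv-right 0<αᵢ ; βb≡1 = inv-right 0<βᵢ
    ; Zz≡1 = trans (cong (_* inv (seq (Z n) i)) (sym seq-Z)) (inv-right 0<Zᵢ)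
    }
    where
    0<αᵢ : 0ℚ < seq α i
    0<αᵢ = ℚ.<-≤-trans 0<δα δα≤
    0<βᵢ : 0ℚ < seq β i
    0<βᵢ = ℚ.<-≤-trans 0<δβ δβ≤

eventually-≥ : ∀ {x} (0<x : 0ℝ <ℝ x) i → proj₁ (proj₂ (proj₂ 0<x)) ℕ.≤ i → proj₁ 0<x ≤ seq x i
eventually-≥ {x} (δ , _ , _ , h) i i≥ = subst (_≤ seq x i) (ℚ.+-identityˡ δ) (h i i≥)

theorem4p3 : (α β : ℝ) (0<α : 0ℝ <ℝ α) (0<β : 0ℝ <ℝ β) →
    (λ n → Law.distribution α β 0<α 0<β n A⁽³⁾) ⟶ᵈ Poisson ½
theorem4p3 α β 0<α 0<β x x∉ℕ ε 0<ε = N , λ n N≤n →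
  -- `<ℝ` demands a rational gap at all late indices: half of `e` serves as the gap, the other half
  -- as the permitted error.
  e * ½ , half-pos e 0<e , bound n , λ i i≥ → final n N≤n i i≥
  where
  open Law α β 0<α 0<β
  e : ℚ
  e = proj₁ 0<ε
  0<e : 0ℚ < e
  0<e = proj₁ (proj₂ 0<ε)
  0<δα : 0ℚ < proj₁ 0<α
  0<δα = proj₁ (proj₂ 0<α)
  0<δβ : 0ℚ < proj₁ 0<β
  0<δβ = proj₁ (proj₂ 0<β)
  c : ℚ
  -- The eventual lower bounds of `α` and `β` bound the reciprocals of all late approximations, so
  -- that `c`, and with it `N`, is independent of `i`.
  c = inv (proj₁ 0<α) + inv (proj₁ 0<β)
  result : ∃ λ N → ∃ λ I → ∀ n → N ℕ.≤ n → ∀ i → I ℕ.≤ i → ∀ (w : Weights c n) →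
    ∣ mean w (below x x∉ℕ) - ∑ℚ (upTo (upperBound x))
      (λ k → below x x∉ℕ k * (expSum (- ½) i * expTerm ½ k)) ∣ ≤ e * ½
  result = uniform c
    (0≤+ (inv (proj₁ 0<α)) (inv (proj₁ 0<β)) (ℚ.<⇒≤ (inv-pos 0<δα)) (ℚ.<⇒≤ (inv-pos 0<δβ)))
    (below x x∉ℕ) (upperBound x) (∣below∣≤1 x x∉ℕ) (below≡0 x x∉ℕ) (e * ½) (half-pos e 0<e)
  N I Mα Mβ Mε : ℕ
  N = proj₁ result
  I = proj₁ (proj₂ result)
  Mα = proj₁ (proj₂ (proj₂ 0<α))
  Mβ = proj₁ (proj₂ (proj₂ 0<β))
  Mε = proj₁ (proj₂ (proj₂ 0<ε))
  MZ bound : ℕ → ℕ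
  MZ n = proj₁ (proj₂ (proj₂ (0<Z n)))
  -- The index, unlike `N`, may depend on `n`: `MZ n` is where the approximations of `Z n` are
  -- bounded away from 0.
  bound n = I ℕ.⊔ (Mα ℕ.⊔ (Mβ ℕ.⊔ (Mε ℕ.⊔ MZ n)))
  module _ (n : ℕ) (N≤n : N ℕ.≤ n) (i : ℕ) (i≥ : bound n ℕ.≤ i) where
    open Pointwise α β 0<α 0<β n i
    i≥₁ : Mα ℕ.⊔ (Mβ ℕ.⊔ (Mε ℕ.⊔ MZ n)) ℕ.≤ i
    i≥₁ = ℕ.m⊔n≤o⇒n≤o I _ i≥
    i≥₂ : Mβ ℕ.⊔ (Mε ℕ.⊔ MZ n) ℕ.≤ i
    i≥₂ = ℕ.m⊔n≤o⇒n≤o Mα _ i≥₁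
    i≥₃ : Mε ℕ.⊔ MZ n ℕ.≤ i
    i≥₃ = ℕ.m⊔n≤o⇒n≤o Mβ _ i≥₂
    w : Weights c n
    w = weights 0<δα 0<δβ
      (eventually-≥ {α} 0<α i (ℕ.m⊔n≤o⇒m≤o Mα _ i≥₁))
        (eventually-≥ {β} 0<β i (ℕ.m⊔n≤o⇒m≤o Mβ _ i≥₂))
      (ℚ.<-≤-trans (proj₁ (proj₂ (0<Z n))) (eventually-≥ {Z n} (0<Z n) i (ℕ.m⊔n≤o⇒n≤o Mε _ i≥₃)))
    final : ∣ seq (distribution n A⁽³⁾ x x∉ℕ) i - seq (Poisson ½ x x∉ℕ) i ∣ + e * ½ ≤ seq ε i
    final = ℚ.≤-trans
      (subst₂ (λ p q → ∣ p - q ∣ + e * ½ ≤ e * ½ + e * ½)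
        (sym (seq-distribution x x∉ℕ)) (sym (seq-Poisson x x∉ℕ ½ i))
        (ℚ.+-monoˡ-≤ (e * ½) (proj₂ (proj₂ result) n N≤n i (ℕ.m⊔n≤o⇒m≤o I _ i≥) w)))
      (subst (_≤ seq ε i) (sym (halves e)) (eventually-≥ {ε} 0<ε i (ℕ.m⊔n≤o⇒m≤o Mε _ i≥₃)))
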